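{- Fuglede's conjecture holds in $\mathbb{Z}_2^d$ for every $d \leq 6$, and fails in $\mathbb{Z}_2^d$ for every $d \geq 10$. That is, for $d\le 6$ every nonempty $E\subseteq\mathbb{Z}_2^d$ tiles $\mathbb{Z}_2^d$ if and only if it is spectral, while for each $d\ge 10$ there is a nonempty $E\subseteq\mathbb{Z}_2^d$ for which this equivalence fails.
   Context: $\mathbb{Z}_2^d$ is the $d$-dimensional vector space over the field $\mathbb{Z}_2$. A nonempty subset $E\subseteq\mathbb{Z}_2^d$ tiles $\mathbb{Z}_2^d$ if there is $T\subseteq\mathbb{Z}_2^d$ with $\bigcup_{t\in T}(E+t)=\mathbb{Z}_2^d$ and $(E+t)\cap(E+t')=\varnothing$ for distinct $t,t'\in T$. A nonempty subset $E$ is spectral if there is $\Lambda\subseteq\mathbb{Z}_2^d$ such that the functions $x\mapsto e^{2\pi i(\lambda\cdot x)/2}=(-1)^{\lambda\cdot x}$, $\lambda\in\Lambda$, restricted to $E$, form an orthogonal basis of the space of all functions $E\to\mathbb{C}$ with inner product $\langle f,g\rangle=\sum_{x\in E}f(x)\overline{g(x)}$; here $\lambda\cdot x=\sum_i\lambda_ix_i$. -}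

module Defs where

open import Data.Bool using (Bool; true; false; _xor_; _∧_; if_then_else_)
open import Data.Nat using (ℕ; zero; suc)
open import Data.Integer using (ℤ; +_; -_) renaming (_+_ to _+ℤ_)
open import Data.Vec using (Vec; []; _∷_; zipWith; foldr)
open import Data.List using (List; []; _∷_; _++_; map; filter; length) renaming (foldr to lfoldr)
open import Data.Product using (Σ; ∃; _×_; _,_)
open import Relation.Binary.PropositionalEquality using (_≡_; _≢_)
open import Relation.Nullary using (¬_)
open import Function.Bundles using (_⇔_)

Pt : ℕ → Set
Pt d = Vec Bool d

_⊕_ : ∀ {d} → Pt d → Pt d → Pt d
_⊕_ = zipWith _xor_

dot : ∀ {d} → Pt d → Pt d → Bool
dot l x = foldr _ _xor_ false (zipWith _∧_ l x)

Subset₂ : ℕ → Set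
Subset₂ d = Pt d → Bool

_∈ₛ_ : ∀ {d} → Pt d → Subset₂ d → Set
x ∈ₛ E = E x ≡ true

Nonempty : ∀ {d} → Subset₂ d → Set
Nonempty {d} E = ∃ λ (x : Pt d) → x ∈ₛ E

allPts : (d : ℕ) → List (Pt d)
allPts zero = [] ∷ []
allPts (suc d) = map (false ∷_) (allPts d) ++ map (true ∷_) (allPts d)

elems : ∀ {d} → Subset₂ d → List (Pt d)
elems {d} E = filter (λ x → Data.Bool._≟_ (E x) true) (allPts d)

card : ∀ {d} → Subset₂ d → ℕ
card E = length (elems E)

sgn : Bool → ℤ
sgn false = + 1
sgn true  = - (+ 1)

-- E tiles Z_2^d: there is T such that the translates E + t (t ∈ T) cover
-- Z_2^d and are pairwise disjoint. (x ∈ E + t  iff  x ⊕ t ∈ E.)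
Tiles : ∀ {d} → Subset₂ d → Set
Tiles {d} E = Σ (Subset₂ d) λ T →
  (∀ (x : Pt d) → ∃ λ (t : Pt d) → t ∈ₛ T × (x ⊕ t) ∈ₛ E)
  × (∀ (t t' : Pt d) → t ∈ₛ T → t' ∈ₛ T → t ≢ t' →
       ∀ (x : Pt d) → ¬ ((x ⊕ t) ∈ₛ E × (x ⊕ t') ∈ₛ E))

-- Inner product on functions E → C of the characters e_λ, e_μ with
-- e_λ(x) = (-1)^{λ·x}:  Σ_{x ∈ E} (-1)^{λ·x} (-1)^{μ·x}  (real, so no conjugation).
charInner : ∀ {d} → Subset₂ d → Pt d → Pt d → ℤ
charInner E l m = lfoldr (λ x acc → sgn (dot l x xor dot m x) +ℤ acc) (+ 0) (elems E)

-- E is spectral: there is Λ such that {e_λ|_E : λ ∈ Λ} is an orthogonal basis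
-- of the |E|-dimensional space C^E, i.e. the e_λ (λ ∈ Λ) are pairwise
-- orthogonal and there are exactly |E| of them (nonzero orthogonal vectors are
-- linearly independent, and each e_λ has norm |E| > 0 for nonempty E).
Spectral : ∀ {d} → Subset₂ d → Set
Spectral {d} E = Σ (Subset₂ d) λ Λ →
  (∀ (l m : Pt d) → l ∈ₛ Λ → m ∈ₛ Λ → l ≢ m → charInner E l m ≡ + 0)
  × card Λ ≡ card E

FugledeFor : ∀ {d} → Subset₂ d → Set
FugledeFor E = Tiles E ⇔ Spectral E

{-# OPTIONS --safe #-}
module Submission where

-- Fourier analysis on ℤ₂ᵈ.  Write n = |E|, N = 2ᵈ.  If (E, Λ) is a spectral pair then so is (Λ, E);
-- hence E contains no two points with difference h ≢ 0 whenever Λ̂(h) ≢ 0.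
--
-- If a tiling complement has 1, 2 or 4 points, differences of its points span a subgroup which is again
-- a complement, and the annihilator of that subgroup is a spectrum.  For d ≤ 6 the remaining tiles have
-- n ≤ 8.  A set of 1, 2, 4 or 8 points either maps bijectively onto some ℤ₂ᵏ by an affine map, so that it
-- tiles and is spectral, or consists of 8 points, six of which sum to 0; then Ê(ξ) ≢ 0 whenever ξ
-- separates the other two points, which excludes both properties.  The bijection exists because
-- the affine dependencies then form a doubly even code of length 8.
--
-- For spectral E with n ≢ N some Λ̂(t) ≢ 0, so 2n ≤ N.  Three rows of the character table give 4 ∣ n.  If
-- four points of Λ sum to 0, their characters agree on a set F of n/4 points of E, and off F they take
-- the values 1, 1, -1, -1.  Hence F̂, translated, is n/4 on the quadruple and 0 on the rest of Λ; its
-- parity gives 8 ∣ n for n > 4, and such quadruples exist for n ≥ 12 by counting differences.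
-- For n = 24 the sum of the points of F cuts the quadruple out of Λ by a hyperplane; two such
-- hyperplanes give a plane of nonzero frequencies, so that 4n ≤ N ≤ 64.  For n = 16, N = 64 a third
-- moment inequality yields such a plane, and it is a tiling complement.
--
-- For d ≥ 10 the Hadamard matrix of order 12 gives a spectral set of 12 points, and 12 ∤ 2ᵈ.

open import Defs
open import Data.Nat using (ℕ; _≤_)
open import Data.Product using (Σ; ∃; _×_)
open import Relation.Nullary using (¬_)

open import Data.Bool using (Bool; true; false; _xor_; _∧_; _∨_; not)
import Data.Bool.Properties as Bool
open import Data.Empty using (⊥; ⊥-elim)
open import Data.Fin using (Fin; zero; suc; toℕ; fromℕ<)
import Data.Fin.Properties as Fin
open import Data.Integer as ℤ hiding (suc; _≤_)
open import Data.Integer.Properties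
open import Data.Integer.Tactic.RingSolver using (solve-∀)
open import Data.List using (List; []; _∷_; length; filter; map; _++_) renaming (foldr to lfoldr)
import Data.List.Membership.DecPropositional as DecMembership
open import Data.List.Membership.Propositional using (_∈_; _∉_)
open import Data.List.Properties using (length-++; ++-identityʳ)
open import Data.List.Relation.Binary.Permutation.Propositional as Perm using (_↭_; ↭-sym; ↭-trans; ↭-reflexive)
open import Data.List.Relation.Binary.Permutation.Propositional.Properties using (shift; ++⁺; ↭-length)
open import Data.List.Relation.Unary.All as All using (All)
open import Data.List.Relation.Unary.Any using (here; there)
open import Data.Nat as ℕ using (zero; suc)
open import Data.Nat.Divisibility using (_∣_; divides; _∣?_)
open import Data.Nat.Primality using (prime[2]; euclidsLemma)
import Data.Nat.Properties as ℕ
open import Data.Product using (_,_; proj₁; proj₂)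
open import Data.Sum using (_⊎_; inj₁; inj₂)
open import Data.Vec as Vec using (Vec; []; _∷_; replicate; lookup; toList)
import Data.Vec.Properties as Vec
open import Function using (case_of_)
open import Function.Bundles using (mk⇔; Equivalence)
open import Relation.Binary.PropositionalEquality hiding ([_])
open import Relation.Nullary using (Dec; yes; no)
open import Relation.Nullary.Decidable using (does; from-yes; decidable-stable; ¬?; _×-dec_; _→-dec_; _⊎-dec_)
open ≡-Reasoning

private variable
  d k m : ℕ

-- The group ℤ₂ᵈ

𝟎 : Pt d
𝟎 = replicate _ false

⊕-comm : (a b : Pt d) → a ⊕ b ≡ b ⊕ a
⊕-comm []          []          = refl
⊕-comm (false ∷ a) (false ∷ b) = cong (_ ∷_) (⊕-comm a b)
⊕-comm (false ∷ a) (true  ∷ b) = cong (_ ∷_) (⊕-comm a b)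
⊕-comm (true  ∷ a) (false ∷ b) = cong (_ ∷_) (⊕-comm a b)
⊕-comm (true  ∷ a) (true  ∷ b) = cong (_ ∷_) (⊕-comm a b)

⊕-assoc : (a b c : Pt d) → (a ⊕ b) ⊕ c ≡ a ⊕ (b ⊕ c)
⊕-assoc []          []          []          = refl
⊕-assoc (false ∷ a) (_     ∷ b) (_     ∷ c) = cong (_ ∷_) (⊕-assoc a b c)
⊕-assoc (true  ∷ a) (false ∷ b) (_     ∷ c) = cong (_ ∷_) (⊕-assoc a b c)
⊕-assoc (true  ∷ a) (true  ∷ b) (false ∷ c) = cong (_ ∷_) (⊕-assoc a b c)
⊕-assoc (true  ∷ a) (true  ∷ b) (true  ∷ c) = cong (_ ∷_) (⊕-assoc a b c)

⊕-self : (a : Pt d) → a ⊕ a ≡ 𝟎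
⊕-self []          = refl
⊕-self (false ∷ a) = cong (_ ∷_) (⊕-self a)
⊕-self (true  ∷ a) = cong (_ ∷_) (⊕-self a)

⊕-identityˡ : (a : Pt d) → 𝟎 ⊕ a ≡ a
⊕-identityˡ []      = refl
⊕-identityˡ (_ ∷ a) = cong (_ ∷_) (⊕-identityˡ a)

⊕-identityʳ : (a : Pt d) → a ⊕ 𝟎 ≡ a
⊕-identityʳ a = trans (⊕-comm a 𝟎) (⊕-identityˡ a)

⊕-cancelˡ : (a b : Pt d) → a ⊕ (a ⊕ b) ≡ b
⊕-cancelˡ a b = trans (sym (⊕-assoc a a b)) (trans (cong (_⊕ b) (⊕-self a)) (⊕-identityˡ b))

⊕-cancelʳ : (a b : Pt d) → (a ⊕ b) ⊕ b ≡ a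
⊕-cancelʳ a b = trans (⊕-comm (a ⊕ b) b) (trans (cong (b ⊕_) (⊕-comm a b)) (⊕-cancelˡ b a))

⊕-cancel-mid : (a b c : Pt d) → (a ⊕ b) ⊕ (a ⊕ c) ≡ b ⊕ c
⊕-cancel-mid a b c =
  trans (cong (_⊕ (a ⊕ c)) (⊕-comm a b)) (trans (⊕-assoc b a (a ⊕ c)) (cong (b ⊕_) (⊕-cancelˡ a c)))

⊕≡𝟎⇒≡ : (a b : Pt d) → a ⊕ b ≡ 𝟎 → a ≡ b
⊕≡𝟎⇒≡ a b p = trans (sym (⊕-cancelʳ a b)) (trans (cong (_⊕ b) p) (⊕-identityˡ b))

-- Sums over ℤ₂ᵈ

∑ : (Pt d → ℤ) → ℤ
∑ {zero}  f = f []
∑ {suc d} f = ∑ (λ x → f (false ∷ x)) + ∑ (λ x → f (true ∷ x))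

∑-cong : {f g : Pt d → ℤ} → (∀ x → f x ≡ g x) → ∑ f ≡ ∑ g
∑-cong {zero}  p = p []
∑-cong {suc d} p = cong₂ _+_ (∑-cong (λ x → p (false ∷ x))) (∑-cong (λ x → p (true ∷ x)))

private
  interchange : ∀ a b c e → (a + b) + (c + e) ≡ (a + c) + (b + e)
  interchange = solve-∀

∑-+ : (f g : Pt d → ℤ) → ∑ (λ x → f x + g x) ≡ ∑ f + ∑ g
∑-+ {zero}  f g = refl
∑-+ {suc d} f g =
  trans (cong₂ _+_ (∑-+ (λ x → f (false ∷ x)) (λ x → g (false ∷ x)))
                   (∑-+ (λ x → f (true ∷ x)) (λ x → g (true ∷ x))))
        (interchange (∑ (λ x → f (false ∷ x))) _ _ _)

∑-*ˡ : (c : ℤ) (f : Pt d → ℤ) → ∑ (λ x → c * f x) ≡ c * ∑ f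
∑-*ˡ {zero}  c f = refl
∑-*ˡ {suc d} c f =
  trans (cong₂ _+_ (∑-*ˡ c (λ x → f (false ∷ x))) (∑-*ˡ c (λ x → f (true ∷ x))))
        (sym (*-distribˡ-+ c _ _))

∑-*ʳ : (c : ℤ) (f : Pt d → ℤ) → ∑ (λ x → f x * c) ≡ ∑ f * c
∑-*ʳ c f = trans (∑-cong (λ x → *-comm (f x) c)) (trans (∑-*ˡ c f) (*-comm c (∑ f)))

∑-neg : (f : Pt d → ℤ) → ∑ (λ x → - f x) ≡ - ∑ f
∑-neg f = trans (∑-cong (λ x → sym (-1*i≡-i (f x)))) (trans (∑-*ˡ -1ℤ f) (-1*i≡-i (∑ f)))

∑-- : (f g : Pt d → ℤ) → ∑ (λ x → f x - g x) ≡ ∑ f - ∑ g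
∑-- f g = trans (∑-+ f (λ x → - g x)) (cong (_+_ (∑ f)) (∑-neg g))

∑-0 : ∑ {d} (λ _ → 0ℤ) ≡ 0ℤ
∑-0 {zero}  = refl
∑-0 {suc d} = cong₂ _+_ (∑-0 {d}) (∑-0 {d})

∑-zero : {f : Pt d → ℤ} → (∀ x → f x ≡ 0ℤ) → ∑ f ≡ 0ℤ
∑-zero {d} p = trans (∑-cong p) (∑-0 {d})

∑-swap : ∀ {k} (f : Pt d → Pt k → ℤ) → ∑ (λ x → ∑ (f x)) ≡ ∑ (λ y → ∑ (λ x → f x y))
∑-swap {zero}  f = refl
∑-swap {suc d} f =
  trans (cong₂ _+_ (∑-swap (λ x → f (false ∷ x))) (∑-swap (λ x → f (true ∷ x))))
        (sym (∑-+ (λ y → ∑ (λ x → f (false ∷ x) y)) (λ y → ∑ (λ x → f (true ∷ x) y))))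

∑-shift : (a : Pt d) (f : Pt d → ℤ) → ∑ (λ x → f (a ⊕ x)) ≡ ∑ f
∑-shift []          f = refl
∑-shift (false ∷ a) f = cong₂ _+_ (∑-shift a (λ x → f (false ∷ x))) (∑-shift a (λ x → f (true ∷ x)))
∑-shift (true ∷ a)  f =
  trans (cong₂ _+_ (∑-shift a (λ x → f (true ∷ x))) (∑-shift a (λ x → f (false ∷ x))))
        (+-comm (∑ (λ x → f (true ∷ x))) _)

∑-mono-≤ : {f g : Pt d → ℤ} → (∀ x → f x ℤ.≤ g x) → ∑ f ℤ.≤ ∑ g
∑-mono-≤ {zero}  p = p []
∑-mono-≤ {suc d} p = +-mono-≤ (∑-mono-≤ (λ x → p (false ∷ x))) (∑-mono-≤ (λ x → p (true ∷ x)))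

∑-nonneg : {f : Pt d → ℤ} → (∀ x → 0ℤ ℤ.≤ f x) → 0ℤ ℤ.≤ ∑ f
∑-nonneg {d} p = ≤-trans (≤-reflexive (sym (∑-0 {d}))) (∑-mono-≤ p)

-- Recursion on the coordinates tries every point, so that later arguments may split into cases as
-- in classical logic.
search : {P : Pt d → Set} → (∀ x → Dec (P x)) → ∃ P ⊎ (∀ x → ¬ P x)
search {zero} P? with P? []
... | yes p = inj₁ ([] , p)
... | no ¬p = inj₂ λ { [] → ¬p }
search {suc d} P? with search (λ x → P? (false ∷ x))
... | inj₁ (x , p) = inj₁ (_ , p)
... | inj₂ ¬p with search (λ x → P? (true ∷ x))
...   | inj₁ (x , p) = inj₁ (_ , p)
...   | inj₂ ¬q = inj₂ λ { (false ∷ x) → ¬p x ; (true ∷ x) → ¬q x }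

∑-witness : {f g : Pt d → ℤ} → ∑ f < ∑ g → ∃ λ x → f x < g x
∑-witness {f = f} {g} lt with search (λ x → f x <? g x)
... | inj₁ w = w
... | inj₂ n = ⊥-elim (<⇒≱ lt (∑-mono-≤ (λ x → ≮⇒≥ (n x))))

-- A strict inequality at one point would survive summation. Counting arguments become pointwise
-- equalities this way: for tilings, for duality of spectral pairs and for vanishing
-- autocorrelations.
∑-≤-tight : {f g : Pt d → ℤ} → (∀ x → f x ℤ.≤ g x) → ∑ g ℤ.≤ ∑ f → ∀ x → f x ≡ g x
∑-≤-tight {zero} p q [] = ≤-antisym (p []) q
∑-≤-tight {suc d} {f} {g} p q = go
  where
  pf = ∑-mono-≤ (λ x → p (false ∷ x))
  pt = ∑-mono-≤ (λ x → p (true ∷ x))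
  cancel : ∀ {a b a' b'} → a ℤ.≤ a' → b ℤ.≤ b' → a' + b' ℤ.≤ a + b → (a' ℤ.≤ a) × (b' ℤ.≤ b)
  cancel {a} {b} {a'} {b'} u v w =
    ≮⇒≥ (λ lt → <⇒≱ (+-mono-<-≤ lt v) w) , ≮⇒≥ (λ lt → <⇒≱ (+-mono-≤-< u lt) w)
  go : ∀ x → f x ≡ g x
  go (false ∷ x) = ∑-≤-tight (λ x → p (false ∷ x)) (proj₁ (cancel pf pt q)) x
  go (true ∷ x)  = ∑-≤-tight (λ x → p (true ∷ x)) (proj₂ (cancel pf pt q)) x

-- The Kronecker delta, by recursion on coordinates so that it unfolds in step with `∑`.
δ : Pt d → Pt d → ℤ
δ []          []          = 1ℤ
δ (false ∷ a) (false ∷ x) = δ a x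
δ (false ∷ a) (true  ∷ x) = 0ℤ
δ (true  ∷ a) (false ∷ x) = 0ℤ
δ (true  ∷ a) (true  ∷ x) = δ a x

δ-refl : (a : Pt d) → δ a a ≡ 1ℤ
δ-refl []          = refl
δ-refl (false ∷ a) = δ-refl a
δ-refl (true  ∷ a) = δ-refl a

δ-≢ : {a x : Pt d} → a ≢ x → δ a x ≡ 0ℤ
δ-≢ {a = []}        {[]}        n = ⊥-elim (n refl)
δ-≢ {a = false ∷ a} {false ∷ x} n = δ-≢ (λ e → n (cong (false ∷_) e))
δ-≢ {a = false ∷ a} {true  ∷ x} n = refl
δ-≢ {a = true  ∷ a} {false ∷ x} n = refl
δ-≢ {a = true  ∷ a} {true  ∷ x} n = δ-≢ (λ e → n (cong (true ∷_) e))

∑-δ : (a : Pt d) (f : Pt d → ℤ) → ∑ (λ x → δ a x * f x) ≡ f a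
∑-δ [] f = *-identityˡ (f [])
∑-δ (false ∷ a) f =
  trans (cong₂ _+_ (∑-δ a (λ x → f (false ∷ x))) (∑-zero (λ x → *-zeroˡ (f (true ∷ x)))))
        (+-identityʳ _)
∑-δ (true ∷ a) f =
  trans (cong₂ _+_ (∑-zero (λ x → *-zeroˡ (f (false ∷ x)))) (∑-δ a (λ x → f (true ∷ x))))
        (+-identityˡ _)

_≟ᵖ_ : (x y : Pt d) → Dec (x ≡ y)
_≟ᵖ_ = Vec.≡-dec Bool._≟_

∑-only : (a : Pt d) {f : Pt d → ℤ} → (∀ x → x ≢ a → f x ≡ 0ℤ) → ∑ f ≡ f a
∑-only a {f} p = trans (∑-cong eq) (∑-δ a f)
  where
  eq : ∀ x → f x ≡ δ a x * f x
  eq x with a ≟ᵖ x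
  ... | yes refl = sym (trans (cong (_* f x) (δ-refl x)) (*-identityˡ (f x)))
  ... | no n = trans (p x (λ e → n (sym e))) (sym (trans (cong (_* f x) (δ-≢ n)) (*-zeroˡ (f x))))

∑-δ₁ : (a : Pt d) → ∑ (δ a) ≡ 1ℤ
∑-δ₁ a = trans (∑-only a (λ x n → δ-≢ (λ e → n (sym e)))) (δ-refl a)

δ-⊕ : (x a : Pt d) → δ 𝟎 (x ⊕ a) ≡ δ a x
δ-⊕ {d} x a with a ≟ᵖ x
... | yes refl = trans (cong (δ 𝟎) (⊕-self x)) (trans (δ-refl (𝟎 {d})) (sym (δ-refl x)))
... | no n = trans (δ-≢ λ e → n (sym (⊕≡𝟎⇒≡ x a (sym e)))) (sym (δ-≢ n))

N : ℕ → ℤ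
N d = + (2 ℕ.^ d)

N-suc : ∀ d → N (suc d) ≡ N d + N d
N-suc d = trans (pos-+ (2 ℕ.^ d) (2 ℕ.^ d ℕ.+ 0))
            (cong (_+_ (N d)) (trans (pos-+ (2 ℕ.^ d) 0) (+-identityʳ (N d))))

∑-const : (c : ℤ) → ∑ {d} (λ _ → c) ≡ N d * c
∑-const {zero}  c = sym (*-identityˡ c)
∑-const {suc d} c = trans (cong₂ _+_ (∑-const {d} c) (∑-const {d} c))
  (trans (sym (*-distribʳ-+ c (N d) (N d))) (cong (_* c) (sym (N-suc d))))

-- Characters and Fourier transform

χ : Pt d → Pt d → ℤ
χ ξ x = sgn (dot ξ x)

sgn-xor : ∀ a b → sgn (a xor b) ≡ sgn a * sgn b
sgn-xor false b     = sym (*-identityˡ (sgn b))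
sgn-xor true  false = refl
sgn-xor true  true  = refl

dot-comm : (a b : Pt d) → dot a b ≡ dot b a
dot-comm []      []      = refl
dot-comm (x ∷ a) (y ∷ b) = cong₂ _xor_ (Bool.∧-comm x y) (dot-comm a b)

dot-𝟎ʳ : (a : Pt d) → dot a 𝟎 ≡ false
dot-𝟎ʳ []          = refl
dot-𝟎ʳ (false ∷ a) = dot-𝟎ʳ a
dot-𝟎ʳ (true  ∷ a) = dot-𝟎ʳ a

dot-𝟎ˡ : (a : Pt d) → dot 𝟎 a ≡ false
dot-𝟎ˡ a = trans (dot-comm 𝟎 a) (dot-𝟎ʳ a)

dot-⊕ʳ : (a x y : Pt d) → dot a (x ⊕ y) ≡ dot a x xor dot a y
dot-⊕ʳ [] [] [] = refl
dot-⊕ʳ (e ∷ a) (b ∷ x) (c ∷ y) = trans (cong (((e ∧ (b xor c)) xor_)) (dot-⊕ʳ a x y)) (go e b c _ _)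
  where
  go : ∀ e b c u v → (e ∧ (b xor c)) xor (u xor v) ≡ ((e ∧ b) xor u) xor ((e ∧ c) xor v)
  go false b     c     u v = refl
  go true  false false u v = refl
  go true  false true  false v = refl
  go true  false true  true  v = refl
  go true  true  false false v = refl
  go true  true  false true  v = Bool.not-involutive v
  go true  true  true  false v = sym (Bool.not-involutive v)
  go true  true  true  true  v = refl

dot-⊕ˡ : (x y a : Pt d) → dot (x ⊕ y) a ≡ dot x a xor dot y a
dot-⊕ˡ x y a = trans (dot-comm (x ⊕ y) a)
  (trans (dot-⊕ʳ a x y) (cong₂ _xor_ (dot-comm a x) (dot-comm a y)))

χ-comm : (ξ x : Pt d) → χ ξ x ≡ χ x ξ
χ-comm ξ x = cong sgn (dot-comm ξ x)

χ-𝟎ʳ : (ξ : Pt d) → χ ξ 𝟎 ≡ 1ℤ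
χ-𝟎ʳ ξ = cong sgn (dot-𝟎ʳ ξ)

χ-𝟎ˡ : (x : Pt d) → χ 𝟎 x ≡ 1ℤ
χ-𝟎ˡ x = cong sgn (dot-𝟎ˡ x)

χ-⊕ʳ : (ξ x y : Pt d) → χ ξ (x ⊕ y) ≡ χ ξ x * χ ξ y
χ-⊕ʳ ξ x y = trans (cong sgn (dot-⊕ʳ ξ x y)) (sgn-xor (dot ξ x) (dot ξ y))

χ-⊕ˡ : (ξ η x : Pt d) → χ (ξ ⊕ η) x ≡ χ ξ x * χ η x
χ-⊕ˡ ξ η x = trans (cong sgn (dot-⊕ˡ ξ η x)) (sgn-xor (dot ξ x) (dot η x))

χ-sq : (ξ x : Pt d) → χ ξ x * χ ξ x ≡ 1ℤ
χ-sq ξ x with dot ξ x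
... | false = refl
... | true  = refl

-- If some coordinate of x is `true`, flipping that coordinate of ξ changes the sign, and the terms
-- cancel in pairs.
∑-χ : (x : Pt d) → ∑ (λ ξ → χ ξ x) ≡ N d * δ 𝟎 x
∑-χ [] = refl
∑-χ {suc d} (false ∷ x) = begin
  ∑ (λ ξ → χ ξ x) + ∑ (λ ξ → χ ξ x)  ≡⟨ cong₂ _+_ (∑-χ x) (∑-χ x) ⟩
  N d * δ 𝟎 x + N d * δ 𝟎 x          ≡⟨ *-distribʳ-+ (δ 𝟎 x) (N d) (N d) ⟨
  (N d + N d) * δ 𝟎 x                ≡⟨ cong (_* δ 𝟎 x) (N-suc d) ⟨
  N (suc d) * δ 𝟎 x                  ∎
∑-χ {suc d} (true ∷ x) = begin
  ∑ (λ ξ → χ ξ x) + ∑ (λ ξ → sgn (not (dot ξ x)))  ≡⟨ cong (_+_ (∑ (λ ξ → χ ξ x)))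
      (∑-cong (λ ξ → sgn-not (dot ξ x))) ⟩
  ∑ (λ ξ → χ ξ x) + ∑ (λ ξ → - χ ξ x)              ≡⟨ cong (_+_ (∑ (λ ξ → χ ξ x))) (∑-neg (λ ξ → χ ξ x)) ⟩
  ∑ (λ ξ → χ ξ x) - ∑ (λ ξ → χ ξ x)                ≡⟨ +-inverseʳ (∑ (λ ξ → χ ξ x)) ⟩
  0ℤ                                               ≡⟨ *-zeroʳ (N (suc d)) ⟨
  N (suc d) * 0ℤ                                   ∎
  where
  sgn-not : ∀ b → sgn (not b) ≡ - sgn b
  sgn-not false = refl
  sgn-not true  = refl

hat : (Pt d → ℤ) → Pt d → ℤ
hat f ξ = ∑ (λ x → f x * χ ξ x)

-- The usual convolution: in characteristic 2 the sum `a ⊕ x` is also the difference of x and a.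
conv : (Pt d → ℤ) → (Pt d → ℤ) → Pt d → ℤ
conv f g x = ∑ (λ a → f a * g (a ⊕ x))

hat-cong : {f g : Pt d → ℤ} → (∀ x → f x ≡ g x) → ∀ ξ → hat f ξ ≡ hat g ξ
hat-cong p ξ = ∑-cong (λ x → cong (_* χ ξ x) (p x))

hat-𝟎 : (f : Pt d → ℤ) → hat f 𝟎 ≡ ∑ f
hat-𝟎 f = ∑-cong (λ x → trans (cong (f x *_) (χ-𝟎ˡ x)) (*-identityʳ (f x)))

-- After interchanging the sums, the sum of `χ ξ (x ⊕ a)` over ξ is concentrated at x = a.
hat-inversion : (f : Pt d → ℤ) (a : Pt d) → ∑ (λ ξ → hat f ξ * χ ξ a) ≡ N d * f a
hat-inversion {d} f a = begin
  ∑ (λ ξ → hat f ξ * χ ξ a)                     ≡⟨ ∑-cong (λ ξ → ∑-*ʳ (χ ξ a) (λ x → f x * χ ξ x)) ⟨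
  ∑ (λ ξ → ∑ (λ x → f x * χ ξ x * χ ξ a))       ≡⟨ ∑-swap (λ ξ x → f x * χ ξ x * χ ξ a) ⟩
  ∑ (λ x → ∑ (λ ξ → f x * χ ξ x * χ ξ a))       ≡⟨ ∑-cong inner ⟩
  ∑ (λ x → δ a x * (N d * f x))                 ≡⟨ ∑-δ a (λ x → N d * f x) ⟩
  N d * f a                                     ∎
  where
  rearrange : ∀ u v w → u * (v * w) ≡ w * (v * u)
  rearrange = solve-∀
  inner : ∀ x → ∑ (λ ξ → f x * χ ξ x * χ ξ a) ≡ δ a x * (N d * f x)
  inner x = begin
    ∑ (λ ξ → f x * χ ξ x * χ ξ a)   ≡⟨ ∑-cong
        (λ ξ → trans (*-assoc (f x) _ _) (cong (f x *_) (sym (χ-⊕ʳ ξ x a)))) ⟩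
    ∑ (λ ξ → f x * χ ξ (x ⊕ a))     ≡⟨ ∑-*ˡ (f x) (λ ξ → χ ξ (x ⊕ a)) ⟩
    f x * ∑ (λ ξ → χ ξ (x ⊕ a))     ≡⟨ cong (f x *_) (trans (∑-χ (x ⊕ a)) (cong (N d *_) (δ-⊕ x a))) ⟩
    f x * (N d * δ a x)             ≡⟨ rearrange (f x) (N d) (δ a x) ⟩
    δ a x * (N d * f x)             ∎

∑-hat : (f : Pt d → ℤ) → ∑ (hat f) ≡ N d * f 𝟎
∑-hat f = trans (∑-cong (λ ξ → sym (trans (cong (hat f ξ *_) (χ-𝟎ʳ ξ)) (*-identityʳ (hat f ξ)))))
                (hat-inversion f 𝟎)

hat-conv : (f g : Pt d → ℤ) (ξ : Pt d) → hat (conv f g) ξ ≡ hat f ξ * hat g ξ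
hat-conv f g ξ = begin
  ∑ (λ x → ∑ (λ a → f a * g (a ⊕ x)) * χ ξ x)       ≡⟨ ∑-cong (λ x → ∑-*ʳ (χ ξ x) (λ a → f a * g (a ⊕ x))) ⟨
  ∑ (λ x → ∑ (λ a → f a * g (a ⊕ x) * χ ξ x))       ≡⟨ ∑-swap (λ x a → f a * g (a ⊕ x) * χ ξ x) ⟩
  ∑ (λ a → ∑ (λ x → f a * g (a ⊕ x) * χ ξ x))       ≡⟨ ∑-cong inner ⟩
  ∑ (λ a → f a * χ ξ a * hat g ξ)                   ≡⟨ ∑-*ʳ (hat g ξ) (λ a → f a * χ ξ a) ⟩
  hat f ξ * hat g ξ                                 ∎
  where
  rearrange : ∀ u v w z → u * v * (z * w) ≡ u * z * (v * w)
  rearrange = solve-∀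
  inner : ∀ a → ∑ (λ x → f a * g (a ⊕ x) * χ ξ x) ≡ f a * χ ξ a * hat g ξ
  inner a = begin
    ∑ (λ x → f a * g (a ⊕ x) * χ ξ x)              ≡⟨ ∑-cong
        (λ x → cong (λ y → f a * g (a ⊕ x) * χ ξ y) (⊕-cancelˡ a x)) ⟨
    ∑ (λ x → f a * g (a ⊕ x) * χ ξ (a ⊕ (a ⊕ x)))  ≡⟨ ∑-shift a (λ y → f a * g y * χ ξ (a ⊕ y)) ⟩
    ∑ (λ y → f a * g y * χ ξ (a ⊕ y))              ≡⟨ ∑-cong
        (λ y → trans (cong (f a * g y *_) (χ-⊕ʳ ξ a y)) (rearrange (f a) (g y) (χ ξ y) (χ ξ a))) ⟩
    ∑ (λ y → f a * χ ξ a * (g y * χ ξ y))          ≡⟨ ∑-*ˡ (f a * χ ξ a) (λ y → g y * χ ξ y) ⟩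
    f a * χ ξ a * hat g ξ                          ∎

-- The transform is self-adjoint because its kernel `χ` is symmetric.
∑-hat-swap : (f g : Pt d → ℤ) → ∑ (λ ξ → g ξ * hat f ξ) ≡ ∑ (λ x → f x * hat g x)
∑-hat-swap f g = begin
  ∑ (λ ξ → g ξ * ∑ (λ x → f x * χ ξ x))       ≡⟨ ∑-cong (λ ξ → ∑-*ˡ (g ξ) (λ x → f x * χ ξ x)) ⟨
  ∑ (λ ξ → ∑ (λ x → g ξ * (f x * χ ξ x)))     ≡⟨ ∑-swap (λ ξ x → g ξ * (f x * χ ξ x)) ⟩
  ∑ (λ x → ∑ (λ ξ → g ξ * (f x * χ ξ x)))     ≡⟨ ∑-cong
      (λ x → trans (∑-cong (λ ξ → trans (rearrange (g ξ) (f x) (χ ξ x))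
      (cong (λ u → f x * (g ξ * u)) (χ-comm ξ x)))) (∑-*ˡ (f x) (λ ξ → g ξ * χ x ξ))) ⟩
  ∑ (λ x → f x * hat g x)                     ∎
  where
  rearrange : ∀ u v w → u * (v * w) ≡ v * (u * w)
  rearrange = solve-∀

-- Indicator functions, autocorrelation and enumeration

ind : Bool → ℤ
ind true  = 1ℤ
ind false = 0ℤ

𝟙 : Subset₂ d → Pt d → ℤ
𝟙 A x = ind (A x)

size : Subset₂ d → ℤ
size A = ∑ (𝟙 A)

-- The autocorrelation: `R A h` counts the points x of A for which `x ⊕ h` is also in A, so each
-- unordered pair with difference h ≢ 𝟎 is counted twice.
R : Subset₂ d → Pt d → ℤ
R A = conv (𝟙 A) (𝟙 A)

ind-sq : ∀ b → ind b * ind b ≡ ind b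
ind-sq true  = refl
ind-sq false = refl

R-𝟎 : (A : Subset₂ d) → R A 𝟎 ≡ size A
R-𝟎 A = ∑-cong (λ x → trans (cong (λ y → 𝟙 A x * 𝟙 A y) (⊕-identityʳ x)) (ind-sq (A x)))

hat-R : (A : Subset₂ d) (ξ : Pt d) → hat (R A) ξ ≡ hat (𝟙 A) ξ * hat (𝟙 A) ξ
hat-R A = hat-conv (𝟙 A) (𝟙 A)

-- The square of the transform is the transform of `R A`; inversion at the origin then reads off
-- `R A 𝟎`.
parseval : (A : Subset₂ d) → ∑ (λ ξ → hat (𝟙 A) ξ * hat (𝟙 A) ξ) ≡ N d * size A
parseval {d} A = trans (∑-cong (λ ξ → sym (hat-R A ξ))) (trans (∑-hat (R A)) (cong (N d *_) (R-𝟎 A)))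

-- The same fold as in `charInner`, through which sums over `elems` become sums over the whole
-- group.
Sₗ : ∀ {X : Set} → (X → ℤ) → List X → ℤ
Sₗ g = lfoldr (λ x acc → g x + acc) 0ℤ

Sₗ-++ : ∀ {X : Set} (g : X → ℤ) xs ys → Sₗ g (xs ++ ys) ≡ Sₗ g xs + Sₗ g ys
Sₗ-++ g []       ys = sym (+-identityˡ _)
Sₗ-++ g (x ∷ xs) ys = trans (cong (_+_ (g x)) (Sₗ-++ g xs ys)) (sym (+-assoc (g x) _ _))

Sₗ-map : ∀ {X Y : Set} (g : Y → ℤ) (f : X → Y) xs → Sₗ g (map f xs) ≡ Sₗ (λ x → g (f x)) xs
Sₗ-map g f []       = refl
Sₗ-map g f (x ∷ xs) = cong (_+_ (g (f x))) (Sₗ-map g f xs)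

Sₗ-cong : ∀ {X : Set} {g h : X → ℤ} → (∀ x → g x ≡ h x) → ∀ xs → Sₗ g xs ≡ Sₗ h xs
Sₗ-cong p []       = refl
Sₗ-cong p (x ∷ xs) = cong₂ _+_ (p x) (Sₗ-cong p xs)

Sₗ-allPts : ∀ d (g : Pt d → ℤ) → Sₗ g (allPts d) ≡ ∑ g
Sₗ-allPts zero    g = +-identityʳ _
Sₗ-allPts (suc d) g =
  trans (Sₗ-++ g (map (false ∷_) (allPts d)) (map (true ∷_) (allPts d)))
        (cong₂ _+_ (trans (Sₗ-map g _ (allPts d)) (Sₗ-allPts d _))
                   (trans (Sₗ-map g _ (allPts d)) (Sₗ-allPts d _)))

Sₗ-filter : (E : Subset₂ d) (g : Pt d → ℤ) (xs : List (Pt d)) →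
            Sₗ g (filter (λ x → E x Bool.≟ true) xs) ≡ Sₗ (λ x → 𝟙 E x * g x) xs
Sₗ-filter E g [] = refl
Sₗ-filter E g (x ∷ xs) with E x
... | true  = cong₂ _+_ (sym (*-identityˡ (g x))) (Sₗ-filter E g xs)
... | false = trans (Sₗ-filter E g xs)
  (sym (trans (cong (_+ Sₗ (λ y → 𝟙 E y * g y) xs) (*-zeroˡ (g x))) (+-identityˡ _)))

Sₗ-elems : (E : Subset₂ d) (g : Pt d → ℤ) → Sₗ g (elems E) ≡ ∑ (λ x → 𝟙 E x * g x)
Sₗ-elems {d} E g = trans (Sₗ-filter E g (allPts d)) (Sₗ-allPts d _)

Sₗ-length : ∀ {X : Set} (xs : List X) → Sₗ (λ _ → 1ℤ) xs ≡ + length xs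
Sₗ-length []       = refl
Sₗ-length (x ∷ xs) = cong (_+_ 1ℤ) (Sₗ-length xs)

card≡size : (E : Subset₂ d) → + card E ≡ size E
card≡size E = trans (sym (Sₗ-length (elems E)))
  (trans (Sₗ-elems E (λ _ → 1ℤ)) (∑-cong (λ x → *-identityʳ (𝟙 E x))))

charInner≡hat : (E : Subset₂ d) (l m : Pt d) → charInner E l m ≡ hat (𝟙 E) (l ⊕ m)
charInner≡hat E l m = trans (Sₗ-cong (λ x → cong sgn (sym (dot-⊕ˡ l m x))) (elems E))
                            (Sₗ-elems E (χ (l ⊕ m)))

∈⇒𝟙 : (A : Subset₂ d) {x : Pt d} → x ∈ₛ A → 𝟙 A x ≡ 1ℤ
∈⇒𝟙 A p = cong ind p

𝟙⇒∈ : (A : Subset₂ d) {x : Pt d} → 𝟙 A x ≢ 0ℤ → x ∈ₛ A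
𝟙⇒∈ A {x} p with A x
... | true  = refl
... | false = ⊥-elim (p refl)

0≤ind : ∀ b → 0ℤ ℤ.≤ ind b
0≤ind true  = +≤+ ℕ.z≤n
0≤ind false = +≤+ ℕ.z≤n

ind≤1 : ∀ b → ind b ℤ.≤ 1ℤ
ind≤1 true  = ≤-refl
ind≤1 false = +≤+ ℕ.z≤n

ind-∧ : ∀ a b → ind (a ∧ b) ≡ ind a * ind b
ind-∧ true  true  = refl
ind-∧ true  false = refl
ind-∧ false b     = sym (*-zeroˡ (ind b))

size-≥0 : (A : Subset₂ d) → 0ℤ ℤ.≤ size A
size-≥0 A = ∑-nonneg (λ x → 0≤ind (A x))

size-subsingleton : (A : Subset₂ d) → (∀ x y → x ∈ₛ A → y ∈ₛ A → x ≡ y) → size A ℤ.≤ 1ℤ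
size-subsingleton {d} A u with search (λ x → A x Bool.≟ true)
... | inj₁ (a , p) = ≤-reflexive (trans (∑-only a off) (∈⇒𝟙 A p))
  where
  off : ∀ x → x ≢ a → 𝟙 A x ≡ 0ℤ
  off x n with A x in eq
  ... | true  = ⊥-elim (n (u x a eq p))
  ... | false = refl
... | inj₂ n = ≤-trans (≤-reflexive (∑-zero none)) (+≤+ ℕ.z≤n)
  where
  none : ∀ x → 𝟙 A x ≡ 0ℤ
  none x with A x in eq
  ... | true  = ⊥-elim (n x eq)
  ... | false = refl

∑-Sₗ-δ : (ps : List (Pt d)) → ∑ (λ x → Sₗ (λ p → δ p x) ps) ≡ + length ps
∑-Sₗ-δ {d} []   = ∑-0 {d}
∑-Sₗ-δ (p ∷ ps) = trans (∑-+ (δ p) (λ x → Sₗ (λ q → δ q x) ps)) (cong₂ _+_ (∑-δ₁ p) (∑-Sₗ-δ ps))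

0≤δ : (a x : Pt d) → 0ℤ ℤ.≤ δ a x
0≤δ a x with a ≟ᵖ x
... | yes refl = ≤-trans (+≤+ ℕ.z≤n) (≤-reflexive (sym (δ-refl x)))
... | no n     = ≤-reflexive (sym (δ-≢ n))

0≤Sₗ : ∀ {X : Set} {g : X → ℤ} → (∀ x → 0ℤ ℤ.≤ g x) → ∀ xs → 0ℤ ℤ.≤ Sₗ g xs
0≤Sₗ p []       = ≤-refl
0≤Sₗ p (x ∷ xs) = +-mono-≤ (p x) (0≤Sₗ p xs)

∈⇒1≤Sₗ : {x : Pt d} {ps : List (Pt d)} → x ∈ ps → 1ℤ ℤ.≤ Sₗ (λ p → δ p x) ps
∈⇒1≤Sₗ {x = x} {_ ∷ ps} (here refl) =
  +-mono-≤ (≤-reflexive (sym (δ-refl x))) (0≤Sₗ (λ p → 0≤δ p x) ps)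
∈⇒1≤Sₗ {x = x} {p ∷ ps} (there i) = +-mono-≤ (0≤δ p x) (∈⇒1≤Sₗ i)

-- The multiplicity function of ps has smaller total than the indicator of A, so at some point it is
-- smaller; there the indicator is 1 and the multiplicity 0.
fresh : (A : Subset₂ d) (ps : List (Pt d)) → + length ps < size A → ∃ λ x → x ∈ₛ A × x ∉ ps
fresh A ps lt with ∑-witness (subst (_< size A) (sym (∑-Sₗ-δ ps)) lt)
... | x , p = x , 𝟙⇒∈ A (λ e → <⇒≱ (subst (Sₗ (λ q → δ q x) ps <_) e p) (0≤Sₗ (λ q → 0≤δ q x) ps))
                , λ i → <⇒≱ p (≤-trans (ind≤1 (A x)) (∈⇒1≤Sₗ i))

N≢0 : ∀ d → N d ≢ 0ℤ
N≢0 zero ()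
N≢0 (suc d) e = N≢0 d (i≡0 (N d) (trans (sym (N-suc d)) e))
  where
  i≡0 : ∀ i → i + i ≡ 0ℤ → i ≡ 0ℤ
  i≡0 (+ zero) _ = refl
  i≡0 +[1+ n ] ()
  i≡0 -[1+ n ] ()

*-cancelˡ : ∀ {i j k} → i ≢ 0ℤ → i * j ≡ i * k → j ≡ k
*-cancelˡ {i} n = *-cancelˡ-≡ i _ _ {{≢-nonZero n}}

*-zero-cancelˡ : ∀ {i j} → i ≢ 0ℤ → i * j ≡ 0ℤ → j ≡ 0ℤ
*-zero-cancelˡ {i} n e = *-cancelˡ n (trans e (sym (*-zeroʳ i)))

Avoids : Subset₂ d → Pt d → Set
Avoids E h = ∀ x → x ∈ₛ E → (x ⊕ h) ∈ₛ E → ⊥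

avoids⇒R≡0 : (A : Subset₂ d) {h : Pt d} → Avoids A h → R A h ≡ 0ℤ
avoids⇒R≡0 A {h} av = ∑-zero term
  where
  term : ∀ x → 𝟙 A x * 𝟙 A (x ⊕ h) ≡ 0ℤ
  term x with A x in p | A (x ⊕ h) in q
  ... | true  | true  = ⊥-elim (av x p q)
  ... | true  | false = refl
  ... | false | b     = *-zeroˡ (ind b)

0≤ind*ind : ∀ a b → 0ℤ ℤ.≤ ind a * ind b
0≤ind*ind a b = subst (0ℤ ℤ.≤_) (ind-∧ a b) (0≤ind (a ∧ b))

0≤R : (A : Subset₂ d) (h : Pt d) → 0ℤ ℤ.≤ R A h
0≤R A h = ∑-nonneg (λ x → 0≤ind*ind (A x) (A (x ⊕ h)))

R≡0⇒avoids : (A : Subset₂ d) {h : Pt d} → R A h ≡ 0ℤ → Avoids A h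
R≡0⇒avoids {d} A {h} e x p q = contra
  (∑-≤-tight (λ y → 0≤ind*ind (A y) (A (y ⊕ h))) (≤-reflexive (trans e (sym (∑-0 {d})))) x)
  where
  contra : 0ℤ ≡ 𝟙 A x * 𝟙 A (x ⊕ h) → ⊥
  contra r rewrite p | q with r
  ... | ()

-- Tilings and spectra

∑-conv : (f g : Pt d → ℤ) → ∑ (conv f g) ≡ ∑ f * ∑ g
∑-conv f g = trans (sym (hat-𝟎 (conv f g))) (trans (hat-conv f g 𝟎) (cong₂ _*_ (hat-𝟎 f) (hat-𝟎 g)))

∑-1 : ∑ {d} (λ _ → 1ℤ) ≡ N d
∑-1 {d} = trans (∑-const {d} 1ℤ) (*-identityʳ (N d))

hat-1 : (ξ : Pt d) → ξ ≢ 𝟎 → hat (λ _ → 1ℤ) ξ ≡ 0ℤ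
hat-1 {d} ξ n = begin
  ∑ (λ x → 1ℤ * χ ξ x)  ≡⟨ ∑-cong (λ x → trans (*-identityˡ (χ ξ x)) (χ-comm ξ x)) ⟩
  ∑ (λ x → χ x ξ)       ≡⟨ ∑-χ ξ ⟩
  N d * δ 𝟎 ξ           ≡⟨ cong (N d *_) (δ-≢ (λ e → n (sym e))) ⟩
  N d * 0ℤ              ≡⟨ *-zeroʳ (N d) ⟩
  0ℤ                    ∎

meet : Subset₂ d → Subset₂ d → Pt d → Subset₂ d
meet T E x t = T t ∧ E (t ⊕ x)

conv-meet : (T E : Subset₂ d) (x : Pt d) → conv (𝟙 T) (𝟙 E) x ≡ size (meet T E x)
conv-meet T E x = ∑-cong (λ t → sym (ind-∧ (T t) (E (t ⊕ x))))

∧-true : ∀ {a b} → a ∧ b ≡ true → a ≡ true × b ≡ true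
∧-true {true} {true} _ = refl , refl

∧-true⁻ : ∀ {a b} → a ≡ true → b ≡ true → a ∧ b ≡ true
∧-true⁻ refl refl = refl

-- Covering is replaced by a count: disjoint translates whose sizes add up to `N d` leave no point
-- uncovered.
record Complements (T E : Subset₂ d) : Set where
  field
    sizes : size T * size E ≡ N d
    disjoint : ∀ {t t'} → t ∈ₛ T → t' ∈ₛ T → t ≢ t' → Avoids E (t ⊕ t')

module _ {T E : Subset₂ d} (C : Complements T E) where
  open Complements C

  private
    at-most-one : ∀ x → conv (𝟙 T) (𝟙 E) x ℤ.≤ 1ℤ
    at-most-one x = ≤-trans (≤-reflexive (conv-meet T E x)) (size-subsingleton (meet T E x) uniq)
      where
      uniq : ∀ s t → s ∈ₛ meet T E x → t ∈ₛ meet T E x → s ≡ t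
      uniq s t p q with s ≟ᵖ t
      ... | yes e = e
      ... | no n = ⊥-elim (disjoint (proj₁ (∧-true p)) (proj₁ (∧-true q)) n (s ⊕ x) (proj₂ (∧-true p))
              (subst (_∈ₛ E) (sym (trans (cong (_⊕ (s ⊕ t)) (⊕-comm s x))
                (trans (⊕-assoc x s (s ⊕ t)) (trans (cong (x ⊕_) (⊕-cancelˡ s t)) (⊕-comm x t)))))
                    (proj₂ (∧-true q))))

  -- The convolution counts the translates that contain x. Disjointness bounds it by 1, and its
  -- total is already `N d`.
  conv≡1 : ∀ x → conv (𝟙 T) (𝟙 E) x ≡ 1ℤ
  conv≡1 = ∑-≤-tight at-most-one
    (≤-reflexive (trans (∑-1 {d}) (trans (sym sizes) (sym (∑-conv (𝟙 T) (𝟙 E))))))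

  -- The constant function 1 has its transform supported at the origin.
  hat-product : ∀ ξ → ξ ≢ 𝟎 → hat (𝟙 T) ξ * hat (𝟙 E) ξ ≡ 0ℤ
  hat-product ξ n = trans (sym (hat-conv (𝟙 T) (𝟙 E) ξ)) (trans (hat-cong conv≡1 ξ) (hat-1 ξ n))

  complements⇒tiles : Tiles E
  complements⇒tiles = T , cover , disj
    where
    cover : ∀ x → ∃ λ t → t ∈ₛ T × (x ⊕ t) ∈ₛ E
    cover x =
      let t , p , _ = fresh (meet T E x) [] (<-≤-trans (+<+ (ℕ.s≤s ℕ.z≤n))
                        (≤-reflexive (trans (sym (conv≡1 x)) (conv-meet T E x))))
      in t , proj₁ (∧-true p) , subst (_∈ₛ E) (⊕-comm t x) (proj₂ (∧-true p))
    disj : ∀ t t' → t ∈ₛ T → t' ∈ₛ T → t ≢ t' → ∀ x → ¬ ((x ⊕ t) ∈ₛ E × (x ⊕ t') ∈ₛ E)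
    disj t t' p p' n x (q , q') = disjoint p p' n (x ⊕ t) q
      (subst (_∈ₛ E) (sym (trans (⊕-assoc x t (t ⊕ t')) (cong (x ⊕_) (⊕-cancelˡ t t')))) q')

tiles⇒complements : {E : Subset₂ d} → Tiles E → ∃ λ T → Complements T E
tiles⇒complements {d} {E} (T , cover , disj) = T , record { sizes = sizes ; disjoint = disjoint }
  where
  disjoint : ∀ {t t'} → t ∈ₛ T → t' ∈ₛ T → t ≢ t' → Avoids E (t ⊕ t')
  disjoint {t} {t'} p p' n x q q' = disj t t' p p' n (x ⊕ t)
    ( subst (_∈ₛ E) (sym (⊕-cancelʳ x t)) q
    , subst (_∈ₛ E) (sym (⊕-assoc x t t')) q')
  conv≡ : ∀ x → conv (𝟙 T) (𝟙 E) x ≡ 1ℤ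
  conv≡ x with cover x
  ... | t , p , q = trans (∑-only t off)
        (cong₂ _*_ (∈⇒𝟙 T p) (∈⇒𝟙 E (subst (_∈ₛ E) (⊕-comm x t) q)))
    where
    off : ∀ s → s ≢ t → 𝟙 T s * 𝟙 E (s ⊕ x) ≡ 0ℤ
    off s n with T s in ps | E (s ⊕ x) in qs
    ... | true  | true  = ⊥-elim (disj s t ps p n x (subst (_∈ₛ E) (⊕-comm s x) qs , q))
    ... | true  | false = refl
    ... | false | b     = *-zeroˡ (ind b)
  sizes : size T * size E ≡ N d
  sizes = trans (sym (∑-conv (𝟙 T) (𝟙 E))) (trans (∑-cong conv≡) (∑-1 {d}))

Orth : Subset₂ d → Subset₂ d → Set
Orth E Λ = ∀ {l m} → l ∈ₛ Λ → m ∈ₛ Λ → l ≢ m → hat (𝟙 E) (l ⊕ m) ≡ 0ℤ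

record SpectralPair (E Λ : Subset₂ d) : Set where
  field
    orth  : Orth E Λ
    sizes : size Λ ≡ size E

size≡⇒card≡ : (A B : Subset₂ d) → size A ≡ size B → card A ≡ card B
size≡⇒card≡ A B e = +-injective (trans (card≡size A) (trans e (sym (card≡size B))))

pair⇒spectral : {E Λ : Subset₂ d} → SpectralPair E Λ → Spectral E
pair⇒spectral {E = E} {Λ} P = Λ , (λ l m p q n → trans (charInner≡hat E l m) (orth p q n)) , size≡⇒card≡
    Λ E sizes
  where open SpectralPair P

spectral⇒pair : {E : Subset₂ d} → Spectral E → ∃ λ Λ → SpectralPair E Λ
spectral⇒pair {E = E} (Λ , o , c) = Λ , record
  { orth  = λ {l} {m} p q n → trans (sym (charInner≡hat E l m)) (o l m p q n)
  ; sizes = trans (sym (card≡size Λ)) (trans (cong +_ c) (card≡size E)) }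

-- At differences of Λ the characters are trivial on T, so the transform of T is |T| ≢ 0 there.
-- Since the product with the transform of E vanishes off the origin, the transform of E must
-- vanish.
complementary-pair : {E T Λ : Subset₂ d} → Complements T E → size Λ ≡ size E →
  (∀ {l m t} → l ∈ₛ Λ → m ∈ₛ Λ → t ∈ₛ T → χ (l ⊕ m) t ≡ 1ℤ) → Tiles E × Spectral E
complementary-pair {d} {E} {T} {Λ} C sz triv =
    complements⇒tiles C , pair⇒spectral (record { orth = orth ; sizes = sz })
  where
  size-T≢0 : size T ≢ 0ℤ
  size-T≢0 e = N≢0 d (trans (sym (Complements.sizes C)) (trans (cong (_* size E) e) (*-zeroˡ (size E))))
  orth : Orth E Λ
  orth {l} {m} p q n = *-zero-cancelˡ size-T≢0
    (trans (cong (_* hat (𝟙 E) (l ⊕ m)) (sym hat-T)) (hat-product C (l ⊕ m) (λ e → n (⊕≡𝟎⇒≡ l m e))))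
    where
    hat-T : hat (𝟙 T) (l ⊕ m) ≡ size T
    hat-T = ∑-cong term
      where
      term : ∀ t → 𝟙 T t * χ (l ⊕ m) t ≡ 𝟙 T t
      term t with T t in r
      ... | true  = trans (*-identityˡ (χ (l ⊕ m) t)) (triv p q r)
      ... | false = *-zeroˡ (χ (l ⊕ m) t)

-- Linear spans and annihilators

comb : Vec Bool k → Vec (Pt d) k → Pt d
comb []          []       = 𝟎
comb (true  ∷ c) (v ∷ vs) = v ⊕ comb c vs
comb (false ∷ c) (v ∷ vs) = comb c vs

ev : Vec (Pt d) k → Pt d → Pt k
ev vs x = Vec.map (λ v → dot v x) vs

dot-comb : (c : Pt k) (vs : Vec (Pt d) k) (x : Pt d) → dot (comb c vs) x ≡ dot c (ev vs x)
dot-comb []          []       x = dot-𝟎ˡ x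
dot-comb (true  ∷ c) (v ∷ vs) x = trans (dot-⊕ˡ v (comb c vs) x) (cong (dot v x xor_) (dot-comb c vs x))
dot-comb (false ∷ c) (v ∷ vs) x = dot-comb c vs x

comb-⊕ : (c e : Pt k) (vs : Vec (Pt d) k) → comb (c ⊕ e) vs ≡ comb c vs ⊕ comb e vs
comb-⊕ []          []          []       = sym (⊕-identityˡ 𝟎)
comb-⊕ (false ∷ c) (false ∷ e) (v ∷ vs) = comb-⊕ c e vs
comb-⊕ (true  ∷ c) (false ∷ e) (v ∷ vs) = trans (cong (v ⊕_) (comb-⊕ c e vs)) (sym (⊕-assoc v _ _))
comb-⊕ (false ∷ c) (true  ∷ e) (v ∷ vs) = trans (cong (v ⊕_) (comb-⊕ c e vs))
  (trans (sym (⊕-assoc v _ _)) (trans (cong (_⊕ comb e vs) (⊕-comm v _)) (⊕-assoc _ v _)))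
comb-⊕ (true  ∷ c) (true  ∷ e) (v ∷ vs) = trans (comb-⊕ c e vs) (sym (⊕-cancel-mid v _ _))

comb-𝟎 : (vs : Vec (Pt d) k) → comb 𝟎 vs ≡ 𝟎
comb-𝟎 []       = refl
comb-𝟎 (v ∷ vs) = comb-𝟎 vs

ev-⊕ : (vs : Vec (Pt d) k) (x y : Pt d) → ev vs (x ⊕ y) ≡ ev vs x ⊕ ev vs y
ev-⊕ []       x y = refl
ev-⊕ (v ∷ vs) x y = cong₂ _∷_ (dot-⊕ʳ v x y) (ev-⊕ vs x y)

Independent : Vec (Pt d) k → Set
Independent vs = ∀ c → comb c vs ≡ 𝟎 → c ≡ 𝟎

span : Vec (Pt d) k → Subset₂ d
span vs x with search (λ c → comb c vs ≟ᵖ x)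
... | inj₁ _ = true
... | inj₂ _ = false

∈-span : (vs : Vec (Pt d) k) {x : Pt d} → x ∈ₛ span vs → ∃ λ c → comb c vs ≡ x
∈-span vs {x} p with search (λ c → comb c vs ≟ᵖ x)
... | inj₁ w = w
∈-span vs {x} () | inj₂ _

-- Independence makes coefficients unique, so each point of the span is hit by exactly one c.
size-span : (vs : Vec (Pt d) k) → Independent vs → size (span vs) ≡ N k
size-span {d} {k} vs ind-vs = begin
  ∑ (𝟙 (span vs))                      ≡⟨ ∑-cong term ⟩
  ∑ (λ x → ∑ (λ c → δ (comb c vs) x))  ≡⟨ ∑-swap (λ x c → δ (comb c vs) x) ⟩
  ∑ (λ c → ∑ (δ (comb c vs)))          ≡⟨ ∑-cong (λ c → ∑-δ₁ (comb c vs)) ⟩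
  ∑ {k} (λ _ → 1ℤ)                     ≡⟨ ∑-1 {k} ⟩
  N k                                  ∎
  where
  term : ∀ x → 𝟙 (span vs) x ≡ ∑ (λ c → δ (comb c vs) x)
  term x with search (λ c → comb c vs ≟ᵖ x)
  ... | inj₁ (c , refl) = sym (trans (∑-only c off) (δ-refl (comb c vs)))
    where
    off : ∀ e → e ≢ c → δ (comb e vs) (comb c vs) ≡ 0ℤ
    off e n = δ-≢ (λ eq → n (⊕≡𝟎⇒≡ e c (ind-vs (e ⊕ c)
      (trans (comb-⊕ e c vs) (trans (cong (_⊕ comb c vs) eq) (⊕-self _))))))
  ... | inj₂ n = sym (∑-zero (λ c → δ-≢ (n c)))

ann : Vec (Pt d) k → Subset₂ d
ann vs x with ev vs x ≟ᵖ 𝟎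
... | yes _ = true
... | no  _ = false

∈-ann : (vs : Vec (Pt d) k) {x : Pt d} → x ∈ₛ ann vs → ev vs x ≡ 𝟎
∈-ann vs {x} p with ev vs x ≟ᵖ 𝟎
... | yes e = e
∈-ann vs {x} () | no _

-- Double counting of `χ (comb c vs) x`. Summed over c it gives `N k` on the annihilator and 0
-- elsewhere; summed over x it leaves only c = 𝟎, by independence.
size-ann : (vs : Vec (Pt d) k) → Independent vs → N k * size (ann vs) ≡ N d
size-ann {d} {k} vs ind-vs = begin
  N k * ∑ (𝟙 (ann vs))                 ≡⟨ ∑-*ˡ (N k) (𝟙 (ann vs)) ⟨
  ∑ (λ x → N k * 𝟙 (ann vs) x)         ≡⟨ ∑-cong term ⟩
  ∑ (λ x → ∑ (λ c → χ (comb c vs) x))  ≡⟨ ∑-swap (λ x c → χ (comb c vs) x) ⟩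
  ∑ (λ c → ∑ (λ x → χ (comb c vs) x))  ≡⟨ ∑-cong
      (λ c → trans (∑-cong (λ x → χ-comm (comb c vs) x)) (∑-χ (comb c vs))) ⟩
  ∑ (λ c → N d * δ 𝟎 (comb c vs))      ≡⟨ ∑-only 𝟎 off ⟩
  N d * δ 𝟎 (comb {k} 𝟎 vs)            ≡⟨ cong (N d *_) (trans (cong (δ 𝟎) (comb-𝟎 vs)) (δ-refl (𝟎 {d}))) ⟩
  N d * 1ℤ                             ≡⟨ *-identityʳ (N d) ⟩
  N d                                  ∎
  where
  off : ∀ c → c ≢ 𝟎 → N d * δ 𝟎 (comb c vs) ≡ 0ℤ
  off c n = trans (cong (N d *_) (δ-≢ (λ e → n (ind-vs c (sym e))))) (*-zeroʳ (N d))
  indicator : ∀ x → 𝟙 (ann vs) x ≡ δ 𝟎 (ev vs x)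
  indicator x with ev vs x ≟ᵖ 𝟎
  ... | yes e = sym (trans (cong (δ 𝟎) e) (δ-refl (𝟎 {k})))
  ... | no n  = sym (δ-≢ (λ e → n (sym e)))
  term : ∀ x → N k * 𝟙 (ann vs) x ≡ ∑ (λ c → χ (comb c vs) x)
  term x = trans (cong (N k *_) (indicator x)) (trans (sym (∑-χ (ev vs x)))
    (∑-cong (λ c → cong sgn (sym (dot-comb c vs x)))))

span⊥ann : (vs : Vec (Pt d) k) {s x : Pt d} → s ∈ₛ span vs → ev vs x ≡ 𝟎 → χ s x ≡ 1ℤ
span⊥ann vs {s} {x} p q with ∈-span vs p
... | c , refl = cong sgn (trans (dot-comb c vs x) (trans (cong (dot c) q) (dot-𝟎ʳ c)))

-- A nonempty set never avoids the difference 𝟎, so avoidance also yields independence. The span is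
-- then a complement by count, and the annihilator, on whose differences the span acts trivially, is
-- a spectrum.
span-complement : {E : Subset₂ d} (vs : Vec (Pt d) k) → Nonempty E → N k * size E ≡ N d →
  (∀ c → c ≢ 𝟎 → Avoids E (comb c vs)) → Tiles E × Spectral E
span-complement {d} {k} {E} vs (x , x∈E) sz av =
  complementary-pair {T = span vs} {Λ = ann vs}
    (record { sizes = trans (cong (_* size E) (size-span vs indep)) sz ; disjoint = disjoint })
    (*-cancelˡ (N≢0 k) (trans (size-ann vs indep) (sym sz)))
    (λ {l} {m} {t} p q r → trans (χ-comm (l ⊕ m) t) (span⊥ann vs r (ev-ann p q)))
  where
  indep : Independent vs
  indep c e with c ≟ᵖ 𝟎
  ... | yes p = p
  ... | no n = ⊥-elim (av c n x x∈E (subst (_∈ₛ E) (sym (trans (cong (x ⊕_) e) (⊕-identityʳ x))) x∈E))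
  ev-ann : ∀ {l m} → l ∈ₛ ann vs → m ∈ₛ ann vs → ev vs (l ⊕ m) ≡ 𝟎
  ev-ann {l} {m} p q = trans (ev-⊕ vs l m) (trans (cong₂ _⊕_ (∈-ann vs p) (∈-ann vs q)) (⊕-self 𝟎))
  disjoint : ∀ {t t'} → t ∈ₛ span vs → t' ∈ₛ span vs → t ≢ t' → Avoids E (t ⊕ t')
  disjoint p q n with ∈-span vs p | ∈-span vs q
  ... | c , refl | e , refl =
    subst (Avoids E) (comb-⊕ c e vs) (av (c ⊕ e) (λ z → n (cong (λ b → comb b vs) (⊕≡𝟎⇒≡ c e z))))

-- By count `ev vs` maps E bijectively onto ℤ₂ᵏ. Its kernel is a complement, and the functionals in
-- the span form a spectrum.
ann-complement : {E : Subset₂ d} (vs : Vec (Pt d) k) → Independent vs → size E ≡ N k →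
  (∀ {x y} → x ∈ₛ E → y ∈ₛ E → ev vs x ≡ ev vs y → x ≡ y) → Tiles E × Spectral E
ann-complement {d} {k} {E} vs indep sz inj =
  complementary-pair {T = ann vs} {Λ = span vs}
    (record { sizes = trans (*-comm (size (ann vs)) (size E))
        (trans (cong (_* size (ann vs)) sz) (size-ann vs indep))
            ; disjoint = disjoint })
    (trans (size-span vs indep) (sym sz))
    orthogonal
  where
  orthogonal : ∀ {l m t} → l ∈ₛ span vs → m ∈ₛ span vs → t ∈ₛ ann vs → χ (l ⊕ m) t ≡ 1ℤ
  orthogonal {l} {m} {t} p q r = trans (χ-⊕ˡ l m t)
    (cong₂ _*_ (span⊥ann vs p (∈-ann vs r)) (span⊥ann vs q (∈-ann vs r)))
  disjoint : ∀ {t t'} → t ∈ₛ ann vs → t' ∈ₛ ann vs → t ≢ t' → Avoids E (t ⊕ t')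
  disjoint {t} {t'} p q n x u v = n (⊕≡𝟎⇒≡ t t'
      (trans (sym (⊕-cancelˡ x (t ⊕ t'))) (trans (cong (x ⊕_) (sym same)) (⊕-self x))))
    where
    same : x ≡ x ⊕ (t ⊕ t')
    same = inj u v (sym (trans (ev-⊕ vs x (t ⊕ t')) (trans (cong (ev vs x ⊕_) (trans (ev-⊕ vs t t')
      (trans (cong₂ _⊕_ (∈-ann vs p) (∈-ann vs q)) (⊕-self 𝟎)))) (⊕-identityʳ _))))

0≤i*i : ∀ i → 0ℤ ℤ.≤ i * i
0≤i*i (+ zero)  = +≤+ ℕ.z≤n
0≤i*i +[1+ n ]  = +≤+ ℕ.z≤n
0≤i*i -[1+ n ]  = +≤+ ℕ.z≤n

i*i≡0⇒i≡0 : ∀ i → i * i ≡ 0ℤ → i ≡ 0ℤ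
i*i≡0⇒i≡0 i e with i*j≡0⇒i≡0∨j≡0 i e
... | inj₁ p = p
... | inj₂ p = p

0≤i*j : ∀ {i j} → 0ℤ ℤ.≤ i → 0ℤ ℤ.≤ j → 0ℤ ℤ.≤ i * j
0≤i*j {+ m} {+ n} p q = subst (0ℤ ℤ.≤_) (pos-* m n) (+≤+ ℕ.z≤n)

hat-size : (A : Subset₂ d) → hat (𝟙 A) 𝟎 ≡ size A
hat-size A = hat-𝟎 (𝟙 A)

module _ {E Λ : Subset₂ d} (P : SpectralPair E Λ) where
  open SpectralPair P

  spectrum-avoids : ∀ ξ → ξ ≢ 𝟎 → hat (𝟙 E) ξ ≢ 0ℤ → Avoids Λ ξ
  spectrum-avoids ξ n h x p q = h (subst (λ η → hat (𝟙 E) η ≡ 0ℤ) (⊕-cancelˡ x ξ)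
    (orth p q (λ e → n (trans (sym (⊕-cancelˡ x ξ)) (trans (cong (x ⊕_) (sym e)) (⊕-self x))))))

  -- ∑ R_Λ Ê² = ∑ R_E Λ̂²; orthogonality reduces the left side to its term at the origin, which equals
  -- the term at the origin on the right, so the other terms there, being nonnegative, vanish.
  dual : SpectralPair Λ E
  dual = record { orth = orth′ ; sizes = sym sizes }
    where
    f g : Pt d → ℤ
    f h = δ 𝟎 h * (R E 𝟎 * hat (R Λ) 𝟎)
    g h = R E h * hat (R Λ) h
    0≤g : ∀ h → 0ℤ ℤ.≤ g h
    0≤g h = 0≤i*j (0≤R E h) (subst (0ℤ ℤ.≤_) (sym (hat-R Λ h)) (0≤i*i (hat (𝟙 Λ) h)))
    f≤g : ∀ h → f h ℤ.≤ g h
    f≤g h with h ≟ᵖ 𝟎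
    ... | yes refl = ≤-reflexive (trans (cong (_* g 𝟎) (δ-refl (𝟎 {d}))) (*-identityˡ (g 𝟎)))
    ... | no n = ≤-trans (≤-reflexive (trans (cong (_* g 𝟎) (δ-≢ (λ e → n (sym e)))) (*-zeroˡ (g 𝟎))))
        (0≤g h)
    off : ∀ ξ → ξ ≢ 𝟎 → R Λ ξ * hat (R E) ξ ≡ 0ℤ
    off ξ n with hat (𝟙 E) ξ ≟ 0ℤ
    ... | yes e = trans (cong (R Λ ξ *_) (trans (hat-R E ξ) (cong (λ z → z * z) e))) (*-zeroʳ (R Λ ξ))
    ... | no z  = trans (cong (_* hat (R E) ξ) (avoids⇒R≡0 Λ (spectrum-avoids ξ n z)))
        (*-zeroˡ (hat (R E) ξ))
    corner : ∀ A → hat (R A) 𝟎 ≡ size A * size A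
    corner A = trans (hat-R A 𝟎) (cong₂ _*_ (hat-size A) (hat-size A))
    total : ∑ g ≡ ∑ f
    total = begin
      ∑ g                                ≡⟨ ∑-hat-swap (R E) (R Λ) ⟨
      ∑ (λ ξ → R Λ ξ * hat (R E) ξ)      ≡⟨ ∑-only 𝟎 off ⟩
      R Λ 𝟎 * hat (R E) 𝟎                ≡⟨ cong₂ _*_ (trans (R-𝟎 Λ) (trans sizes (sym (R-𝟎 E))))
          (trans (corner E) (trans (cong (λ z → z * z) (sym sizes)) (sym (corner Λ)))) ⟩
      R E 𝟎 * hat (R Λ) 𝟎                ≡⟨ ∑-δ {d} 𝟎 (λ _ → R E 𝟎 * hat (R Λ) 𝟎) ⟨
      ∑ f                                ∎
    tight : ∀ h → f h ≡ g h
    tight = ∑-≤-tight f≤g (≤-reflexive total)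
    orth′ : Orth Λ E
    orth′ {x} {y} p q n = i*i≡0⇒i≡0 _ (trans (sym (hat-R Λ h)) (*-zero-cancelˡ R≢0 g≡0))
      where
      h = x ⊕ y
      h≢𝟎 : h ≢ 𝟎
      h≢𝟎 e = n (⊕≡𝟎⇒≡ x y e)
      R≢0 : R E h ≢ 0ℤ
      R≢0 e = R≡0⇒avoids E e x p (subst (_∈ₛ E) (sym (⊕-cancelˡ x y)) q)
      g≡0 : g h ≡ 0ℤ
      g≡0 = trans (sym (tight h)) (trans (cong (_* g 𝟎) (δ-≢ (λ e → h≢𝟎 (sym e)))) (*-zeroˡ (g 𝟎)))

  hat-on-spectrum : ∀ {l m} → l ∈ₛ Λ → m ∈ₛ Λ → hat (𝟙 E) (l ⊕ m) ≡ size E * δ l m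
  hat-on-spectrum {l} {m} p q with l ≟ᵖ m
  ... | yes refl = trans (cong (hat (𝟙 E)) (⊕-self l)) (trans (hat-size E)
          (sym (trans (cong (size E *_) (δ-refl l)) (*-identityʳ (size E)))))
  ... | no n = trans (orth p q n) (sym (trans (cong (size E *_) (δ-≢ n)) (*-zeroʳ (size E))))

  -- By Parseval Ê cannot be supported at the origin unless E is everything.
  nonzero-frequency : size E ≢ 0ℤ → size E ≢ N d → ∃ λ ξ → ξ ≢ 𝟎 × hat (𝟙 E) ξ ≢ 0ℤ
  nonzero-frequency n≢0 n≢N with search (λ ξ → dec ξ)
    where
    dec : ∀ ξ → Dec (ξ ≢ 𝟎 × hat (𝟙 E) ξ ≢ 0ℤ)
    dec ξ with ξ ≟ᵖ 𝟎 | hat (𝟙 E) ξ ≟ 0ℤ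
    ... | yes e | _     = no (λ (p , _) → p e)
    ... | no _  | yes e = no (λ (_ , q) → q e)
    ... | no p  | no q  = yes (p , q)
  ... | inj₁ w = w
  ... | inj₂ none = ⊥-elim (n≢N (*-cancelˡ n≢0 (begin
      size E * size E                               ≡⟨ cong₂ _*_ (hat-size E) (hat-size E) ⟨
      hat (𝟙 E) 𝟎 * hat (𝟙 E) 𝟎                     ≡⟨ ∑-only 𝟎 off ⟨
      ∑ (λ ξ → hat (𝟙 E) ξ * hat (𝟙 E) ξ)           ≡⟨ parseval E ⟩
      N d * size E                                  ≡⟨ *-comm (N d) (size E) ⟩
      size E * N d                                  ∎)))
    where
    off : ∀ ξ → ξ ≢ 𝟎 → hat (𝟙 E) ξ * hat (𝟙 E) ξ ≡ 0ℤ
    off ξ n with hat (𝟙 E) ξ ≟ 0ℤ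
    ... | yes e = cong (λ z → z * z) e
    ... | no z  = ⊥-elim (none ξ (n , z))

-- Packing bounds from avoided differences

size-shift : (E : Subset₂ d) (t : Pt d) → ∑ (λ x → 𝟙 E (x ⊕ t)) ≡ size E
size-shift E t = trans (∑-cong (λ x → cong (𝟙 E) (⊕-comm x t))) (∑-shift t (𝟙 E))

-- E and its translate by t are disjoint.
avoids⇒2n≤N : (E : Subset₂ d) (t : Pt d) → Avoids E t → size E + size E ℤ.≤ N d
avoids⇒2n≤N {d} E t av = ≤-trans (≤-reflexive
    (trans (cong (_+_ (size E)) (sym (size-shift E t))) (sym (∑-+ (𝟙 E) (λ x → 𝟙 E (x ⊕ t))))))
    (≤-trans (∑-mono-≤ term) (≤-reflexive (∑-1 {d})))
  where
  term : ∀ x → 𝟙 E x + 𝟙 E (x ⊕ t) ℤ.≤ 1ℤ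
  term x with E x in p | E (x ⊕ t) in q
  ... | true  | true  = ⊥-elim (av x p q)
  ... | true  | false = ≤-refl
  ... | false | true  = ≤-refl
  ... | false | false = +≤+ ℕ.z≤n

-- The four translates of E by 𝟎, s, t and `s ⊕ t` are pairwise disjoint.
avoids-plane⇒4n≤N : (E : Subset₂ d) (s t : Pt d) → Avoids E s → Avoids E t → Avoids E (s ⊕ t) →
  (size E + size E) + (size E + size E) ℤ.≤ N d
avoids-plane⇒4n≤N {d} E s t as at ast = ≤-trans (≤-reflexive (sym total))
    (≤-trans (∑-mono-≤ term) (≤-reflexive (∑-1 {d})))
  where
  f : Pt d → ℤ
  f x = (𝟙 E x + 𝟙 E (x ⊕ s)) + (𝟙 E (x ⊕ t) + 𝟙 E (x ⊕ (s ⊕ t)))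
  total : ∑ f ≡ (size E + size E) + (size E + size E)
  total = trans (∑-+ (λ x → 𝟙 E x + 𝟙 E (x ⊕ s)) (λ x → 𝟙 E (x ⊕ t) + 𝟙 E (x ⊕ (s ⊕ t)))) (cong₂ _+_
    (trans (∑-+ (𝟙 E) (λ x → 𝟙 E (x ⊕ s))) (cong (_+_ (size E)) (size-shift E s)))
    (trans (∑-+ (λ x → 𝟙 E (x ⊕ t)) (λ x → 𝟙 E (x ⊕ (s ⊕ t))))
        (cong₂ _+_ (size-shift E t) (size-shift E (s ⊕ t)))))
  move : ∀ {x u v h} → (x ⊕ v) ∈ₛ E → v ≡ u ⊕ h → ((x ⊕ u) ⊕ h) ∈ₛ E
  move {x} {u} {v} {h} p refl = subst (_∈ₛ E) (sym (⊕-assoc x u h)) p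
  st : ∀ x → (x ⊕ s) ∈ₛ E → (x ⊕ t) ∈ₛ E → ⊥
  st x p q = ast (x ⊕ s) p (move q (sym (⊕-cancelˡ s t)))
  s-st : ∀ x → (x ⊕ s) ∈ₛ E → (x ⊕ (s ⊕ t)) ∈ₛ E → ⊥
  s-st x p q = at (x ⊕ s) p (move q refl)
  t-st : ∀ x → (x ⊕ t) ∈ₛ E → (x ⊕ (s ⊕ t)) ∈ₛ E → ⊥
  t-st x p q = as (x ⊕ t) p (move q (⊕-comm s t))
  term : ∀ x → f x ℤ.≤ 1ℤ
  term x with E x in p | E (x ⊕ s) in q | E (x ⊕ t) in r | E (x ⊕ (s ⊕ t)) in u
  ... | true  | true  | _     | _     = ⊥-elim (as x p q)
  ... | true  | _     | true  | _     = ⊥-elim (at x p r)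
  ... | true  | _     | _     | true  = ⊥-elim (ast x p u)
  ... | _     | true  | true  | _     = ⊥-elim (st x q r)
  ... | _     | true  | _     | true  = ⊥-elim (s-st x q u)
  ... | _     | _     | true  | true  = ⊥-elim (t-st x r u)
  ... | true  | false | false | false = ≤-refl
  ... | false | true  | false | false = ≤-refl
  ... | false | false | true  | false = ≤-refl
  ... | false | false | false | true  = ≤-refl
  ... | false | false | false | false = +≤+ ℕ.z≤n

-- Sections by two characters and sums of signs modulo 4

section : Subset₂ d → Pt d → Pt d → Subset₂ d
section A a b x = A x ∧ (not (dot a x) ∧ not (dot b x))

-- Four times the indicator of the common kernel of a and b is (1 + χ a)(1 + χ b); expanding the
-- product shifts the frequency by 𝟎, a, b and `a ⊕ b`.
hat-section : (A : Subset₂ d) (a b ξ : Pt d) →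
  + 4 * hat (𝟙 (section A a b)) ξ ≡
  (hat (𝟙 A) ξ + hat (𝟙 A) (a ⊕ ξ)) + (hat (𝟙 A) (b ⊕ ξ) + hat (𝟙 A) ((a ⊕ b) ⊕ ξ))
hat-section A a b ξ = trans (sym (∑-*ˡ (+ 4) (λ x → 𝟙 (section A a b) x * χ ξ x))) (trans (∑-cong term)
    (trans (∑-+ (λ x → t₀ x + t₁ x) (λ x → t₂ x + t₃ x)) (cong₂ _+_ (∑-+ t₀ t₁) (∑-+ t₂ t₃))))
  where
  t₀ t₁ t₂ t₃ : Pt _ → ℤ
  t₀ x = 𝟙 A x * χ ξ x
  t₁ x = 𝟙 A x * χ (a ⊕ ξ) x
  t₂ x = 𝟙 A x * χ (b ⊕ ξ) x
  t₃ x = 𝟙 A x * χ ((a ⊕ b) ⊕ ξ) x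
  expand : ∀ p u v w → (p * w + p * (u * w)) + (p * (v * w) + p * (u * v * w)) ≡ p *
      ((1ℤ + u) * (1ℤ + v)) * w
  expand = solve-∀
  move : ∀ p u w → + 4 * (p * u * w) ≡ p * (+ 4 * u) * w
  move = solve-∀
  four : ∀ u v → + 4 * ind (not u ∧ not v) ≡ (1ℤ + sgn u) * (1ℤ + sgn v)
  four false false = refl
  four false true  = refl
  four true  false = refl
  four true  true  = refl
  term : ∀ x → + 4 * (𝟙 (section A a b) x * χ ξ x) ≡ (t₀ x + t₁ x) + (t₂ x + t₃ x)
  term x = begin
    + 4 * (𝟙 (section A a b) x * χ ξ x)
      ≡⟨ cong (λ z → + 4 * (z * χ ξ x)) (ind-∧ (A x) _) ⟩
    + 4 * (𝟙 A x * ind (not (dot a x) ∧ not (dot b x)) * χ ξ x)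
      ≡⟨ move (𝟙 A x) _ (χ ξ x) ⟩
    𝟙 A x * (+ 4 * ind (not (dot a x) ∧ not (dot b x))) * χ ξ x
      ≡⟨ cong (λ z → 𝟙 A x * z * χ ξ x) (four (dot a x) (dot b x)) ⟩
    𝟙 A x * ((1ℤ + χ a x) * (1ℤ + χ b x)) * χ ξ x
      ≡⟨ expand (𝟙 A x) (χ a x) (χ b x) (χ ξ x) ⟨
    (t₀ x + 𝟙 A x * (χ a x * χ ξ x)) + (𝟙 A x * (χ b x * χ ξ x) + 𝟙 A x * (χ a x * χ b x * χ ξ x))
      ≡⟨ cong₂ _+_ (cong (λ z → t₀ x + 𝟙 A x * z) (χ-⊕ˡ a ξ x))
          (cong₂ (λ y z → 𝟙 A x * y + 𝟙 A x * z) (χ-⊕ˡ b ξ x)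
            (trans (χ-⊕ˡ (a ⊕ b) ξ x) (cong (_* χ ξ x) (χ-⊕ˡ a b x)))) ⟨
    (t₀ x + t₁ x) + (t₂ x + t₃ x) ∎

-- By duality the transform of Λ vanishes at the differences of the three points. In the section
-- identity at the origin only |Λ| survives, and it is four times the size of a section.
three-points⇒4∣size : {E Λ : Subset₂ d} → SpectralPair E Λ → ∀ {x y z} → x ∈ₛ E → y ∈ₛ E → z ∈ₛ E →
  x ≢ y → x ≢ z → y ≢ z → ∃ λ m → size E ≡ + 4 * m
three-points⇒4∣size {E = E} {Λ} P {x} {y} {z} p q r x≢y x≢z y≢z = hat (𝟙 S) 𝟎 , sym (begin
  + 4 * hat (𝟙 S) 𝟎       ≡⟨ hat-section Λ (x ⊕ y) (x ⊕ z) 𝟎 ⟩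
  (hat (𝟙 Λ) 𝟎 + hat (𝟙 Λ) ((x ⊕ y) ⊕ 𝟎)) + (hat (𝟙 Λ) ((x ⊕ z) ⊕ 𝟎) + hat (𝟙 Λ) (((x ⊕ y) ⊕ (x ⊕ z)) ⊕ 𝟎))
                          ≡⟨ cong₂ _+_ (cong₂ _+_ (hat-size Λ) (vanish p q x≢y refl))
                               (cong₂ _+_ (vanish p r x≢z refl) (vanish q r y≢z (⊕-cancel-mid x y z))) ⟩
  (size Λ + 0ℤ) + 0ℤ      ≡⟨ trans (+-identityʳ _) (+-identityʳ _) ⟩
  size Λ                  ≡⟨ SpectralPair.sizes P ⟩
  size E                  ∎)
  where
  S = section Λ (x ⊕ y) (x ⊕ z)
  vanish : ∀ {u v w} → u ∈ₛ E → v ∈ₛ E → u ≢ v → w ≡ u ⊕ v → hat (𝟙 Λ) (w ⊕ 𝟎) ≡ 0ℤ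
  vanish {u} {v} p q n refl = trans (cong (hat (𝟙 Λ)) (⊕-identityʳ (u ⊕ v)))
      (SpectralPair.orth (dual P) p q n)

⨁ : List (Pt d) → Pt d
⨁ = lfoldr _⊕_ 𝟎

-- A product of signs is determined by their sum modulo 4.
χ-⨁-mod4 : (ξ : Pt d) (qs : List (Pt d)) →
  ∃ λ z → + length qs - Sₗ (χ ξ) qs ≡ + 4 * z + (1ℤ - χ ξ (⨁ qs))
χ-⨁-mod4 ξ [] = 0ℤ , sym (trans (cong (λ u → + 4 * 0ℤ + (1ℤ - u)) (χ-𝟎ʳ ξ)) refl)
χ-⨁-mod4 ξ (q ∷ qs) with χ-⨁-mod4 ξ qs
... | z , e = z + w , (begin
  + suc (length qs) - (χ ξ q + Sₗ (χ ξ) qs)                   ≡⟨ rearrange (+ length qs) (χ ξ q)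
      (Sₗ (χ ξ) qs) ⟩
  (1ℤ - χ ξ q) + (+ length qs - Sₗ (χ ξ) qs)                  ≡⟨ cong (_+_ (1ℤ - χ ξ q)) e ⟩
  (1ℤ - χ ξ q) + (+ 4 * z + (1ℤ - χ ξ (⨁ qs)))                ≡⟨ step z (χ ξ q) (χ ξ (⨁ qs)) ⟩
  + 4 * z + (1ℤ - χ ξ q) * (1ℤ - χ ξ (⨁ qs)) + (1ℤ - χ ξ q * χ ξ (⨁ qs))
    ≡⟨ cong₂ (λ u v → + 4 * z + u + (1ℤ - v)) (four (dot ξ q) (dot ξ (⨁ qs))) (sym (χ-⊕ʳ ξ q (⨁ qs))) ⟩
  + 4 * z + + 4 * w + (1ℤ - χ ξ (q ⊕ ⨁ qs))                   ≡⟨ cong (_+ (1ℤ - χ ξ (q ⊕ ⨁ qs)))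
      (*-distribˡ-+ (+ 4) z w) ⟨
  + 4 * (z + w) + (1ℤ - χ ξ (q ⊕ ⨁ qs))                       ∎)
  where
  w = ind (dot ξ q ∧ dot ξ (⨁ qs))
  four : ∀ a b → (1ℤ - sgn a) * (1ℤ - sgn b) ≡ + 4 * ind (a ∧ b)
  four false b     = refl
  four true  false = refl
  four true  true  = refl
  rearrange : ∀ l c s → (1ℤ + l) - (c + s) ≡ (1ℤ - c) + (l - s)
  rearrange = solve-∀
  step : ∀ z a b → (1ℤ - a) + (+ 4 * z + (1ℤ - b)) ≡ + 4 * z + (1ℤ - a) * (1ℤ - b) + (1ℤ - a * b)
  step = solve-∀

χ-⨁-elems-mod4 : (F : Subset₂ d) (ξ : Pt d) →
  ∃ λ z → size F - hat (𝟙 F) ξ ≡ + 4 * z + (1ℤ - χ ξ (⨁ (elems F)))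
χ-⨁-elems-mod4 F ξ with χ-⨁-mod4 ξ (elems F)
... | z , e = z , trans (cong₂ _-_ (sym (card≡size F)) (sym (Sₗ-elems F (χ ξ)))) e

-- For h ≢ 𝟎 this is the indicator of the pair l, `l ⊕ h`.
pairδ : Pt d → Pt d → Pt d → ℤ
pairδ h l μ = δ l μ + δ (l ⊕ h) μ

pairδ-∈ : ∀ {h l μ : Pt d} → h ≢ 𝟎 → (l ≡ μ ⊎ l ⊕ h ≡ μ) → pairδ h l μ ≡ 1ℤ
pairδ-∈ {h = h} {l} h≢𝟎 (inj₁ refl) = cong₂ _+_ (δ-refl l)
  (δ-≢ λ e → h≢𝟎 (trans (sym (⊕-cancelˡ l h)) (trans (cong (l ⊕_) e) (⊕-self l))))
pairδ-∈ {h = h} {l} h≢𝟎 (inj₂ refl) = cong₂ _+_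
  (δ-≢ λ e → h≢𝟎 (trans (sym (⊕-cancelˡ l h)) (trans (cong (l ⊕_) (sym e)) (⊕-self l)))) (δ-refl (l ⊕ h))

pairδ-∉ : ∀ {h l μ : Pt d} → l ≢ μ → l ⊕ h ≢ μ → pairδ h l μ ≡ 0ℤ
pairδ-∉ p q = cong₂ _+_ (δ-≢ p) (δ-≢ q)

2*i≢1 : ∀ i → + 2 * i ≢ 1ℤ
2*i≢1 (+ zero)       ()
2*i≢1 +[1+ zero ]    ()
2*i≢1 +[1+ suc n ]   ()
2*i≢1 -[1+ n ]       ()

4*i≢2 : ∀ i → + 4 * i ≢ + 2
4*i≢2 i e = 2*i≢1 i (*-cancelˡ {+ 2} (λ ()) (trans (sym (*-assoc (+ 2) (+ 2) i)) e))

-- Pairs of spectrum points with a common difference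

-- Four points of the spectrum with sum 𝟎; the listed inequalities make all four distinct.
record Quad (Λ : Subset₂ d) (h l m : Pt d) : Set where
  field
    h≢𝟎  : h ≢ 𝟎
    l∈   : l ∈ₛ Λ
    l+h∈ : (l ⊕ h) ∈ₛ Λ
    m∈   : m ∈ₛ Λ
    m+h∈ : (m ⊕ h) ∈ₛ Λ
    l≢m   : l ≢ m
    l+h≢m : l ⊕ h ≢ m

module _ {E Λ : Subset₂ d} (P : SpectralPair E Λ) {h l m : Pt d} (Q : Quad Λ h l m) where
  open Quad Q
  private
    n = size E
    -- where the four characters of the quad agree
    F = section E h (l ⊕ m)

  -- The four shifts of `l ⊕ μ` in the section identity are the differences between μ and the four
  -- points of the quad, where orthogonality makes the transform of E equal to n or 0.
  hat-quad-section : ∀ {μ} → μ ∈ₛ Λ → + 4 * hat (𝟙 F) (l ⊕ μ) ≡ n * (pairδ h l μ + pairδ h m μ)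
  hat-quad-section {μ} μ∈ = begin
    + 4 * hat (𝟙 F) (l ⊕ μ)  ≡⟨ hat-section E h (l ⊕ m) (l ⊕ μ) ⟩
    (hat (𝟙 E) (l ⊕ μ) + hat (𝟙 E) (h ⊕ (l ⊕ μ))) +
        (hat (𝟙 E) ((l ⊕ m) ⊕ (l ⊕ μ)) + hat (𝟙 E) ((h ⊕ (l ⊕ m)) ⊕ (l ⊕ μ)))
      ≡⟨ cong₂ _+_ (cong₂ _+_ (on l∈ refl) (on l+h∈
          (trans (sym (⊕-assoc h l μ)) (cong (_⊕ μ) (⊕-comm h l)))))
           (cong₂ _+_ (on m∈ (⊕-cancel-mid l m μ))
              (on m+h∈ (trans (⊕-assoc h _ _) (trans (cong (h ⊕_) (⊕-cancel-mid l m μ))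
                 (trans (sym (⊕-assoc h m μ)) (cong (_⊕ μ) (⊕-comm h m))))))) ⟩
    (n * δ l μ + n * δ (l ⊕ h) μ) + (n * δ m μ + n * δ (m ⊕ h) μ)
      ≡⟨ factor n (δ l μ) (δ (l ⊕ h) μ) (δ m μ) (δ (m ⊕ h) μ) ⟩
    n * (pairδ h l μ + pairδ h m μ) ∎
    where
    on : ∀ {u v} → u ∈ₛ Λ → v ≡ u ⊕ μ → hat (𝟙 E) v ≡ n * δ u μ
    on p refl = hat-on-spectrum P p μ∈
    factor : ∀ n a b c e → (n * a + n * b) + (n * c + n * e) ≡ n * ((a + b) + (c + e))
    factor = solve-∀

  size-quad-section : + 4 * size F ≡ n
  size-quad-section = begin
    + 4 * size F                     ≡⟨ cong (+ 4 *_) (trans (cong (hat (𝟙 F)) (⊕-self l)) (hat-size F)) ⟨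
    + 4 * hat (𝟙 F) (l ⊕ l)          ≡⟨ hat-quad-section l∈ ⟩
    n * (pairδ h l l + pairδ h m l)  ≡⟨ cong (n *_)
        (cong₂ _+_ (pairδ-∈ {l = l} h≢𝟎 (inj₁ refl)) (pairδ-∉ (λ e → l≢m (sym e)) m+h≢l)) ⟩
    n * 1ℤ                           ≡⟨ *-identityʳ n ⟩
    n                                ∎
    where
    m+h≢l : m ⊕ h ≢ l
    m+h≢l e = l+h≢m (trans (cong (_⊕ h) (sym e)) (⊕-cancelʳ m h))

  -- At a point μ outside the quad the signs over F add up to 0, so |F| is even, while n = 4 |F|.
  quad⇒8∣size : ∀ {μ} → μ ∈ₛ Λ → pairδ h l μ + pairδ h m μ ≡ 0ℤ → ∃ λ w → n ≡ + 8 * w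
  quad⇒8∣size {μ} μ∈ out =
    let z , e = χ-⨁-elems-mod4 F (l ⊕ μ)
        w , p = even (dot (l ⊕ μ) (⨁ (elems F)))
    in + 2 * z + w , (begin
      n                                                      ≡⟨ size-quad-section ⟨
      + 4 * size F                                           ≡⟨ cong (+ 4 *_)
          (trans (sym (+-identityʳ (size F))) (cong (λ u → size F - u) (sym hat≡0))) ⟩
      + 4 * (size F - hat (𝟙 F) (l ⊕ μ))                     ≡⟨ cong (+ 4 *_) e ⟩
      + 4 * (+ 4 * z + (1ℤ - χ (l ⊕ μ) (⨁ (elems F))))       ≡⟨ cong (λ u → + 4 * (+ 4 * z + u)) p ⟩
      + 4 * (+ 4 * z + + 2 * w)                              ≡⟨ collect z w ⟩
      + 8 * (+ 2 * z + w)                                    ∎)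
    where
    hat≡0 : hat (𝟙 F) (l ⊕ μ) ≡ 0ℤ
    hat≡0 = *-zero-cancelˡ {+ 4} (λ ()) (trans (hat-quad-section μ∈) (trans (cong (n *_) out) (*-zeroʳ n)))
    even : ∀ b → ∃ λ w → 1ℤ - sgn b ≡ + 2 * w
    even false = 0ℤ , refl
    even true  = 1ℤ , refl
    collect : ∀ z w → + 4 * (+ 4 * z + + 2 * w) ≡ + 8 * (+ 2 * z + w)
    collect = solve-∀

  -- A character at this point is the product of its signs over F.
  quad-point : Pt d
  quad-point = ⨁ (elems F)

  -- Here |F| = 6. On the quad all six signs are 1, with product 1; at the other points of Λ they
  -- add up to 0, so three of them are -1 and the product is -1.
  χ-quad-point : n ≡ + 24 → ∀ {μ} → μ ∈ₛ Λ → ∀ {b} → pairδ h l μ + pairδ h m μ ≡ ind b →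
                 χ (l ⊕ μ) quad-point ≡ + 2 * ind b - 1ℤ
  χ-quad-point n≡24 {μ} μ∈ {b} yμ =
    let z , e = χ-⨁-elems-mod4 F (l ⊕ μ)
    in conclude z (dot (l ⊕ μ) quad-point) b (trans (sym (cong₂ _-_ size≡6 hat≡)) e)
    where
    size≡6 : size F ≡ + 6
    size≡6 = *-cancelˡ {+ 4} (λ ()) (trans size-quad-section n≡24)
    hat≡ : hat (𝟙 F) (l ⊕ μ) ≡ + 6 * ind b
    hat≡ = *-cancelˡ {+ 4} (λ ()) (trans (hat-quad-section μ∈)
        (trans (cong₂ _*_ n≡24 yμ) (*-assoc (+ 4) (+ 6) (ind b))))
    -- Modulo 4 the left side is 0 or 2 according to b, which determines the sign; a mismatch would
    -- make 2 a multiple of 4.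
    conclude : ∀ z c b → + 6 - + 6 * ind b ≡ + 4 * z + (1ℤ - sgn c) → sgn c ≡ + 2 * ind b - 1ℤ
    conclude z false true  _ = refl
    conclude z true  false _ = refl
    conclude z false false e = ⊥-elim (4*i≢2 (z - 1ℤ) (trans (shift₄ z) (cong (_- + 4) (sym e))))
      where
      shift₄ : ∀ z → + 4 * (z - 1ℤ) ≡ (+ 4 * z + 0ℤ) - + 4
      shift₄ = solve-∀
    conclude z true  true  e = ⊥-elim (4*i≢2 (z + 1ℤ) (trans (shift₄ z) (cong (_+ + 2) (sym e))))
      where
      shift₄ : ∀ z → + 4 * (z + 1ℤ) ≡ (+ 4 * z + + 2) + + 2
      shift₄ = solve-∀

-- R Λ has total mass |Λ|², of which the origin carries |Λ|.
pigeonhole : (Λ : Subset₂ d) (c : ℤ) → 0ℤ ℤ.≤ c → N d * c + size Λ < size Λ * size Λ →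
             ∃ λ h → h ≢ 𝟎 × c < R Λ h
pigeonhole {d} Λ c 0≤c lt =
  let h , p = ∑-witness (subst₂ _<_ (sym ∑f) (sym (∑-conv (𝟙 Λ) (𝟙 Λ))) lt)
  in h , case h p
  where
  f : Pt d → ℤ
  f h = c + δ 𝟎 h * size Λ
  ∑f : ∑ f ≡ N d * c + size Λ
  ∑f = trans (∑-+ {d} (λ _ → c) (λ h → δ 𝟎 h * size Λ))
      (cong₂ _+_ (∑-const {d} c) (∑-δ {d} 𝟎 (λ _ → size Λ)))
  case : ∀ h → f h < R Λ h → h ≢ 𝟎 × c < R Λ h
  case h p with 𝟎 ≟ᵖ h
  ... | yes refl = ⊥-elim (<⇒≱ p (≤-trans (≤-reflexive (trans (R-𝟎 Λ) (sym (+-identityˡ (size Λ)))))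
                     (+-mono-≤ 0≤c (≤-reflexive
                         (sym (trans (cong (_* size Λ) (δ-refl (𝟎 {d}))) (*-identityˡ (size Λ))))))))
  ... | no n = (λ e → n (sym e)) , subst (_< R Λ h)
      (trans (cong (λ u → c + u * size Λ) (δ-≢ n)) (+-identityʳ c)) p

shifted : Subset₂ d → Pt d → Subset₂ d
shifted Λ h x = Λ x ∧ Λ (x ⊕ h)

R≡size-shifted : (Λ : Subset₂ d) (h : Pt d) → R Λ h ≡ size (shifted Λ h)
R≡size-shifted Λ h = ∑-cong (λ x → sym (ind-∧ (Λ x) (Λ (x ⊕ h))))

fresh-pair : (Λ : Subset₂ d) (h : Pt d) (ps : List (Pt d)) → + length ps < R Λ h →
  ∃ λ l → l ∈ₛ Λ × (l ⊕ h) ∈ₛ Λ × l ∉ ps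
fresh-pair Λ h ps lt =
  let l , p , q = fresh (shifted Λ h) ps (subst (+ length ps <_) (R≡size-shifted Λ h) lt)
  in l , proj₁ (∧-true p) , proj₂ (∧-true p) , q

-- Some difference h is attained at more than two points, hence by two disjoint pairs, which form a
-- quad. As n ≥ 12, there is a fifth point of Λ at which parity can be read off.
size≥12⇒8∣size : {E Λ : Subset₂ d} → SpectralPair E Λ → N d ℤ.≤ + 64 → + 12 ℤ.≤ size E →
    ∃ λ w → size E ≡ + 8 * w
size≥12⇒8∣size {d} {E} {Λ} P N≤64 12≤n =
  case pigeonhole Λ (+ 2) (+≤+ ℕ.z≤n) small of λ { (h , h≢𝟎 , 2<R) →
  case fresh-pair Λ h [] (<-trans (+<+ (ℕ.s≤s ℕ.z≤n)) 2<R) of λ { (l , l∈ , l+h∈ , _) →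
  case fresh-pair Λ h (l ∷ (l ⊕ h) ∷ []) 2<R of λ { (m , m∈ , m+h∈ , m∉) →
  case fresh Λ (l ∷ (l ⊕ h) ∷ m ∷ (m ⊕ h) ∷ []) (<-≤-trans (+<+ (ℕ.m≤m+n 5 7)) 12≤n′) of λ { (μ , μ∈ , μ∉) →
    quad⇒8∣size P
      (record { h≢𝟎 = h≢𝟎 ; l∈ = l∈ ; l+h∈ = l+h∈ ; m∈ = m∈ ; m+h∈ = m+h∈
              ; l≢m = λ e → m∉ (here (sym e)) ; l+h≢m = λ e → m∉ (there (here (sym e))) })
      μ∈ (cong₂ _+_
       (pairδ-∉ (λ e → μ∉ (here (sym e))) (λ e → μ∉ (there (here (sym e)))))
       (pairδ-∉ (λ e → μ∉ (there (there (here (sym e)))))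
           (λ e → μ∉ (there (there (there (here (sym e)))))))) }}}}
  where
  n = size Λ
  12≤n′ : + 12 ℤ.≤ n
  12≤n′ = subst (+ 12 ℤ.≤_) (sym (SpectralPair.sizes P)) 12≤n
  expand : ∀ n → + 11 * n + n ≡ + 12 * n
  expand = solve-∀
  -- For n ≥ 12 one has 11 n ≥ 132 > 128 = 2 · 64, and n + 11 n ≤ n².
  small : N d * + 2 + n < n * n
  small = <-≤-trans (+-monoˡ-< n (≤-<-trans (*-monoʳ-≤-nonNeg (+ 2) N≤64)
            (<-≤-trans (+<+ (ℕ.m≤m+n 129 3)) (*-monoˡ-≤-nonNeg (+ 11) 12≤n′))))
            (≤-trans (≤-reflexive (expand n)) (*-monoʳ-≤-nonNeg n {{nonNegative (size-≥0 Λ)}} 12≤n′))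

-- Spectral sets of 24 points

inPair : Pt d → Pt d → Pt d → Bool
inPair h l μ with l ≟ᵖ μ | (l ⊕ h) ≟ᵖ μ
... | no _ | no _ = false
... | _    | _    = true

inPair⁻ : (h l μ : Pt d) → inPair h l μ ≡ true → l ≡ μ ⊎ l ⊕ h ≡ μ
inPair⁻ h l μ p with l ≟ᵖ μ | (l ⊕ h) ≟ᵖ μ
... | yes e | _     = inj₁ e
... | no _  | yes e = inj₂ e
inPair⁻ h l μ () | no _ | no _

pairδ≡ind : {h : Pt d} → h ≢ 𝟎 → (l μ : Pt d) → pairδ h l μ ≡ ind (inPair h l μ)
pairδ≡ind {h = h} n l μ with l ≟ᵖ μ | (l ⊕ h) ≟ᵖ μ
... | yes e | _     = pairδ-∈ {h = h} {l} n (inj₁ e)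
... | no _  | yes e = pairδ-∈ {h = h} {l} n (inj₂ e)
... | no p  | no q  = pairδ-∉ p q

pairs-disjoint : {Λ : Subset₂ d} {h l m : Pt d} → Quad Λ h l m → ∀ μ → inPair h l μ ∧ inPair h m μ ≡ false
pairs-disjoint {h = h} {l} {m} Q μ with inPair h l μ in p | inPair h m μ in q
... | false | _     = refl
... | true  | false = refl
... | true  | true  with inPair⁻ h l μ p | inPair⁻ h m μ q
...   | inj₁ e | inj₁ f = ⊥-elim (Quad.l≢m Q (trans e (sym f)))
...   | inj₂ e | inj₁ f = ⊥-elim (Quad.l+h≢m Q (trans e (sym f)))
...   | inj₁ e | inj₂ f = ⊥-elim (Quad.l+h≢m Q (trans (cong (_⊕ h) (trans e (sym f))) (⊕-cancelʳ m h)))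
...   | inj₂ e | inj₂ f = ⊥-elim (Quad.l≢m Q (trans (sym (⊕-cancelʳ l h))
    (trans (cong (_⊕ h) (trans e (sym f))) (⊕-cancelʳ m h))))

∑-𝟙-pairδ : (Λ : Subset₂ d) {h l : Pt d} → l ∈ₛ Λ → (l ⊕ h) ∈ₛ Λ → ∑ (λ μ → 𝟙 Λ μ * pairδ h l μ) ≡ + 2
∑-𝟙-pairδ Λ {h} {l} p q = trans (∑-cong (λ μ → distrib (𝟙 Λ μ) (δ l μ) (δ (l ⊕ h) μ)))
  (trans (∑-+ (λ μ → δ l μ * 𝟙 Λ μ) (λ μ → δ (l ⊕ h) μ * 𝟙 Λ μ))
    (cong₂ _+_ (trans (∑-δ l (𝟙 Λ)) (∈⇒𝟙 Λ p)) (trans (∑-δ (l ⊕ h) (𝟙 Λ)) (∈⇒𝟙 Λ q))))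
  where
  distrib : ∀ a b c → a * (b + c) ≡ b * a + c * a
  distrib = solve-∀

-- Measuring characters relative to l multiplies the transform by the sign `χ l x`, which disappears
-- in the square.
hat²-from-values : (Λ : Subset₂ d) (l x : Pt d) (φ : Pt d → ℤ) → (∀ μ → μ ∈ₛ Λ → χ (l ⊕ μ) x ≡ φ μ) →
  hat (𝟙 Λ) x * hat (𝟙 Λ) x ≡ ∑ (λ μ → 𝟙 Λ μ * φ μ) * ∑ (λ μ → 𝟙 Λ μ * φ μ)
hat²-from-values Λ l x φ v = trans (cong (λ z → z * z) hat≡)
    (trans (square (χ l x) _) (trans (cong (_* _) (χ-sq l x)) (*-identityˡ _)))
  where
  square : ∀ s u → (s * u) * (s * u) ≡ (s * s) * (u * u)
  square = solve-∀
  swap : ∀ a s u → a * (s * u) ≡ s * (a * u)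
  swap = solve-∀
  term : ∀ μ → 𝟙 Λ μ * χ x μ ≡ χ l x * (𝟙 Λ μ * φ μ)
  term μ with Λ μ in p
  ... | false = sym (*-zeroʳ (χ l x))
  ... | true  = begin
    1ℤ * χ x μ                       ≡⟨ cong (1ℤ *_) (begin
        χ x μ                        ≡⟨ χ-comm x μ ⟩
        χ μ x                        ≡⟨ cong (λ u → χ u x) (⊕-cancelˡ l μ) ⟨
        χ (l ⊕ (l ⊕ μ)) x            ≡⟨ χ-⊕ˡ l (l ⊕ μ) x ⟩
        χ l x * χ (l ⊕ μ) x          ≡⟨ cong (χ l x *_) (v μ p) ⟩
        χ l x * φ μ                  ∎) ⟩
    1ℤ * (χ l x * φ μ)               ≡⟨ swap 1ℤ (χ l x) (φ μ) ⟩
    χ l x * (1ℤ * φ μ)               ∎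
  hat≡ : hat (𝟙 Λ) x ≡ χ l x * ∑ (λ μ → 𝟙 Λ μ * φ μ)
  hat≡ = trans (∑-cong term) (∑-*ˡ (χ l x) (λ μ → 𝟙 Λ μ * φ μ))

module _ {Λ : Subset₂ d} {h l m k : Pt d} (Q : Quad Λ h l m) (Q′ : Quad Λ h l k) (Q″ : Quad Λ h m k) where
  private
    A B C : Pt d → ℤ
    A = pairδ h l
    B = pairδ h m
    C = pairδ h k

  ∑-pairs : ∀ a b c e → ∑ (λ μ → 𝟙 Λ μ * (a + b * A μ + c * B μ + e * C μ)) ≡
            a * size Λ + b * + 2 + c * + 2 + e * + 2
  ∑-pairs a b c e = begin
    ∑ (λ μ → 𝟙 Λ μ * (a + b * A μ + c * B μ + e * C μ))
      ≡⟨ ∑-cong (λ μ → distrib (𝟙 Λ μ) a b c e (A μ) (B μ) (C μ)) ⟩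
    ∑ (λ μ → a * 𝟙 Λ μ + b * (𝟙 Λ μ * A μ) + c * (𝟙 Λ μ * B μ) + e * (𝟙 Λ μ * C μ))
      ≡⟨ trans (∑-+ (λ μ → a * 𝟙 Λ μ + b * (𝟙 Λ μ * A μ) + c * (𝟙 Λ μ * B μ)) (λ μ → e * (𝟙 Λ μ * C μ)))
           (cong₂ _+_ (trans (∑-+ (λ μ → a * 𝟙 Λ μ + b * (𝟙 Λ μ * A μ)) (λ μ → c * (𝟙 Λ μ * B μ)))
             (cong₂ _+_ (trans (∑-+ (λ μ → a * 𝟙 Λ μ) (λ μ → b * (𝟙 Λ μ * A μ)))
               (cong₂ _+_ (∑-*ˡ a (𝟙 Λ)) (∑-*ˡ b (λ μ → 𝟙 Λ μ * A μ)))) (∑-*ˡ c (λ μ → 𝟙 Λ μ * B μ))))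
             (∑-*ˡ e (λ μ → 𝟙 Λ μ * C μ))) ⟩
    a * size Λ + b * ∑ (λ μ → 𝟙 Λ μ * A μ) + c * ∑ (λ μ → 𝟙 Λ μ * B μ) + e * ∑ (λ μ → 𝟙 Λ μ * C μ)
      ≡⟨ cong₂ _+_ (cong₂ _+_ (cong (λ u → a * size Λ + b * u) (∑-𝟙-pairδ Λ l∈ l+h∈))
          (cong (c *_) (∑-𝟙-pairδ Λ m∈ m+h∈)))
           (cong (e *_) (∑-𝟙-pairδ Λ (Quad.m∈ Q′) (Quad.m+h∈ Q′))) ⟩
    a * size Λ + b * + 2 + c * + 2 + e * + 2 ∎
    where
    open Quad Q
    distrib : ∀ i a b c e A B C → i * (a + b * A + c * B + e * C) ≡
              a * i + b * (i * A) + c * (i * B) + e * (i * C)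
    distrib = solve-∀

  module _ {E : Subset₂ d} (P : SpectralPair E Λ) (n≡24 : size E ≡ + 24) where
    private
      x x′ : Pt d
      x  = quad-point P Q
      x′ = quad-point P Q′

      size-Λ : size Λ ≡ + 24
      size-Λ = trans (SpectralPair.sizes P) n≡24

      a b c : Pt d → Bool
      a = inPair h l
      b = inPair h m
      c = inPair h k

      A≡ = pairδ≡ind (Quad.h≢𝟎 Q) l
      B≡ = pairδ≡ind (Quad.h≢𝟎 Q) m
      C≡ = pairδ≡ind (Quad.h≢𝟎 Q) k

      -- On Λ, φ is 1 on the pairs of l and m and -1 elsewhere, and φ′ likewise for l and k. Their
      -- product φ″ is -1 on the pairs of m and k and 1 elsewhere. The zero coefficients give all
      -- three the shape of `∑-pairs`.
      φ φ′ φ″ : Pt d → ℤ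
      φ μ  = - 1ℤ + + 2 * A μ + + 2 * B μ + 0ℤ * C μ
      φ′ μ = - 1ℤ + + 2 * A μ + 0ℤ * B μ + + 2 * C μ
      φ″ μ = 1ℤ + 0ℤ * A μ + - + 2 * B μ + - + 2 * C μ

      ind-∨ : ∀ a b → a ∧ b ≡ false → ∃ λ c → ind a + ind b ≡ ind c
      ind-∨ true  true  ()
      ind-∨ true  false _ = true , refl
      ind-∨ false b     _ = b , +-identityˡ (ind b)

      valueφ : ∀ μ → μ ∈ₛ Λ → χ (l ⊕ μ) x ≡ φ μ
      valueφ μ p = case ind-∨ (a μ) (b μ) (pairs-disjoint Q μ) of λ { (u , e) →
        trans (χ-quad-point P Q n≡24 p {u} (trans (cong₂ _+_ (A≡ μ) (B≡ μ)) e))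
          (trans (cong (λ z → + 2 * z - 1ℤ) (trans (sym e) (cong₂ _+_ (sym (A≡ μ)) (sym (B≡ μ)))))
              (expand (A μ) (B μ) (C μ))) }
        where
        expand : ∀ A B C → + 2 * (A + B) - 1ℤ ≡ - 1ℤ + + 2 * A + + 2 * B + 0ℤ * C
        expand = solve-∀

      valueφ′ : ∀ μ → μ ∈ₛ Λ → χ (l ⊕ μ) x′ ≡ φ′ μ
      valueφ′ μ p = case ind-∨ (a μ) (c μ) (pairs-disjoint Q′ μ) of λ { (u , e) →
        trans (χ-quad-point P Q′ n≡24 p {u} (trans (cong₂ _+_ (A≡ μ) (C≡ μ)) e))
          (trans (cong (λ z → + 2 * z - 1ℤ) (trans (sym e) (cong₂ _+_ (sym (A≡ μ)) (sym (C≡ μ)))))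
              (expand (A μ) (B μ) (C μ))) }
        where
        expand : ∀ A B C → + 2 * (A + C) - 1ℤ ≡ - 1ℤ + + 2 * A + 0ℤ * B + + 2 * C
        expand = solve-∀

      product : ∀ a b c → a ∧ b ≡ false → a ∧ c ≡ false → b ∧ c ≡ false →
        (- 1ℤ + + 2 * ind a + + 2 * ind b + 0ℤ * ind c) * (- 1ℤ + + 2 * ind a + 0ℤ * ind b + + 2 * ind c)
        ≡ 1ℤ + 0ℤ * ind a + - + 2 * ind b + - + 2 * ind c
      product true  true  _     () _  _
      product true  false true  _  () _
      product false true  true  _  _  ()
      product true  false false _  _  _ = refl
      product false true  false _  _  _ = refl
      product false false true  _  _  _ = refl
      product false false false _  _  _ = refl

      valueφ″ : ∀ μ → μ ∈ₛ Λ → χ (l ⊕ μ) (x ⊕ x′) ≡ φ″ μ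
      valueφ″ μ p = trans (χ-⊕ʳ (l ⊕ μ) x x′) (trans (cong₂ _*_ (valueφ μ p) (valueφ′ μ p)) prod)
        where
        prod : φ μ * φ′ μ ≡ φ″ μ
        prod rewrite A≡ μ | B≡ μ | C≡ μ =
          product (a μ) (b μ) (c μ) (pairs-disjoint Q μ) (pairs-disjoint Q′ μ) (pairs-disjoint Q″ μ)

      sum-to : ∀ a b c e v → a * + 24 + b * + 2 + c * + 2 + e * + 2 ≡ v →
        ∑ (λ μ → 𝟙 Λ μ * (a + b * A μ + c * B μ + e * C μ)) ≡ v
      sum-to a b c e v r = trans (∑-pairs a b c e)
          (trans (cong (λ s → a * s + b * + 2 + c * + 2 + e * + 2) size-Λ) r)

      -- Four values 1 and twenty values -1.
      hat²-x : hat (𝟙 Λ) x * hat (𝟙 Λ) x ≡ + 256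
      hat²-x = trans (hat²-from-values Λ l x φ valueφ)
          (cong (λ z → z * z) (sum-to (- 1ℤ) (+ 2) (+ 2) 0ℤ (- + 16) refl))

      hat²-x′ : hat (𝟙 Λ) x′ * hat (𝟙 Λ) x′ ≡ + 256
      hat²-x′ = trans (hat²-from-values Λ l x′ φ′ valueφ′)
          (cong (λ z → z * z) (sum-to (- 1ℤ) (+ 2) 0ℤ (+ 2) (- + 16) refl))

      -- Four values -1 and twenty values 1.
      hat²-x″ : hat (𝟙 Λ) (x ⊕ x′) * hat (𝟙 Λ) (x ⊕ x′) ≡ + 256
      hat²-x″ = trans (hat²-from-values Λ l (x ⊕ x′) φ″ valueφ″)
          (cong (λ z → z * z) (sum-to 1ℤ 0ℤ (- + 2) (- + 2) (+ 16) refl))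

      avoid : ∀ y → hat (𝟙 Λ) y * hat (𝟙 Λ) y ≡ + 256 → Avoids E y
      avoid y e = spectrum-avoids (dual P) y y≢𝟎 (λ z → 256≢0 (trans (sym e) (cong (λ z → z * z) z)))
        where
        256≢0 : + 256 ≢ 0ℤ
        256≢0 ()
        576≢256 : + 576 ≢ + 256
        576≢256 ()
        -- At the origin the square would be 24² = 576.
        y≢𝟎 : y ≢ 𝟎
        y≢𝟎 refl = 576≢256 (trans (sym (cong (λ z → z * z) (trans (hat-size Λ) size-Λ))) e)

    96≤N : + 96 ℤ.≤ N d
    96≤N = subst (ℤ._≤ N d) (cong (λ s → (s + s) + (s + s)) n≡24)
             (avoids-plane⇒4n≤N E x x′ (avoid x hat²-x) (avoid x′ hat²-x′) (avoid (x ⊕ x′) hat²-x″))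

-- Three pairs with a common difference give points x, x′ of ℤ₂ᵈ such that Λ̂ is ±16 at x, x′ and
-- x ⊕ x′; then E meets each coset of the plane they span at most once.
size≢24 : {E Λ : Subset₂ d} → SpectralPair E Λ → N d ℤ.≤ + 64 → size E ≢ + 24
size≢24 {d} {E} {Λ} P N≤64 n≡24 =
  case pigeonhole Λ (+ 4) (+≤+ ℕ.z≤n) small of λ { (h , h≢𝟎 , 4<R) →
  case fresh-pair Λ h [] (<-trans (+<+ (ℕ.s≤s ℕ.z≤n)) 4<R) of λ { (l , l∈ , l+h∈ , _) →
  case fresh-pair Λ h (l ∷ (l ⊕ h) ∷ []) (<-trans (+<+ (ℕ.m≤m+n 3 1)) 4<R) of λ { (m , m∈ , m+h∈ , m∉) →
  case fresh-pair Λ h (l ∷ (l ⊕ h) ∷ m ∷ (m ⊕ h) ∷ []) 4<R of λ { (k , k∈ , k+h∈ , k∉) →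
    let quad : ∀ {u v} → u ∈ₛ Λ → (u ⊕ h) ∈ₛ Λ → v ∈ₛ Λ → (v ⊕ h) ∈ₛ Λ → v ≢ u → v ≢ u ⊕ h → Quad Λ h u v
        quad p q r s t w = record { h≢𝟎 = h≢𝟎 ; l∈ = p ; l+h∈ = q ; m∈ = r ; m+h∈ = s
                                  ; l≢m = λ e → t (sym e) ; l+h≢m = λ e → w (sym e) }
    in <⇒≱ (+<+ (ℕ.m≤m+n 65 31)) (≤-trans (96≤N
        (quad l∈ l+h∈ m∈ m+h∈ (λ e → m∉ (here e)) (λ e → m∉ (there (here e))))
        (quad l∈ l+h∈ k∈ k+h∈ (λ e → k∉ (here e)) (λ e → k∉ (there (here e))))
        (quad m∈ m+h∈ k∈ k+h∈ (λ e → k∉ (there (there (here e))))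
            (λ e → k∉ (there (there (there (here e))))))
        P n≡24) N≤64) }}}}
  where
  size-Λ : size Λ ≡ + 24
  size-Λ = trans (SpectralPair.sizes P) n≡24
  -- Since 4 · 64 + 24 = 280 < 576, some difference occurs at more than four points, hence in at
  -- least three pairs.
  small : N d * + 4 + size Λ < size Λ * size Λ
  small = subst (λ s → N d * + 4 + s < s * s) (sym size-Λ)
    (≤-<-trans (+-monoˡ-≤ (+ 24) (*-monoʳ-≤-nonNeg (+ 4) N≤64)) (+<+ (ℕ.m≤m+n 281 295)))

-- Spectral sets of 16 points among 64

exists? : {P : Pt d → Set} → (∀ x → Dec (P x)) → Dec (∃ P)
exists? P? with search P?
... | inj₁ w = yes w
... | inj₂ n = no λ (x , p) → n x p

hat-hat : (f : Pt d → ℤ) (ξ : Pt d) → hat (hat f) ξ ≡ N d * f ξ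
hat-hat f ξ = trans (∑-cong (λ x → cong (hat f x *_) (χ-comm ξ x))) (hat-inversion f ξ)

-- The cube is the transform of a triple convolution, whose value at the origin is a sum over
-- triples a, b, `a ⊕ b`.
∑-hat³ : (u : Pt d → ℤ) → (∀ a b → u a * (u b * u (a ⊕ b)) ≡ 0ℤ) →
         ∑ (λ ξ → hat u ξ * (hat u ξ * hat u ξ)) ≡ 0ℤ
∑-hat³ {d} u free = begin
  ∑ (λ ξ → hat u ξ * (hat u ξ * hat u ξ))  ≡⟨ ∑-cong
      (λ ξ → trans (hat-conv u (conv u u) ξ) (cong (hat u ξ *_) (hat-conv u u ξ))) ⟨
  ∑ (hat (conv u (conv u u)))              ≡⟨ ∑-hat (conv u (conv u u)) ⟩
  N d * conv u (conv u u) 𝟎                ≡⟨ cong (N d *_) (∑-zero outer) ⟩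
  N d * 0ℤ                                 ≡⟨ *-zeroʳ (N d) ⟩
  0ℤ                                       ∎
  where
  outer : ∀ a → u a * conv u u (a ⊕ 𝟎) ≡ 0ℤ
  outer a = trans (sym (∑-*ˡ (u a) (λ b → u b * u (b ⊕ (a ⊕ 𝟎)))))
    (∑-zero (λ b → trans (cong (λ z → u a * (u b * u z))
        (trans (cong (b ⊕_) (⊕-identityʳ a)) (⊕-comm b a))) (free a b)))

Plane : Subset₂ d → Pt d → Pt d → Set
Plane Λ a b = ((a ≢ 𝟎 × b ≢ 𝟎) × a ⊕ b ≢ 𝟎) ×
  ((hat (𝟙 Λ) a ≢ 0ℤ × hat (𝟙 Λ) b ≢ 0ℤ) × hat (𝟙 Λ) (a ⊕ b) ≢ 0ℤ)

-- If the nonzero frequencies of Λ were sum-free, then u = Λ̂² − 256 δ₀ would satisfy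
-- û = 64 (R − 4) and hence ∑ R (R − 6)² = 64 · 16, but the origin alone contributes 16 · 10².
module _ (Λ : Subset₂ d) (N≡64 : N d ≡ + 64) (n≡16 : size Λ ≡ + 16)
         (none : ∀ a b → ¬ Plane Λ a b) where
  private
    u s g : Pt d → ℤ
    -- 256 = 16² is the value of the transform at the origin; subtracting it leaves u supported on
    -- the nonzero frequencies.
    u x = hat (R Λ) x - δ 𝟎 x * + 256
    s ξ = R Λ ξ - + 4
    g ξ = R Λ ξ * ((R Λ ξ - + 6) * (R Λ ξ - + 6))

    u-𝟎 : u 𝟎 ≡ 0ℤ
    u-𝟎 = cong₂ (λ p q → p - q * + 256)
      (trans (hat-R Λ 𝟎) (cong (λ z → z * z) (trans (hat-size Λ) n≡16))) (δ-refl (𝟎 {d}))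

    u-≢𝟎 : ∀ {x} → x ≢ 𝟎 → hat (𝟙 Λ) x ≡ 0ℤ → u x ≡ 0ℤ
    u-≢𝟎 {x} n e = cong₂ (λ p q → p - q * + 256) (trans (hat-R Λ x) (cong (λ z → z * z) e))
        (δ-≢ (λ e → n (sym e)))

    zero₁ : ∀ {x} y z → x ≡ 0ℤ → x * (y * z) ≡ 0ℤ
    zero₁ y z refl = *-zeroˡ (y * z)
    zero₂ : ∀ x {y} z → y ≡ 0ℤ → x * (y * z) ≡ 0ℤ
    zero₂ x z refl = trans (cong (x *_) (*-zeroˡ z)) (*-zeroʳ x)
    zero₃ : ∀ x y {z} → z ≡ 0ℤ → x * (y * z) ≡ 0ℤ
    zero₃ x y refl = trans (cong (x *_) (*-zeroʳ y)) (*-zeroʳ x)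

    free : ∀ a b → u a * (u b * u (a ⊕ b)) ≡ 0ℤ
    free a b = go (vanish? a) (vanish? b) (vanish? (a ⊕ b))
      where
      vanish? : ∀ x → (u x ≡ 0ℤ) ⊎ (x ≢ 𝟎 × hat (𝟙 Λ) x ≢ 0ℤ)
      vanish? x with x ≟ᵖ 𝟎
      ... | yes refl = inj₁ u-𝟎
      ... | no n with hat (𝟙 Λ) x ≟ 0ℤ
      ...   | yes e = inj₁ (u-≢𝟎 n e)
      ...   | no m  = inj₂ (n , m)
      go : (u a ≡ 0ℤ) ⊎ (a ≢ 𝟎 × hat (𝟙 Λ) a ≢ 0ℤ) → (u b ≡ 0ℤ) ⊎ (b ≢ 𝟎 × hat (𝟙 Λ) b ≢ 0ℤ) →
           (u (a ⊕ b) ≡ 0ℤ) ⊎ (a ⊕ b ≢ 𝟎 × hat (𝟙 Λ) (a ⊕ b) ≢ 0ℤ) → u a * (u b * u (a ⊕ b)) ≡ 0ℤ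
      go (inj₁ e) _ _ = zero₁ (u b) (u (a ⊕ b)) e
      go _ (inj₁ e) _ = zero₂ (u a) (u (a ⊕ b)) e
      go _ _ (inj₁ e) = zero₃ (u a) (u b) e
      go (inj₂ (p , p′)) (inj₂ (q , q′)) (inj₂ (r , r′)) =
          ⊥-elim (none a b (((p , q) , r) , (p′ , q′) , r′))

    hat-u : ∀ ξ → hat u ξ ≡ + 64 * s ξ
    hat-u ξ = begin
      ∑ (λ x → (hat (R Λ) x - δ 𝟎 x * + 256) * χ ξ x)
        ≡⟨ ∑-cong (λ x → split (hat (R Λ) x) (δ 𝟎 x) (χ ξ x)) ⟩
      ∑ (λ x → hat (R Λ) x * χ ξ x - δ 𝟎 x * (+ 256 * χ ξ x))
        ≡⟨ ∑-- (λ x → hat (R Λ) x * χ ξ x) (λ x → δ 𝟎 x * (+ 256 * χ ξ x)) ⟩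
      hat (hat (R Λ)) ξ - ∑ (λ x → δ 𝟎 x * (+ 256 * χ ξ x))
        ≡⟨ cong₂ _-_ (trans (hat-hat (R Λ) ξ) (cong (_* R Λ ξ) N≡64))
             (trans (∑-δ 𝟎 (λ x → + 256 * χ ξ x)) (cong (+ 256 *_) (χ-𝟎ʳ ξ))) ⟩
      + 64 * R Λ ξ - + 256
        ≡⟨ factor (R Λ ξ) ⟩
      + 64 * s ξ ∎
      where
      split : ∀ p q c → (p - q * + 256) * c ≡ p * c - q * (+ 256 * c)
      split = solve-∀
      factor : ∀ r → + 64 * r - + 256 ≡ + 64 * (r - + 4)
      factor = solve-∀

    ∑s : ∑ s ≡ 0ℤ
    ∑s = *-zero-cancelˡ {+ 64} (λ ()) (begin
      + 64 * ∑ s              ≡⟨ ∑-*ˡ (+ 64) s ⟨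
      ∑ (λ ξ → + 64 * s ξ)    ≡⟨ ∑-cong hat-u ⟨
      ∑ (hat u)               ≡⟨ ∑-hat u ⟩
      N d * u 𝟎               ≡⟨ trans (cong (N d *_) u-𝟎) (*-zeroʳ (N d)) ⟩
      0ℤ                      ∎)

    ∑s³ : ∑ (λ ξ → s ξ * (s ξ * s ξ)) ≡ 0ℤ
    -- 262144 = 64³ comes from cubing û = 64 s.
    ∑s³ = *-zero-cancelˡ {+ 262144} (λ ()) (begin
      + 262144 * ∑ (λ ξ → s ξ * (s ξ * s ξ))               ≡⟨ ∑-*ˡ (+ 262144) (λ ξ → s ξ * (s ξ * s ξ)) ⟨
      ∑ (λ ξ → + 262144 * (s ξ * (s ξ * s ξ)))             ≡⟨ ∑-cong
          (λ ξ → trans (cong (λ w → w * (w * w)) (hat-u ξ)) (cube (+ 64) (s ξ))) ⟨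
      ∑ (λ ξ → hat u ξ * (hat u ξ * hat u ξ))              ≡⟨ ∑-hat³ u free ⟩
      0ℤ                                                   ∎)
      where
      cube : ∀ c s → (c * s) * ((c * s) * (c * s)) ≡ c * (c * c) * (s * (s * s))
      cube = solve-∀

    -- As a cubic in s = r - 4, r (r - 6)² has roots -4, 2, 2, which add up to 0. Hence there is no
    -- quadratic term, and the vanishing first and third moments determine the sum.
    ∑g : ∑ g ≡ + 1024
    ∑g = begin
      ∑ g
        ≡⟨ ∑-cong (λ ξ → expand (R Λ ξ)) ⟩
      ∑ (λ ξ → (s ξ * (s ξ * s ξ) + - + 12 * s ξ) + + 16)
        ≡⟨ trans (∑-+ (λ ξ → s ξ * (s ξ * s ξ) + - + 12 * s ξ) (λ _ → + 16))
             (cong₂ _+_ (trans (∑-+ (λ ξ → s ξ * (s ξ * s ξ)) (λ ξ → - + 12 * s ξ))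
               (cong₂ _+_ ∑s³ (trans (∑-*ˡ (- + 12) s) (cong (- + 12 *_) ∑s))))
               (trans (∑-const {d} (+ 16)) (cong (_* + 16) N≡64))) ⟩
      + 1024 ∎
      where
      expand : ∀ r → r * ((r - + 6) * (r - + 6)) ≡
        ((r - + 4) * ((r - + 4) * (r - + 4)) + - + 12 * (r - + 4)) + + 16
      expand = solve-∀

    1600≤∑g : + 1600 ℤ.≤ ∑ g
    1600≤∑g = ≤-trans (≤-reflexive (sym (∑-δ {d} 𝟎 (λ _ → + 1600)))) (∑-mono-≤ term)
      where
      term : ∀ ξ → δ 𝟎 ξ * + 1600 ℤ.≤ g ξ
      term ξ with 𝟎 ≟ᵖ ξ
      ... | yes refl = ≤-reflexive (trans (cong (_* + 1600) (δ-refl (𝟎 {d})))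
              (sym (cong (λ r → r * ((r - + 6) * (r - + 6))) (trans (R-𝟎 Λ) n≡16))))
      ... | no n = ≤-trans (≤-reflexive (cong (_* + 1600) (δ-≢ n))) (0≤i*j (0≤R Λ ξ) (0≤i*i (R Λ ξ - + 6)))

  sum-free-frequencies-impossible : ⊥
  sum-free-frequencies-impossible = <⇒≱ (+<+ (ℕ.m≤m+n 1025 575)) (subst (+ 1600 ℤ.≤_) ∑g 1600≤∑g)

frequency-plane : (Λ : Subset₂ d) → N d ≡ + 64 → size Λ ≡ + 16 → ∃ λ a → ∃ λ b → Plane Λ a b
frequency-plane {d} Λ N≡64 n≡16 with search (λ a → exists? (λ b → plane? a b))
  where
  plane? : ∀ a b → Dec (Plane Λ a b)
  plane? a b = ((¬? (a ≟ᵖ 𝟎) ×-dec ¬? (b ≟ᵖ 𝟎)) ×-dec ¬? ((a ⊕ b) ≟ᵖ 𝟎)) ×-dec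
    ((¬? (hat (𝟙 Λ) a ≟ 0ℤ) ×-dec ¬? (hat (𝟙 Λ) b ≟ 0ℤ)) ×-dec ¬? (hat (𝟙 Λ) (a ⊕ b) ≟ 0ℤ))
... | inj₁ w = w
... | inj₂ n = ⊥-elim (sum-free-frequencies-impossible Λ N≡64 n≡16 (λ a b p → n a (b , p)))

-- Complements spanned by avoided differences

all₁ : {X : Pt d → Set} (v : Pt d) → X v → ∀ c → c ≢ 𝟎 → X (comb c (v ∷ []))
all₁ v p (false ∷ []) n = ⊥-elim (n refl)
all₁ {X = X} v p (true ∷ []) n = subst X (sym (⊕-identityʳ v)) p

all₂ : {X : Pt d → Set} (v w : Pt d) → X v → X w → X (v ⊕ w) → ∀ c → c ≢ 𝟎 → X (comb c (v ∷ w ∷ []))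
all₂ v w p q r (false ∷ false ∷ []) n = ⊥-elim (n refl)
all₂ {X = X} v w p q r (true ∷ false ∷ []) n = subst X (sym (⊕-identityʳ v)) p
all₂ {X = X} v w p q r (false ∷ true ∷ []) n = subst X (sym (⊕-identityʳ w)) q
all₂ {X = X} v w p q r (true ∷ true ∷ []) n = subst X (sym (cong (v ⊕_) (⊕-identityʳ w))) r

half⇒ : {E : Subset₂ d} → Nonempty E → + 2 * size E ≡ N d → ∀ t → Avoids E t → Tiles E × Spectral E
half⇒ {E = E} ne sz t av = span-complement (t ∷ []) ne sz (all₁ {X = Avoids E} t av)

quarter⇒ : {E : Subset₂ d} → Nonempty E → + 4 * size E ≡ N d → ∀ s t →
  Avoids E s → Avoids E t → Avoids E (s ⊕ t) → Tiles E × Spectral E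
quarter⇒ {E = E} ne sz s t a b c = span-complement (s ∷ t ∷ []) ne sz (all₂ {X = Avoids E} s t a b c)

full⇒ : {E : Subset₂ d} → Nonempty E → size E ≡ N d → Tiles E × Spectral E
full⇒ {E = E} ne sz = span-complement [] ne (trans (*-identityˡ (size E)) sz) (λ { [] n → ⊥-elim (n refl) })

-- By duality E avoids the nonzero frequencies of Λ. A plane of them has four elements, and 4 · 16 =
-- 64 makes it a complement.
spectral-quarter⇒ : {E Λ : Subset₂ d} → SpectralPair E Λ → Nonempty E → N d ≡ + 64 → size E ≡ + 16 →
    Tiles E × Spectral E
spectral-quarter⇒ {E = E} {Λ} P ne N≡64 n≡16 =
  case frequency-plane Λ N≡64 (trans (SpectralPair.sizes P) n≡16) of λ
      { (a , b , ((p , q) , r) , (p′ , q′) , r′) →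
    quarter⇒ ne (trans (cong (+ 4 *_) n≡16) (sym N≡64)) a b
      (spectrum-avoids (dual P) a p p′) (spectrum-avoids (dual P) b q q′)
          (spectrum-avoids (dual P) (a ⊕ b) r r′) }

-- Sets of at most eight points

nonzero-functional : (y : Pt m) → y ≡ 𝟎 ⊎ ∃ λ w → dot w y ≡ true
nonzero-functional [] = inj₁ refl
nonzero-functional (true ∷ y) = inj₂ (true ∷ 𝟎 , cong not (dot-𝟎ˡ y))
nonzero-functional (false ∷ y) with nonzero-functional y
... | inj₁ e = inj₁ (cong (false ∷_) e)
... | inj₂ (w , p) = inj₂ (false ∷ w , p)

comb-∷ : (w : Pt m) (P : Vec (Pt (suc d)) m) →
         comb w P ≡ dot w (Vec.map Vec.head P) ∷ comb w (Vec.map Vec.tail P)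
comb-∷ []          []                = refl
comb-∷ (true  ∷ w) ((true  ∷ p) ∷ P) rewrite comb-∷ w P = refl
comb-∷ (true  ∷ w) ((false ∷ p) ∷ P) rewrite comb-∷ w P = refl
comb-∷ (false ∷ w) (p ∷ P)           rewrite comb-∷ w P = refl

ev-false∷ : (P : Vec (Pt (suc d)) m) (ξ : Pt d) → ev P (false ∷ ξ) ≡ ev (Vec.map Vec.tail P) ξ
ev-false∷ []                ξ = refl
ev-false∷ ((true  ∷ p) ∷ P) ξ = cong (_ ∷_) (ev-false∷ P ξ)
ev-false∷ ((false ∷ p) ∷ P) ξ = cong (_ ∷_) (ev-false∷ P ξ)

ev-true∷ : (P : Vec (Pt (suc d)) m) (ξ : Pt d) →
    ev P (true ∷ ξ) ≡ Vec.map Vec.head P ⊕ ev (Vec.map Vec.tail P) ξ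
ev-true∷ []                ξ = refl
ev-true∷ ((true  ∷ p) ∷ P) ξ = cong (_ ∷_) (ev-true∷ P ξ)
ev-true∷ ((false ∷ p) ∷ P) ξ = cong (_ ∷_) (ev-true∷ P ξ)

ev-trivial : (P : Vec (Pt 0) m) → ev P [] ≡ 𝟎
ev-trivial []       = refl
ev-trivial ([] ∷ P) = cong (false ∷_) (ev-trivial P)

comb-trivial : (w : Pt m) (P : Vec (Pt 0) m) → comb w P ≡ []
comb-trivial w P with comb w P
... | [] = refl

-- The Fredholm alternative, by induction on the dimension. Solutions with leading coordinate
-- `false`, then `true`, are tried. If both fail, the obstructions w and w′ kill the tails of P, and
-- one of w, w′, `w ⊕ w′` kills the heads as well and still detects y.
fredholm : (P : Vec (Pt d) m) (y : Pt m) →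
           (∃ λ ξ → ev P ξ ≡ y) ⊎ (∃ λ w → comb w P ≡ 𝟎 × dot w y ≡ true)
fredholm {zero} P y with nonzero-functional y
... | inj₁ e = inj₁ ([] , trans (ev-trivial P) (sym e))
... | inj₂ (w , p) = inj₂ (w , comb-trivial w P , p)
fredholm {suc d} P y with fredholm (Vec.map Vec.tail P) y
... | inj₁ (ξ , e) = inj₁ (false ∷ ξ , trans (ev-false∷ P ξ) e)
... | inj₂ (w , z , p) with dot w (Vec.map Vec.head P) in hw
...   | false = inj₂ (w , trans (comb-∷ w P) (cong₂ _∷_ hw z) , p)
...   | true with fredholm (Vec.map Vec.tail P) (Vec.map Vec.head P ⊕ y)
...     | inj₁ (ξ , e) = inj₁ (true ∷ ξ , trans (ev-true∷ P ξ)
    (trans (cong (Vec.map Vec.head P ⊕_) e) (⊕-cancelˡ _ y)))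
...     | inj₂ (w′ , z′ , p′) = inj₂ (refute (dot w′ heads) refl)
  where
  heads = Vec.map Vec.head P
  refute : ∀ b → dot w′ heads ≡ b → ∃ λ w → comb w P ≡ 𝟎 × dot w y ≡ true
  refute false h = w′ , trans (comb-∷ w′ P) (cong₂ _∷_ h z′)
                 , trans (sym (trans (dot-⊕ʳ w′ heads y) (cong (_xor dot w′ y) h))) p′
  refute true h = w ⊕ w′
    , trans (comb-∷ (w ⊕ w′) P) (cong₂ _∷_ (trans (dot-⊕ˡ w w′ heads) (cong₂ _xor_ hw h))
        (trans (comb-⊕ w w′ (Vec.map Vec.tail P)) (trans (cong₂ _⊕_ z z′) (⊕-self 𝟎))))
    , trans (dot-⊕ˡ w w′ y) (trans (cong (_xor dot w′ y) p)
        (trans (sym (trans (dot-⊕ʳ w′ heads y) (cong (_xor dot w′ y) h))) p′))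

-- The leading coordinate of comb⁺ w ps is the parity of w, so comb⁺ w ps ≡ 𝟎 is an affine dependency.

comb⁺ : Vec Bool m → Vec (Pt d) m → Pt (suc d)
comb⁺ w ps = comb w (Vec.map (true ∷_) ps)

Column : Vec (Pt m) k → Fin m → Pt k
Column rows j = Vec.map (λ r → lookup r j) rows

-- A row orthogonal to all affine dependencies is, by the Fredholm alternative for the points with
-- `true` prefixed, the list of values of an affine function. The coordinate of the solution at the
-- prefix is the constant term and goes into κ.
affine-map : (ps : Vec (Pt d) m) (rows : Vec (Pt m) k) → (∀ w → comb⁺ w ps ≡ 𝟎 → ev rows w ≡ 𝟎) →
  ∃ λ κ → ∃ λ vs → ∀ j → ev vs (lookup ps j) ⊕ κ ≡ Column rows j
affine-map ps [] _ = [] , [] , λ _ → refl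
affine-map ps (r ∷ rs) orth with affine-map ps rs (λ w e → cong Vec.tail (orth w e)) | fredholm
    (Vec.map (true ∷_) ps) r
... | _ | inj₂ (w , e , p) with trans (sym p) (trans (dot-comm w r) (cong Vec.head (orth w e)))
...   | ()
affine-map ps (r ∷ rs) orth | κ , vs , col | inj₁ (b ∷ ξ , e) = b ∷ κ , ξ ∷ vs , λ j →
    cong₂ _∷_ (head-col j) (col j)
  where
  lookup-ev : ∀ {m} (ps : Vec (Pt _) m) j → lookup (ev (Vec.map (true ∷_) ps) (b ∷ ξ)) j ≡ b xor dot
      (lookup ps j) ξ
  lookup-ev (p ∷ ps) zero    = refl
  lookup-ev (p ∷ ps) (suc j) = lookup-ev ps j
  head-col : ∀ j → dot ξ (lookup ps j) xor b ≡ lookup r j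
  head-col j = trans (Bool.xor-comm (dot ξ (lookup ps j)) b)
    (trans (cong (b xor_) (dot-comm ξ (lookup ps j)))
        (trans (sym (lookup-ev ps j)) (cong (λ y → lookup y j) e)))

-- Reordered enumerations of a set

Sₗ-↭ : (g : Pt d → ℤ) {xs ys : List (Pt d)} → xs ↭ ys → Sₗ g xs ≡ Sₗ g ys
Sₗ-↭ g Perm.refl = refl
Sₗ-↭ g (Perm.prep x p) = cong (_+_ (g x)) (Sₗ-↭ g p)
Sₗ-↭ g (Perm.swap x y p) = trans (cong (λ s → g x + (g y + s)) (Sₗ-↭ g p)) (exchange (g x) (g y) _)
  where
  exchange : ∀ a b c → a + (b + c) ≡ b + (a + c)
  exchange = solve-∀
Sₗ-↭ g (Perm.trans p q) = trans (Sₗ-↭ g p) (Sₗ-↭ g q)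

multiplicity : (E : Subset₂ d) (x : Pt d) → Sₗ (λ p → δ x p) (elems E) ≡ 𝟙 E x
multiplicity E x = trans (Sₗ-elems E (δ x)) (trans (∑-cong (λ y → *-comm (𝟙 E y) (δ x y))) (∑-δ x (𝟙 E)))

locate : (E : Subset₂ d) (ps : Vec (Pt d) m) → toList ps ↭ elems E → ∀ x → x ∈ₛ E → ∃ λ j → lookup ps j ≡ x
locate E ps perm x x∈E = find ps λ e → 1≢0 (trans
    (sym (trans (Sₗ-↭ (δ x) perm) (trans (multiplicity E x) (∈⇒𝟙 E x∈E)))) e)
  where
  1≢0 : 1ℤ ≢ 0ℤ
  1≢0 ()
  find : ∀ {m} (ps : Vec (Pt _) m) → Sₗ (δ x) (toList ps) ≢ 0ℤ → ∃ λ j → lookup ps j ≡ x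
  find []       n = ⊥-elim (n refl)
  find (p ∷ ps) n with p ≟ᵖ x
  ... | yes e = zero , e
  ... | no q with find ps (λ e → n (trans (cong₂ _+_ (δ-≢ (λ r → q (sym r))) e) refl))
  ...   | j , e = suc j , e

-- A repeated point would have multiplicity at least 2, but in any ordering multiplicities are
-- values of the indicator.
elems-distinct : (E : Subset₂ d) {a b : Pt d} {rs : List (Pt d)} → a ∷ b ∷ rs ↭ elems E → a ≢ b
elems-distinct E {a} {rs = rs} perm refl = <⇒≱ (+<+ (ℕ.s≤s (ℕ.s≤s ℕ.z≤n)))
  (≤-trans (+-mono-≤ (≤-reflexive (sym (δ-refl a)))
      (+-mono-≤ (≤-reflexive (sym (δ-refl a))) (0≤Sₗ (0≤δ a) rs)))
    (≤-trans (≤-reflexive (trans (Sₗ-↭ (δ a) perm) (multiplicity E a))) (ind≤1 (E a))))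

elems-∈ : (E : Subset₂ d) {a : Pt d} {rs : List (Pt d)} → a ∷ rs ↭ elems E → a ∈ₛ E
elems-∈ E {a} {rs} perm = 𝟙⇒∈ E λ e → <⇒≱ (+<+ (ℕ.s≤s ℕ.z≤n))
  (≤-trans (+-mono-≤ (≤-reflexive (sym (δ-refl a))) (0≤Sₗ (0≤δ a) rs))
    (≤-reflexive (trans (Sₗ-↭ (δ a) perm) (trans (multiplicity E a) e))))

-- The affine map sends the points of E to the columns, which exhaust ℤ₂ᵏ without repetition; so its
-- linear part is injective on E. It has independent rows, since a vanishing combination of them
-- would be a functional that is constant on all of ℤ₂ᵏ.
labelled-complement : {E : Subset₂ d} (ps : Vec (Pt d) m) (rows : Vec (Pt m) k) →
  toList ps ↭ elems E → size E ≡ N k →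
  (∀ i j → Column rows i ≡ Column rows j → i ≡ j) → (∀ y → ∃ λ j → Column rows j ≡ y) →
  (∀ w → comb⁺ w ps ≡ 𝟎 → ev rows w ≡ 𝟎) → Tiles E × Spectral E
labelled-complement {k = k} {E = E} ps rows perm sz inj surj orth with affine-map ps rows orth
... | κ , vs , col = ann-complement vs indep sz inj′
  where
  inj′ : ∀ {x y} → x ∈ₛ E → y ∈ₛ E → ev vs x ≡ ev vs y → x ≡ y
  inj′ {x} {y} p q e with locate E ps perm x p | locate E ps perm y q
  ... | i , refl | j , refl = cong (lookup ps)
      (inj i j (trans (sym (col i)) (trans (cong (_⊕ κ) e) (col j))))
  indep : Independent vs
  indep c e with nonzero-functional c
  ... | inj₁ z = z
  ... | inj₂ (y , p) with trans (sym p) (trans (dot-comm y c)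
      (trans (constant y) (trans (sym (constant 𝟎)) (dot-𝟎ʳ c))))
    where
    constant : ∀ y → dot c y ≡ dot c κ
    constant y with surj y
    ... | j , refl = trans (cong (dot c) (sym (col j))) (trans (dot-⊕ʳ c _ κ)
      (cong (_xor dot c κ) (trans (sym (dot-comb c vs (lookup ps j)))
          (trans (cong (λ v → dot v (lookup ps j)) e) (dot-𝟎ˡ (lookup ps j))))))
  ...   | ()

-- Eight points, six of which sum to zero

χ-±1 : (ξ x : Pt d) → χ ξ x ≡ 1ℤ ⊎ χ ξ x ≡ -1ℤ
χ-±1 ξ x with dot ξ x
... | false = inj₁ refl
... | true  = inj₂ refl

-- The exceptional configuration: the six points together with p and q enumerate E, so E has eight
-- points.
record ZeroSumSextuple (E : Subset₂ d) : Set where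
  field
    six   : List (Pt d)
    p q   : Pt d
    perm  : six ++ p ∷ q ∷ [] ↭ elems E
    len   : length six ≡ 6
    sum≡𝟎 : ⨁ six ≡ 𝟎

module _ {E : Subset₂ d} (B : ZeroSumSextuple E) where
  open ZeroSumSextuple B
  private
    h : Pt d
    h = p ⊕ q

    front : p ∷ q ∷ six ↭ elems E
    front = Perm.trans (Perm.trans (Perm.prep p
        (↭-sym (Perm.trans (shift q six []) (Perm.prep q (↭-reflexive (++-identityʳ six))))))
              (↭-sym (shift p six (q ∷ [])))) perm

    p∈ : p ∈ₛ E
    p∈ = elems-∈ E front

    q∈ : q ∈ₛ E
    q∈ = elems-∈ E (Perm.trans (Perm.swap q p Perm.refl) front)

    p≢q : p ≢ q
    p≢q = elems-distinct E front

    h≢𝟎 : h ≢ 𝟎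
    h≢𝟎 e = p≢q (⊕≡𝟎⇒≡ p q e)

  -- p and q cancel, and the other six values have product 1, so that their sum is 2 mod 4.
  separating⇒hat≢0 : ∀ ξ → χ ξ h ≡ -1ℤ → hat (𝟙 E) ξ ≢ 0ℤ
  separating⇒hat≢0 ξ s e with χ-⨁-mod4 ξ six
  ... | z , r = 2*i≢1 (z - 1ℤ) (*-cancelˡ {+ 2} (λ ()) (trans (l z) (cong (_- + 4) 4z≡6)))
    where
    l : ∀ z → + 2 * (+ 2 * (z - 1ℤ)) ≡ + 4 * z - + 4
    l = solve-∀
    cancel : ∀ a b → a ≡ 1ℤ ⊎ a ≡ -1ℤ → a * b ≡ -1ℤ → a + (b + 0ℤ) ≡ 0ℤ
    cancel a b (inj₁ refl) t = cong (λ b → 1ℤ + (b + 0ℤ)) (trans (sym (*-identityˡ b)) t)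
    cancel a b (inj₂ refl) t = cong (λ b → -1ℤ + (b + 0ℤ)) (*-cancelˡ { -1ℤ} {b} {1ℤ} (λ ()) t)
    sum≡0 : Sₗ (χ ξ) six ≡ 0ℤ
    sum≡0 = begin
      Sₗ (χ ξ) six                                ≡⟨ +-identityʳ _ ⟨
      Sₗ (χ ξ) six + 0ℤ                           ≡⟨ cong (_+_ (Sₗ (χ ξ) six))
          (cancel (χ ξ p) (χ ξ q) (χ-±1 ξ p) (trans (sym (χ-⊕ʳ ξ p q)) s)) ⟨
      Sₗ (χ ξ) six + Sₗ (χ ξ) (p ∷ q ∷ [])        ≡⟨ Sₗ-++ (χ ξ) six (p ∷ q ∷ []) ⟨
      Sₗ (χ ξ) (six ++ p ∷ q ∷ [])                ≡⟨ Sₗ-↭ (χ ξ) perm ⟩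
      Sₗ (χ ξ) (elems E)                          ≡⟨ Sₗ-elems E (χ ξ) ⟩
      hat (𝟙 E) ξ                                 ≡⟨ e ⟩
      0ℤ                                          ∎
    4z≡6 : + 4 * z ≡ + 6
    4z≡6 = begin
      + 4 * z                                     ≡⟨ +-identityʳ _ ⟨
      + 4 * z + 0ℤ                                ≡⟨ cong (λ u → + 4 * z + (1ℤ - u))
          (trans (cong (χ ξ) sum≡𝟎) (χ-𝟎ʳ ξ)) ⟨
      + 4 * z + (1ℤ - χ ξ (⨁ six))                ≡⟨ r ⟨
      + length six - Sₗ (χ ξ) six                 ≡⟨ cong₂ (λ u v → + u - v) len sum≡0 ⟩
      + 6                                         ∎

  private
    separating⇒≢𝟎 : ∀ ξ → χ ξ h ≡ -1ℤ → ξ ≢ 𝟎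
    separating⇒≢𝟎 ξ s refl with trans (sym (χ-𝟎ˡ h)) s
    ... | ()

    -- Wherever the factor is not 1 the function vanishes. This identifies the total mass of f with
    -- its transform at h.
    ignore-h : (f : Pt d → ℤ) → (∀ ξ → χ ξ h ≡ -1ℤ → f ξ ≡ 0ℤ) → ∑ (λ ξ → f ξ * χ ξ h) ≡ ∑ f
    ignore-h f v = ∑-cong λ ξ → go ξ (χ-±1 ξ h)
      where
      go : ∀ ξ → χ ξ h ≡ 1ℤ ⊎ χ ξ h ≡ -1ℤ → f ξ * χ ξ h ≡ f ξ
      go ξ (inj₁ e) = trans (cong (f ξ *_) e) (*-identityʳ (f ξ))
      go ξ (inj₂ e) = trans (cong (_* χ ξ h) (v ξ e)) (trans (*-zeroˡ (χ ξ h)) (sym (v ξ e)))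

  -- The transform of T vanishes at every frequency separating p and q, so `R T` agrees at h and at
  -- 𝟎. But T avoids h, because E contains two points with that difference; so |T| = 0.
  sextuple⇒¬tiles : ¬ Tiles E
  sextuple⇒¬tiles tiles with tiles⇒complements tiles
  ... | T , C = N≢0 d (trans (sym (Complements.sizes C))
      (trans (cong (_* size E) size-T≡0) (*-zeroˡ (size E))))
    where
    avoids : Avoids T h
    avoids t t∈ t+h∈ = Complements.disjoint C t∈ t+h∈ t≢ p p∈
      (subst (_∈ₛ E) (sym (trans (cong (p ⊕_) (⊕-cancelˡ t h)) (⊕-cancelˡ p q))) q∈)
      where
      t≢ : t ≢ t ⊕ h
      t≢ e = h≢𝟎 (trans (sym (⊕-cancelˡ t h)) (trans (cong (t ⊕_) (sym e)) (⊕-self t)))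
    vanish : ∀ ξ → χ ξ h ≡ -1ℤ → hat (R T) ξ ≡ 0ℤ
    vanish ξ s = trans (hat-R T ξ) (cong (λ z → z * z)
      (*-zero-cancelˡ (separating⇒hat≢0 ξ s) (trans (*-comm (hat (𝟙 E) ξ) (hat (𝟙 T) ξ))
          (hat-product C ξ (separating⇒≢𝟎 ξ s)))))
    size-T≡0 : size T ≡ 0ℤ
    size-T≡0 = *-cancelˡ (N≢0 d) (begin
      N d * size T                        ≡⟨ cong (N d *_) (R-𝟎 T) ⟨
      N d * R T 𝟎                         ≡⟨ ∑-hat (R T) ⟨
      ∑ (hat (R T))                       ≡⟨ ignore-h (hat (R T)) vanish ⟨
      ∑ (λ ξ → hat (R T) ξ * χ ξ h)       ≡⟨ hat-inversion (R T) h ⟩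
      N d * R T h                         ≡⟨ cong (N d *_) (avoids⇒R≡0 T avoids) ⟩
      N d * 0ℤ                            ∎)

  -- `R Λ` vanishes at separating frequencies, so its mass |Λ|² equals its transform at h, the
  -- square of the transform of Λ. That is 0 by duality, and E would be empty.
  sextuple⇒¬spectral : ¬ Spectral E
  sextuple⇒¬spectral spectral with spectral⇒pair spectral
  ... | Λ , P = R≡0⇒avoids E R-E≡0 p p∈ (subst (_∈ₛ E) (sym (⊕-cancelˡ p q)) q∈)
    where
    size-Λ≡0 : size Λ ≡ 0ℤ
    size-Λ≡0 = i*i≡0⇒i≡0 (size Λ) (begin
      size Λ * size Λ                 ≡⟨ ∑-conv (𝟙 Λ) (𝟙 Λ) ⟨
      ∑ (R Λ)                         ≡⟨ ignore-h (R Λ)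
          (λ ξ s → avoids⇒R≡0 Λ (spectrum-avoids P ξ (separating⇒≢𝟎 ξ s) (separating⇒hat≢0 ξ s))) ⟨
      ∑ (λ ξ → R Λ ξ * χ ξ h)         ≡⟨ ∑-cong (λ ξ → cong (R Λ ξ *_) (χ-comm ξ h)) ⟩
      hat (R Λ) h                     ≡⟨ hat-R Λ h ⟩
      hat (𝟙 Λ) h * hat (𝟙 Λ) h       ≡⟨ cong (λ z → z * z) (SpectralPair.orth (dual P) p∈ q∈ p≢q) ⟩
      0ℤ                              ∎)
    size-E≡0 : size E ≡ 0ℤ
    size-E≡0 = trans (sym (SpectralPair.sizes P)) size-Λ≡0
    R-E≡0 : R E h ≡ 0ℤ
    R-E≡0 = ≤-antisym (≤-trans (∑-mono-≤ below) (≤-reflexive size-E≡0)) (0≤R E h)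
      where
      below : ∀ x → 𝟙 E x * 𝟙 E (x ⊕ h) ℤ.≤ 𝟙 E x
      below x with E x | E (x ⊕ h)
      ... | true  | true  = ≤-refl
      ... | true  | false = +≤+ ℕ.z≤n
      ... | false | b     = ≤-reflexive (*-zeroˡ (ind b))

-- Affine dependencies as words of a binary code

sel unsel : Vec Bool m → Vec (Pt d) m → List (Pt d)
sel []          []       = []
sel (true  ∷ w) (p ∷ ps) = p ∷ sel w ps
sel (false ∷ w) (p ∷ ps) = sel w ps
unsel []          []       = []
unsel (true  ∷ w) (p ∷ ps) = unsel w ps
unsel (false ∷ w) (p ∷ ps) = p ∷ unsel w ps

wt : Vec Bool m → ℕ
wt []          = 0
wt (true  ∷ w) = suc (wt w)
wt (false ∷ w) = wt w

sel-unsel : (w : Vec Bool m) (ps : Vec (Pt d) m) → sel w ps ++ unsel w ps ↭ toList ps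
sel-unsel []          []       = Perm.refl
sel-unsel (true  ∷ w) (p ∷ ps) = Perm.prep p (sel-unsel w ps)
sel-unsel (false ∷ w) (p ∷ ps) = ↭-trans (shift p (sel w ps) (unsel w ps)) (Perm.prep p (sel-unsel w ps))

length-sel : (w : Vec Bool m) (ps : Vec (Pt d) m) → length (sel w ps) ≡ wt w
length-sel []          []       = refl
length-sel (true  ∷ w) (p ∷ ps) = cong suc (length-sel w ps)
length-sel (false ∷ w) (p ∷ ps) = length-sel w ps

-- Sum of the points lifted by a leading `true`: it vanishes when the number of points is even and
-- they add up to 𝟎, and only then.
⨁⁺ : List (Pt d) → Pt (suc d)
⨁⁺ []       = 𝟎
⨁⁺ (p ∷ ps) = (true ∷ p) ⊕ ⨁⁺ ps

comb⁺-sel : (w : Vec Bool m) (ps : Vec (Pt d) m) → comb⁺ w ps ≡ ⨁⁺ (sel w ps)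
comb⁺-sel []          []       = refl
comb⁺-sel (true  ∷ w) (p ∷ ps) = cong ((true ∷ p) ⊕_) (comb⁺-sel w ps)
comb⁺-sel (false ∷ w) (p ∷ ps) = comb⁺-sel w ps

tail-⨁⁺ : (ps : List (Pt d)) → Vec.tail (⨁⁺ ps) ≡ ⨁ ps
tail-⨁⁺ [] = refl
tail-⨁⁺ (p ∷ ps) with ⨁⁺ ps | tail-⨁⁺ ps
... | _ ∷ s | refl = refl

⨁⁺-↭ : {xs ys : List (Pt d)} → xs ↭ ys → ⨁⁺ xs ≡ ⨁⁺ ys
⨁⁺-↭ Perm.refl = refl
⨁⁺-↭ (Perm.prep x p) = cong ((true ∷ x) ⊕_) (⨁⁺-↭ p)
⨁⁺-↭ (Perm.swap x y p) = trans (cong (λ s → (true ∷ x) ⊕ ((true ∷ y) ⊕ s)) (⨁⁺-↭ p))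
    (exchange (true ∷ x) (true ∷ y) _)
  where
  exchange : (a b c : Pt (suc _)) → a ⊕ (b ⊕ c) ≡ b ⊕ (a ⊕ c)
  exchange a b c = trans (sym (⊕-assoc a b c)) (trans (cong (_⊕ c) (⊕-comm a b)) (⊕-assoc b a c))
⨁⁺-↭ (Perm.trans p q) = trans (⨁⁺-↭ p) (⨁⁺-↭ q)

4∣ᵇ_ : ℕ → Bool
4∣ᵇ 0 = true
4∣ᵇ 1 = false
4∣ᵇ 2 = false
4∣ᵇ 3 = false
4∣ᵇ suc (suc (suc (suc n))) = 4∣ᵇ n

Dep : Vec (Pt d) m → Pt m → Set
Dep ps w = comb⁺ w ps ≡ 𝟎

-- Dependencies have even weight by the leading coordinate, and weight 2 would repeat a point. Below
-- 9 this leaves 0, 4, 6 and 8, and weight 6 with two remaining points is a sextuple.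
doubly-even-or-sextuple : (E : Subset₂ d) (ps : Vec (Pt d) m) → m ≤ 8 → (∀ n → 6 ℕ.+ n ≡ m → n ≡ 2) →
    toList ps ↭ elems E →
  ZeroSumSextuple E ⊎ (∀ w → Dep ps w → 4∣ᵇ (wt w) ≡ true)
doubly-even-or-sextuple {d} {m} E ps m≤8 m≡6+2 perm with
    search (λ w → ((comb⁺ w ps ≟ᵖ 𝟎) ×-dec (wt w ℕ.≟ 6)) ×-dec (length (unsel w ps) ℕ.≟ 2))
... | inj₁ (w , (dep , wt≡6) , l₂) = inj₁ (bad (unsel w ps) refl l₂)
  where
  bad : ∀ rs → unsel w ps ≡ rs → length rs ≡ 2 → ZeroSumSextuple E
  bad (p ∷ q ∷ []) e _ = record
    { six = sel w ps ; p = p ; q = q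
    ; perm = ↭-trans (subst (λ rs → sel w ps ++ rs ↭ toList ps) e (sel-unsel w ps)) perm
    ; len = trans (length-sel w ps) wt≡6
    ; sum≡𝟎 = trans (sym (tail-⨁⁺ (sel w ps))) (cong Vec.tail (trans (sym (comb⁺-sel w ps)) dep)) }
... | inj₂ none = inj₂ λ w dep → subst (λ n → 4∣ᵇ n ≡ true) (length-sel w ps)
      (ok w dep (sel w ps) refl (trans (sym (comb⁺-sel w ps)) dep))
  where
  total : ∀ w → length (sel w ps) ℕ.+ length (unsel w ps) ≡ m
  total w = trans (sym (length-++ (sel w ps))) (trans (↭-length (sel-unsel w ps)) (Vec.length-toList ps))
  no-odd : {A : Set} {s : Pt (suc d)} {t : Pt d} → s ≡ true ∷ t → s ≡ 𝟎 → A
  no-odd refl ()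
  ok : ∀ w → Dep ps w → ∀ xs → sel w ps ≡ xs → ⨁⁺ xs ≡ 𝟎 → 4∣ᵇ (length xs) ≡ true
  ok w dep [] e s = refl
  ok w dep (a ∷ []) e s = no-odd refl s
  ok w dep (a ∷ b ∷ []) e s = ⊥-elim (elems-distinct E
      (↭-trans (subst (λ xs → xs ++ unsel w ps ↭ toList ps) e (sel-unsel w ps)) perm)
    (⊕≡𝟎⇒≡ a b (trans (cong (a ⊕_) (sym (⊕-identityʳ b))) (cong Vec.tail s))))
  ok w dep (a ∷ b ∷ c ∷ []) e s = no-odd refl s
  ok w dep (_ ∷ _ ∷ _ ∷ _ ∷ []) e s = refl
  ok w dep (_ ∷ _ ∷ _ ∷ _ ∷ _ ∷ []) e s = no-odd refl s
  ok w dep (_ ∷ _ ∷ _ ∷ _ ∷ _ ∷ _ ∷ []) e s = ⊥-elim (none w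
    ((dep , trans (sym (length-sel w ps)) (cong length e))
    , m≡6+2 (length (unsel w ps)) (trans (cong (λ xs → length xs ℕ.+ length (unsel w ps)) (sym e))
        (total w))))
  ok w dep (_ ∷ _ ∷ _ ∷ _ ∷ _ ∷ _ ∷ _ ∷ []) e s = no-odd refl s
  ok w dep (_ ∷ _ ∷ _ ∷ _ ∷ _ ∷ _ ∷ _ ∷ _ ∷ []) e s = refl
  ok w dep (_ ∷ _ ∷ _ ∷ _ ∷ _ ∷ _ ∷ _ ∷ _ ∷ _ ∷ xs) e s = ⊥-elim (ℕ.<⇒≱ (ℕ.m≤m+n 9 (length xs))
    (ℕ.≤-trans (ℕ.≤-reflexive (cong length (sym e)))
        (ℕ.≤-trans (ℕ.m≤m+n _ (length (unsel w ps))) (ℕ.≤-trans (ℕ.≤-reflexive (total w)) m≤8))))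

-- Verification over all words

allTrue : (Pt m → Bool) → Bool
allTrue {zero}  f = f []
allTrue {suc m} f = allTrue (λ w → f (false ∷ w)) ∧ allTrue (λ w → f (true ∷ w))

allTrue⁻ : (f : Pt m → Bool) → allTrue f ≡ true → ∀ w → f w ≡ true
allTrue⁻ f p []          = p
allTrue⁻ f p (false ∷ w) = allTrue⁻ (λ w → f (false ∷ w)) (proj₁ (∧-true p)) w
allTrue⁻ f p (true  ∷ w) = allTrue⁻ (λ w → f (true ∷ w))
    (proj₂ (∧-true {allTrue (λ w → f (false ∷ w))} p)) w

infixr 5 _⇒ᵇ_
_⇒ᵇ_ : Bool → Bool → Bool
a ⇒ᵇ b = not a ∨ b

⇒ᵇ⁻ : ∀ {a b} → a ⇒ᵇ b ≡ true → a ≡ true → b ≡ true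
⇒ᵇ⁻ p refl = p

isZero : Pt m → Bool
isZero []          = true
isZero (true ∷ w)  = false
isZero (false ∷ w) = isZero w

isZero⁻ : (w : Pt m) → isZero w ≡ true → w ≡ 𝟎
isZero⁻ []          _ = refl
isZero⁻ (false ∷ w) p = cong (false ∷_) (isZero⁻ w p)
isZero⁻ (true ∷ w) ()

-- For concrete rows and tests the hypothesis is a closed Boolean that evaluates over all words.
check-rows : (rows : Vec (Pt m) k) (f : Pt m → Bool) → allTrue (λ w → f w ⇒ᵇ isZero (ev rows w)) ≡ true →
  ∀ w → f w ≡ true → ev rows w ≡ 𝟎
check-rows rows f p w q = isZero⁻ (ev rows w) (⇒ᵇ⁻ (allTrue⁻ (λ w → f w ⇒ᵇ isZero (ev rows w)) p w) q)

-- Either alternative settles the equivalence: on the left tiling and spectrality both fail, on the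
-- right both hold.
FugledeOutcome : Subset₂ d → Set
FugledeOutcome E = ZeroSumSextuple E ⊎ (Tiles E × Spectral E)

I O : Bool
I = true
O = false

-- Indicators of the first 4 points, of the first 2 in each half, and of the first in each pair.
y₁ y₂ y₃ : Pt 8
y₁ = I ∷ I ∷ I ∷ I ∷ O ∷ O ∷ O ∷ O ∷ []
y₂ = I ∷ I ∷ O ∷ O ∷ I ∷ I ∷ O ∷ O ∷ []
y₃ = I ∷ O ∷ I ∷ O ∷ I ∷ O ∷ I ∷ O ∷ []

rows₈ : Vec (Pt 8) 3
rows₈ = y₁ ∷ y₂ ∷ y₃ ∷ []

rows₄ : Vec (Pt 4) 2
rows₄ = (I ∷ I ∷ O ∷ O ∷ []) ∷ (I ∷ O ∷ I ∷ O ∷ []) ∷ []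

rows₂ : Vec (Pt 2) 1
rows₂ = (I ∷ O ∷ []) ∷ []

rows₁ : Vec (Pt 1) 0
rows₁ = []

all-distinct? : (rows : Vec (Pt m) k) → Dec (∀ i j → Column rows i ≡ Column rows j → i ≡ j)
all-distinct? rows = Fin.all? (λ i → Fin.all? (λ j → (Column rows i ≟ᵖ Column rows j) →-dec (i Fin.≟ j)))

all-covered? : (rows : Vec (Pt m) k) → Dec (∀ y → ∃ λ j → Column rows j ≡ y)
all-covered? rows with search (λ y → ¬? (Fin.any? (λ j → Column rows j ≟ᵖ y)))
... | inj₁ (y , n) = no (λ f → n (f y))
... | inj₂ n = yes (λ y → decidable-stable (Fin.any? (λ j → Column rows j ≟ᵖ y)) (n y))

toVec : {A : Set} (xs : List A) → length xs ≡ m → ∃ λ (v : Vec A m) → toList v ≡ xs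
toVec xs refl = Vec.fromList xs , Vec.toList∘fromList xs

-- Reordering the points along dependencies

σ : Vec (Pt d) m → Pt (suc d)
σ ps = ⨁⁺ (toList ps)

comb⁺-++ : ∀ {m n} (u : Vec Bool m) (v : Vec Bool n) (ps : Vec (Pt d) m) (qs : Vec (Pt d) n) →
  comb⁺ (u Vec.++ v) (ps Vec.++ qs) ≡ comb⁺ u ps ⊕ comb⁺ v qs
comb⁺-++ []          v []       qs = sym (⊕-identityˡ _)
comb⁺-++ (true  ∷ u) v (p ∷ ps) qs = trans (cong ((true ∷ p) ⊕_) (comb⁺-++ u v ps qs))
    (sym (⊕-assoc (true ∷ p) _ _))
comb⁺-++ (false ∷ u) v (p ∷ ps) qs = comb⁺-++ u v ps qs

comb⁺-all : (ps : Vec (Pt d) m) → comb⁺ (replicate m true) ps ≡ σ ps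
comb⁺-all []       = refl
comb⁺-all (p ∷ ps) = cong ((true ∷ p) ⊕_) (comb⁺-all ps)

comb⁺-none : (ps : Vec (Pt d) m) → comb⁺ (replicate m false) ps ≡ 𝟎
comb⁺-none ps = comb-𝟎 (Vec.map (true ∷_) ps)

-- A reordering of X that brings the points selected by w to the front; `σ-fst` keeps the sum of
-- that half.
record Halves {r : ℕ} (X : Vec (Pt d) (r ℕ.+ r)) (w : Vec Bool (r ℕ.+ r)) : Set where
  field
    fst snd : Vec (Pt d) r
    perm : toList (fst Vec.++ snd) ↭ toList X
    σ-fst : σ fst ≡ comb⁺ w X

halve : ∀ {r} (X : Vec (Pt d) (r ℕ.+ r)) (w : Vec Bool (r ℕ.+ r)) → wt w ≡ r → Halves X w
halve {r = r} X w wt≡r with toVec (sel w X) (trans (length-sel w X) wt≡r) | toVec (unsel w X) length-unsel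
  where
  length-unsel : length (unsel w X) ≡ r
  length-unsel = ℕ.+-cancelˡ-≡ r _ _ (trans (cong (ℕ._+ length (unsel w X))
      (sym (trans (length-sel w X) wt≡r)))
    (trans (sym (length-++ (sel w X))) (trans (↭-length (sel-unsel w X)) (Vec.length-toList X))))
... | u , e | v , f = record
  { fst = u ; snd = v
  ; perm = ↭-trans (↭-reflexive (trans (Vec.toList-++ u v) (cong₂ _++_ e f))) (sel-unsel w X)
  ; σ-fst = trans (cong ⨁⁺ e) (sym (comb⁺-sel w X)) }

toList-++-↭ : ∀ {m n m′ n′} {u : Vec (Pt d) m} {v : Vec (Pt d) n} {u′ : Vec (Pt d) m′}
    {v′ : Vec (Pt d) n′} →
  toList u ↭ toList u′ → toList v ↭ toList v′ → toList (u Vec.++ v) ↭ toList (u′ Vec.++ v′)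
toList-++-↭ {u = u} {v} {u′} {v′} p q =
  ↭-trans (↭-reflexive (Vec.toList-++ u v)) (↭-trans (++⁺ p q) (↭-reflexive (sym (Vec.toList-++ u′ v′))))

σ-++ : ∀ {m n} (u : Vec (Pt d) m) (v : Vec (Pt d) n) → σ (u Vec.++ v) ≡ σ u ⊕ σ v
σ-++ []      v = sym (⊕-identityˡ (σ v))
σ-++ (p ∷ u) v = trans (cong ((true ∷ p) ⊕_) (σ-++ u v)) (sym (⊕-assoc (true ∷ p) (σ u) (σ v)))

search-dep : (ps : Vec (Pt d) m) (t : Pt m → Bool) →
  (∃ λ w → Dep ps w × t w ≡ true) ⊎ (∀ w → Dep ps w → t w ≡ false)
search-dep ps t with search (λ w → (comb⁺ w ps ≟ᵖ 𝟎) ×-dec (t w Bool.≟ true))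
... | inj₁ s = inj₁ s
... | inj₂ n = inj₂ λ w dep → Bool.¬-not (λ e → n w (dep , e))

dep-⊕ : (ps : Vec (Pt d) m) {w y : Pt m} → Dep ps w → Dep ps y → Dep ps (w ⊕ y)
dep-⊕ ps {w} {y} p q = trans (comb-⊕ w y _) (trans (cong₂ _⊕_ p q) (⊕-self 𝟎))

module _ (E : Subset₂ d) (size≡8 : size E ≡ + 8) where
  private
    doubly-even : (ps : Vec (Pt d) 8) → toList ps ↭ elems E →
        ZeroSumSextuple E ⊎ (∀ w → Dep ps w → 4∣ᵇ (wt w) ≡ true)
    doubly-even ps = doubly-even-or-sextuple E ps ℕ.≤-refl (λ { _ refl → refl })

    -- Here f is a test passed by all dependencies, and evaluation shows that every word passing it
    -- is orthogonal to y₁, y₂ and y₃.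
    finish : (ps : Vec (Pt d) 8) → toList ps ↭ elems E → (f : Pt 8 → Bool) → (∀ w → Dep ps w → f w ≡ true) →
      allTrue (λ w → f w ⇒ᵇ isZero (ev rows₈ w)) ≡ true → FugledeOutcome E
    finish ps perm f dep-f ch = inj₂ (labelled-complement ps rows₈ perm size≡8
      (from-yes (all-distinct? rows₈)) (from-yes (all-covered? rows₈))
      (λ w dep → check-rows rows₈ f ch w (dep-f w dep)))

    even : Pt 8 → Bool
    even w = 4∣ᵇ (wt w)

    split-pairs : Pt 8 → Bool
    split-pairs (a ∷ b ∷ c ∷ e ∷ f ∷ g ∷ h ∷ i ∷ []) = (a xor b) ∧ (c xor e) ∧ (f xor g) ∧ (h xor i)

    -- The weight of `w ⊕ y` is wt w + wt y minus twice the overlap. As w, yᵢ and `w ⊕ yᵢ` all have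
    -- weight divisible by 4, each overlap is even.
    stage₃ : (ps : Vec (Pt d) 8) → toList ps ↭ elems E → Dep ps y₁ → Dep ps y₂ → Dep ps y₃ →
        FugledeOutcome E
    stage₃ ps perm d₁ d₂ d₃ with doubly-even ps perm
    ... | inj₁ b = inj₁ b
    ... | inj₂ ok = finish ps perm (λ w → even w ∧ (even (w ⊕ y₁) ∧ (even (w ⊕ y₂) ∧ even (w ⊕ y₃))))
          (λ w dep → ∧-true⁻ (ok w dep) (∧-true⁻ (ok (w ⊕ y₁) (dep-⊕ ps {w} {y₁} dep d₁))
              (∧-true⁻ (ok (w ⊕ y₂) (dep-⊕ ps {w} {y₂} dep d₂)) (ok (w ⊕ y₃) (dep-⊕ ps {w} {y₃} dep d₃)))))
          refl

    stage₂ : (X₁ X₂ Y₁ Y₂ : Vec (Pt d) 2) → toList ((X₁ Vec.++ X₂) Vec.++ (Y₁ Vec.++ Y₂)) ↭ elems E →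
      σ X₁ ⊕ σ X₂ ≡ 𝟎 → σ X₁ ⊕ σ Y₁ ≡ 𝟎 → FugledeOutcome E
    stage₂ X₁ X₂ Y₁ Y₂ perm s₁ s₂ with doubly-even ((X₁ Vec.++ X₂) Vec.++ (Y₁ Vec.++ Y₂)) perm
    ... | inj₁ b = inj₁ b
    ... | inj₂ ok with search-dep ((X₁ Vec.++ X₂) Vec.++ (Y₁ Vec.++ Y₂)) split-pairs
    -- Orthogonality to y₁, y₂ and the all-one word gives w the same parity on all four pairs. Odd
    -- parity is excluded, so w is a union of pairs, of even number since its weight is divisible by
    -- 4.
    ...   | inj₂ none = finish ps perm (λ w →
        even w ∧ (even (w ⊕ y₁) ∧ (even (w ⊕ y₂) ∧ not (split-pairs w))))
          (λ w dep → ∧-true⁻ (ok w dep) (∧-true⁻ (ok (w ⊕ y₁) (dep-⊕ ps {w} {y₁} dep d₁))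
              (∧-true⁻ (ok (w ⊕ y₂) (dep-⊕ ps {w} {y₂} dep d₂)) (cong not (none w dep)))))
          refl
      where
      ps = (X₁ Vec.++ X₂) Vec.++ (Y₁ Vec.++ Y₂)
      d₁ : Dep ps y₁
      d₁ = trans (comb⁺-++ (I ∷ I ∷ I ∷ I ∷ []) (O ∷ O ∷ O ∷ O ∷ []) (X₁ Vec.++ X₂) (Y₁ Vec.++ Y₂))
        (trans (cong₂ _⊕_ (trans (comb⁺-all (X₁ Vec.++ X₂)) (trans (σ-++ X₁ X₂) s₁))
            (comb⁺-none (Y₁ Vec.++ Y₂))) (⊕-self 𝟎))
      half : (X Y : Vec (Pt d) 2) → comb⁺ (I ∷ I ∷ O ∷ O ∷ []) (X Vec.++ Y) ≡ σ X
      half X Y = trans (comb⁺-++ (I ∷ I ∷ []) (O ∷ O ∷ []) X Y)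
          (trans (cong₂ _⊕_ (comb⁺-all X) (comb⁺-none Y)) (⊕-identityʳ (σ X)))
      d₂ : Dep ps y₂
      d₂ = trans (comb⁺-++ (I ∷ I ∷ O ∷ O ∷ []) (I ∷ I ∷ O ∷ O ∷ []) (X₁ Vec.++ X₂) (Y₁ Vec.++ Y₂))
        (trans (cong₂ _⊕_ (half X₁ X₂) (half Y₁ Y₂)) s₂)
    ...   | inj₁ (a ∷ b ∷ c ∷ e ∷ f ∷ g ∷ h ∷ i ∷ [] , dep , t) =
      reorder (halve X₁ (a ∷ b ∷ []) (one a b (proj₁ (∧-true t))))
              (halve X₂ (c ∷ e ∷ []) (one c e (proj₁ (∧-true (proj₂ (∧-true {a xor b} t))))))
              (halve Y₁ (f ∷ g ∷ []) (one f g
                  (proj₁ (∧-true (proj₂ (∧-true {c xor e} (proj₂ (∧-true {a xor b} t))))))))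
              (halve Y₂ (h ∷ i ∷ []) (one h i
                  (proj₂ (∧-true {f xor g} (proj₂ (∧-true {c xor e} (proj₂ (∧-true {a xor b} t))))))))
      where
      one : ∀ a b → a xor b ≡ true → wt (a ∷ b ∷ []) ≡ 1
      one true  false _ = refl
      one false true  _ = refl
      one true  true ()
      one false false ()
      reorder : Halves X₁ (a ∷ b ∷ []) → Halves X₂ (c ∷ e ∷ []) → Halves Y₁ (f ∷ g ∷ []) →
          Halves Y₂ (h ∷ i ∷ []) → FugledeOutcome E
      reorder H₁ H₂ H₃ H₄ = stage₃ ps (↭-trans
          (toList-++-↭ {u = P₁ Vec.++ P₂} {P₃ Vec.++ P₄} {X₁ Vec.++ X₂} {Y₁ Vec.++ Y₂}
            (toList-++-↭ {u = P₁} {P₂} {X₁} {X₂} (Halves.perm H₁) (Halves.perm H₂))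
            (toList-++-↭ {u = P₃} {P₄} {Y₁} {Y₂} (Halves.perm H₃) (Halves.perm H₄))) perm) d₁ d₂ d₃
        where
        P₁ = Halves.fst H₁ Vec.++ Halves.snd H₁
        P₂ = Halves.fst H₂ Vec.++ Halves.snd H₂
        P₃ = Halves.fst H₃ Vec.++ Halves.snd H₃
        P₄ = Halves.fst H₄ Vec.++ Halves.snd H₄
        ps = (P₁ Vec.++ P₂) Vec.++ (P₃ Vec.++ P₄)
        σ-P : ∀ {X w} (H : Halves {r = 1} X w) → σ (Halves.fst H Vec.++ Halves.snd H) ≡ σ X
        σ-P H = ⨁⁺-↭ (Halves.perm H)
        comb-two : ∀ {m n} (u : Vec Bool m) (v : Vec Bool n) (X : Vec (Pt d) m) (Y : Vec (Pt d) n)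
            {s t : Pt (suc d)} →
          comb⁺ u X ≡ s → comb⁺ v Y ≡ t → comb⁺ (u Vec.++ v) (X Vec.++ Y) ≡ s ⊕ t
        comb-two u v X Y p q = trans (comb⁺-++ u v X Y) (cong₂ _⊕_ p q)
        II OO IO : Pt 2
        II = I ∷ I ∷ []
        OO = O ∷ O ∷ []
        IO = I ∷ O ∷ []
        d₁ : Dep ps y₁
        d₁ = trans (comb-two (II Vec.++ II) (OO Vec.++ OO) (P₁ Vec.++ P₂) (P₃ Vec.++ P₄)
                (comb-two II II P₁ P₂ (trans (comb⁺-all P₁) (σ-P H₁)) (trans (comb⁺-all P₂) (σ-P H₂)))
                (comb⁺-none (P₃ Vec.++ P₄)))
             (trans (⊕-identityʳ _) s₁)
        half : ∀ {X w Y v} (H : Halves {r = 1} X w) (K : Halves {r = 1} Y v) →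
          comb⁺ (II Vec.++ OO) ((Halves.fst H Vec.++ Halves.snd H) Vec.++
              (Halves.fst K Vec.++ Halves.snd K)) ≡ σ X
        half H K = trans (comb-two II OO (Halves.fst H Vec.++ Halves.snd H)
            (Halves.fst K Vec.++ Halves.snd K)
             (trans (comb⁺-all (Halves.fst H Vec.++ Halves.snd H)) (σ-P H))
                 (comb⁺-none (Halves.fst K Vec.++ Halves.snd K))) (⊕-identityʳ _)
        d₂ : Dep ps y₂
        d₂ = trans (comb-two (II Vec.++ OO) (II Vec.++ OO) (P₁ Vec.++ P₂) (P₃ Vec.++ P₄) (half H₁ H₂)
            (half H₃ H₄)) s₂
        first : ∀ {X w} (H : Halves {r = 1} X w) → comb⁺ IO (Halves.fst H Vec.++ Halves.snd H) ≡ comb⁺ w X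
        first H = trans (comb-two (I ∷ []) (O ∷ []) (Halves.fst H) (Halves.snd H)
            (comb⁺-all (Halves.fst H)) (comb⁺-none (Halves.snd H)))
          (trans (⊕-identityʳ _) (Halves.σ-fst H))
        d₃ : Dep ps y₃
        d₃ = trans (comb-two (IO Vec.++ IO) (IO Vec.++ IO) (P₁ Vec.++ P₂) (P₃ Vec.++ P₄)
               (comb-two IO IO P₁ P₂ (first H₁) (first H₂)) (comb-two IO IO P₃ P₄ (first H₃) (first H₄)))
             (trans (sym (trans (comb⁺-++ (a ∷ b ∷ c ∷ e ∷ []) (f ∷ g ∷ h ∷ i ∷ []) (X₁ Vec.++ X₂)
                 (Y₁ Vec.++ Y₂))
               (cong₂ _⊕_ (comb⁺-++ (a ∷ b ∷ []) (c ∷ e ∷ []) X₁ X₂)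
                   (comb⁺-++ (f ∷ g ∷ []) (h ∷ i ∷ []) Y₁ Y₂)))) dep)

    halves-2 : Pt 8 → Bool
    halves-2 (a ∷ b ∷ c ∷ e ∷ rest) = (wt (a ∷ b ∷ c ∷ e ∷ []) ℕ.≡ᵇ 2) ∧ (wt rest ℕ.≡ᵇ 2)

    ≡ᵇ⁻ : ∀ a b → (a ℕ.≡ᵇ b) ≡ true → a ≡ b
    ≡ᵇ⁻ a b p = ℕ.≡ᵇ⇒≡ a b (subst Data.Bool.T (sym p) _)

    stage₁ : (X Y : Vec (Pt d) 4) → toList (X Vec.++ Y) ↭ elems E → σ X ≡ 𝟎 → FugledeOutcome E
    stage₁ X Y perm s with doubly-even (X Vec.++ Y) perm
    ... | inj₁ b = inj₁ b
    ... | inj₂ ok with search-dep (X Vec.++ Y) halves-2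
    -- A doubly even word orthogonal to y₁ has two points in each half or is a union of halves; only
    -- the latter remains.
    ...   | inj₂ none = finish (X Vec.++ Y) perm (λ w → even w ∧ (even (w ⊕ y₁) ∧ not (halves-2 w)))
            (λ w dep → ∧-true⁻ (ok w dep) (∧-true⁻ (ok (w ⊕ y₁) (dep-⊕ (X Vec.++ Y) {w} {y₁} dep d₁))
                (cong not (none w dep)))) refl
      where
      d₁ : Dep (X Vec.++ Y) y₁
      d₁ = trans (comb⁺-++ (I ∷ I ∷ I ∷ I ∷ []) (O ∷ O ∷ O ∷ O ∷ []) X Y)
        (trans (cong₂ _⊕_ (trans (comb⁺-all X) s) (comb⁺-none Y)) (⊕-self 𝟎))
    ...   | inj₁ (a ∷ b ∷ c ∷ e ∷ rest , dep , t) =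
      reorder (halve X w₁ (≡ᵇ⁻ (wt w₁) 2 (proj₁ (∧-true t))))
          (halve Y rest (≡ᵇ⁻ (wt rest) 2 (proj₂ (∧-true {wt w₁ ℕ.≡ᵇ 2} t))))
      where
      w₁ = a ∷ b ∷ c ∷ e ∷ []
      reorder : Halves {r = 2} X w₁ → Halves {r = 2} Y rest → FugledeOutcome E
      reorder H K = stage₂ (Halves.fst H) (Halves.snd H) (Halves.fst K) (Halves.snd K)
        (↭-trans (toList-++-↭ {u = Halves.fst H Vec.++ Halves.snd H} {Halves.fst K Vec.++ Halves.snd K}
            {X} {Y} (Halves.perm H) (Halves.perm K)) perm)
        (trans (sym (σ-++ (Halves.fst H) (Halves.snd H))) (trans (⨁⁺-↭ (Halves.perm H)) s))
        (trans (cong₂ _⊕_ (Halves.σ-fst H) (Halves.σ-fst K)) (trans (sym (comb⁺-++ w₁ rest X Y)) dep))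

    stage₀ : (ps : Vec (Pt d) 8) → toList ps ↭ elems E → FugledeOutcome E
    stage₀ ps perm with doubly-even ps perm
    ... | inj₁ b = inj₁ b
    ... | inj₂ ok with search-dep ps (λ w → wt w ℕ.≡ᵇ 4)
    -- Only the zero word and the all-one word remain.
    ...   | inj₂ none = finish ps perm (λ w → even w ∧ not (wt w ℕ.≡ᵇ 4))
        (λ w dep → ∧-true⁻ (ok w dep) (cong not (none w dep))) refl
    ...   | inj₁ (w , dep , t) = reorder (halve ps w (≡ᵇ⁻ (wt w) 4 t))
      where
      reorder : Halves {r = 4} ps w → FugledeOutcome E
      reorder H = stage₁ (Halves.fst H) (Halves.snd H) (↭-trans (Halves.perm H) perm)
          (trans (Halves.σ-fst H) dep)

  -- Doubly even codes are self-orthogonal.  If some dependency halves every current block of points,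
  -- reorder so that it becomes the next yᵢ, which is then orthogonal to all dependencies; if none does,
  -- every dependency is orthogonal to all the remaining yᵢ in any order.
  eight-points : FugledeOutcome E
  eight-points with toVec (elems E) (+-injective (trans (card≡size E) size≡8))
  ... | ps , e = stage₀ ps (↭-reflexive e)

-- With at most five points the weight 6 cannot occur, so the dependencies have weight 0 or 4.
few-points : (E : Subset₂ d) (rows : Vec (Pt m) k) → size E ≡ + m → + m ≡ N k → m ≤ 5 →
  (∀ i j → Column rows i ≡ Column rows j → i ≡ j) → (∀ y → ∃ λ j → Column rows j ≡ y) →
  allTrue (λ w → 4∣ᵇ (wt w) ⇒ᵇ isZero (ev rows w)) ≡ true → FugledeOutcome E
few-points {m = m} E rows sz m≡2^k m≤5 inj surj ch with
    toVec (elems E) (+-injective (trans (card≡size E) sz))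
... | ps , e with doubly-even-or-sextuple E ps (ℕ.≤-trans m≤5 (ℕ.m≤m+n 5 3))
    (λ n p → ⊥-elim (ℕ.<⇒≱ (ℕ.m≤m+n 6 n) (subst (_≤ 5) (sym p) m≤5))) (↭-reflexive e)
...   | inj₁ b = inj₁ b
...   | inj₂ ok = inj₂ (labelled-complement ps rows (↭-reflexive e) (trans sz m≡2^k) inj surj
          (λ w dep → check-rows rows (λ w → 4∣ᵇ (wt w)) ch w (ok w dep)))

one-point : (E : Subset₂ d) → size E ≡ + 1 → FugledeOutcome E
one-point E sz = few-points E rows₁ sz refl (ℕ.m≤m+n 1 4) (from-yes (all-distinct? rows₁))
    (from-yes (all-covered? rows₁)) refl

two-points : (E : Subset₂ d) → size E ≡ + 2 → FugledeOutcome E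
two-points E sz = few-points E rows₂ sz refl (ℕ.m≤m+n 2 3) (from-yes (all-distinct? rows₂))
    (from-yes (all-covered? rows₂)) refl

four-points : (E : Subset₂ d) → size E ≡ + 4 → FugledeOutcome E
four-points E sz = few-points E rows₄ sz refl (ℕ.m≤m+n 4 1) (from-yes (all-distinct? rows₄))
    (from-yes (all-covered? rows₄)) refl

-- Dimension at most six

-- Factors of 2 are removed one at a time: a prime dividing the product divides a or b.
product-power-of-2 : ∀ d a b → a ℕ.* b ≡ 2 ℕ.^ d → ∃ λ i → ∃ λ j → i ℕ.+ j ≡ d × a ≡ 2 ℕ.^ i × b ≡ 2 ℕ.^ j
product-power-of-2 zero a b e = 0 , 0 , refl , ℕ.m*n≡1⇒m≡1 a b e , ℕ.m*n≡1⇒n≡1 a b e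
product-power-of-2 (suc d) a b e with euclidsLemma a b prime[2]
    (divides (2 ℕ.^ d) (trans e (ℕ.*-comm 2 (2 ℕ.^ d))))
... | inj₁ (divides a′ refl) with product-power-of-2 d a′ b
    (ℕ.*-cancelˡ-≡ _ _ 2 (trans (sym (ℕ.*-assoc 2 a′ b)) (trans (cong (ℕ._* b) (ℕ.*-comm 2 a′)) e)))
...   | i , j , s , p , q = suc i , j , cong suc s , trans (ℕ.*-comm a′ 2) (cong (2 ℕ.*_) p) , q
product-power-of-2 (suc d) a b e | inj₂ (divides b′ refl) with
    product-power-of-2 d a b′ (ℕ.*-cancelˡ-≡ _ _ 2
    (trans (sym (ℕ.*-assoc 2 a b′)) (trans (cong (ℕ._* b′) (ℕ.*-comm 2 a))
    (trans (ℕ.*-assoc a 2 b′) (trans (cong (a ℕ.*_) (ℕ.*-comm 2 b′)) e)))))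
...   | i , j , s , p , q = i , suc j , trans (ℕ.+-suc i j) (cong suc s) , p , trans (ℕ.*-comm b′ 2)
    (cong (2 ℕ.*_) q)

outcome⇒fuglede : {E : Subset₂ d} → FugledeOutcome E → FugledeFor E
outcome⇒fuglede (inj₁ b)       = mk⇔ (λ t → ⊥-elim (sextuple⇒¬tiles b t))
    (λ s → ⊥-elim (sextuple⇒¬spectral b s))
outcome⇒fuglede (inj₂ (t , s)) = mk⇔ (λ _ → s) (λ _ → t)

small-size : (E : Subset₂ d) (j : ℕ) → j ≤ 3 → size E ≡ N j → FugledeOutcome E
small-size E 0 _ = one-point E
small-size E 1 _ = two-points E
small-size E 2 _ = four-points E
small-size E 3 _ = eight-points E
small-size E (suc (suc (suc (suc j)))) (ℕ.s≤s (ℕ.s≤s (ℕ.s≤s ())))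

size-nonempty : {E : Subset₂ d} → Nonempty E → size E ≢ 0ℤ
size-nonempty {d} {E} (x , p) e = 0≢1 (trans (∑-≤-tight (λ y → 0≤ind (E y))
    (≤-reflexive (trans e (sym (∑-0 {d})))) x) (∈⇒𝟙 E p))
  where
  0≢1 : 0ℤ ≢ 1ℤ
  0≢1 ()

module _ {T E : Subset₂ d} (C : Complements T E) (ne : Nonempty E) where

  -- For |T| = 4 the differences of three points s, t, u are the nonzero elements of a plane, since
  -- `s ⊕ t` and `s ⊕ u` add up to `t ⊕ u`. E avoids them, and the plane is as large as T.
  small-complement : (i : ℕ) → i ≤ 2 → card T ≡ 2 ℕ.^ i → Tiles E × Spectral E
  small-complement i i≤2 card≡ = go i i≤2 (elems T) Perm.refl (trans card≡ refl) sizes′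
    where
    sizes′ : N i * size E ≡ N d
    sizes′ = trans (cong (_* size E) (trans (cong +_ (sym card≡)) (card≡size T))) (Complements.sizes C)
    difference : ∀ {s t rs} → s ∷ t ∷ rs ↭ elems T → Avoids E (s ⊕ t)
    difference {s} {t} perm = Complements.disjoint C (elems-∈ T perm)
        (elems-∈ T (Perm.trans (Perm.swap t s Perm.refl) perm)) (elems-distinct T perm)
    go : ∀ i → i ≤ 2 → ∀ ts → ts ↭ elems T → length ts ≡ 2 ℕ.^ i → N i * size E ≡ N d → Tiles E × Spectral E
    go 0 _ ts _ _ sz = full⇒ ne (trans (sym (*-identityˡ (size E))) sz)
    go 1 _ (s ∷ t ∷ []) perm _ sz = half⇒ ne sz (s ⊕ t) (difference perm)
    go 2 _ (s ∷ t ∷ u ∷ v ∷ []) perm _ sz = quarter⇒ ne sz (s ⊕ t) (s ⊕ u)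
      (difference perm) (difference (Perm.trans (Perm.prep s (Perm.swap u t Perm.refl)) perm))
      (subst (Avoids E) (sym (⊕-cancel-mid s t u))
        (difference (Perm.trans (Perm.trans (Perm.prep t (Perm.swap u s Perm.refl))
            (Perm.swap t s Perm.refl)) perm)))
    go (suc (suc (suc i))) (ℕ.s≤s (ℕ.s≤s ()))

-- The sizes are powers of 2 with product at most 64: either |T| ≤ 4, or |T| ≥ 8 and |E| ≤ 8.
tiles⇒spectral : d ≤ 6 → (E : Subset₂ d) → Nonempty E → Tiles E → Spectral E
tiles⇒spectral {d} d≤6 E ne tiles with tiles⇒complements tiles
... | T , C with product-power-of-2 d (card T) (card E)
    (+-injective (trans (pos-* (card T) (card E))
    (trans (cong₂ _*_ (card≡size T) (card≡size E)) (Complements.sizes C))))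
...   | i , j , s , p , q with i ℕ.≤? 2
...     | yes i≤2 = proj₂ (small-complement C ne i i≤2 p)
...     | no i≰2 = Equivalence.to (outcome⇒fuglede
    (small-size E j j≤3 (trans (sym (card≡size E)) (cong +_ q)))) tiles
  where
  j≤3 : j ≤ 3
  j≤3 = ℕ.+-cancelˡ-≤ 3 j 3 (ℕ.≤-trans (ℕ.+-monoˡ-≤ j (ℕ.≰⇒> i≰2)) (ℕ.≤-trans (ℕ.≤-reflexive s) d≤6))

Sizes : ℕ → Set
Sizes n = (n ≡ 1 ⊎ n ≡ 2 ⊎ n ≡ 4 ⊎ n ≡ 8) ⊎ (n ≡ 16 ⊎ n ≡ 24)

-- A finite table: 1 and 2 below 3, the multiples of 4 below 12, and the multiples of 8 from 12 to
-- 31.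
classify : ∀ n → n ℕ.< 32 → n ≢ 0 → (3 ≤ n → 4 ∣ n) → (12 ≤ n → 8 ∣ n) → Sizes n
classify n n<32 = subst Claim (Fin.toℕ-fromℕ< n<32) (table (fromℕ< n<32))
  where
  Claim : ℕ → Set
  Claim n = n ≢ 0 → (3 ≤ n → 4 ∣ n) → (12 ≤ n → 8 ∣ n) → Sizes n
  claim? : ∀ n → Dec (Claim n)
  claim? n = (¬? (n ℕ.≟ 0)) →-dec (((3 ℕ.≤? n) →-dec (4 ∣? n)) →-dec (((12 ℕ.≤? n) →-dec (8 ∣? n)) →-dec
    (((n ℕ.≟ 1) ⊎-dec ((n ℕ.≟ 2) ⊎-dec ((n ℕ.≟ 4) ⊎-dec (n ℕ.≟ 8)))) ⊎-dec ((n ℕ.≟ 16) ⊎-dec (n ℕ.≟ 24)))))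
  table : ∀ (i : Fin 32) → Claim (toℕ i)
  table = from-yes (Fin.all? (λ (i : Fin 32) → claim? (toℕ i)))

∣-from-ℤ : ∀ {n} k z → + n ≡ + k * z → k ∣ n
∣-from-ℤ {n} k z e = divides ∣ z ∣ (trans (cong ∣_∣ e) (trans (abs-* (+ k) z) (ℕ.*-comm k ∣ z ∣)))

N≤64 : ∀ {d} → d ≤ 6 → N d ℤ.≤ + 64
N≤64 d≤6 = +≤+ (ℕ.^-monoʳ-≤ 2 d≤6)

N≡64 : ∀ d → d ≤ 6 → 32 ℕ.< 2 ℕ.^ d → N d ≡ + 64
N≡64 d d≤6 lt with d ℕ.≟ 6
... | yes refl = refl
... | no n = ⊥-elim (ℕ.<⇒≱ lt (ℕ.^-monoʳ-≤ 2 {d} {5} (ℕ.s≤s⁻¹ (ℕ.≤∧≢⇒< d≤6 n))))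

-- A proper spectral E avoids some t ≢ 𝟎. If it fills half the space, t spans a complement;
-- otherwise n < 32, and divisibility leaves few sizes.
spectral⇒outcome : d ≤ 6 → (E : Subset₂ d) → Nonempty E → Spectral E → FugledeOutcome E
spectral⇒outcome {d} d≤6 E ne spectral with spectral⇒pair spectral
... | Λ , P with size E ≟ N d
...   | yes e = inj₂ (full⇒ ne e)
...   | no n≢N with nonzero-frequency (dual P)
    (λ e → size-nonempty ne (trans (sym (SpectralPair.sizes P)) e))
    (λ e → n≢N (trans (sym (SpectralPair.sizes P)) e))
...     | t , t≢𝟎 , hat≢0 = avoiding (spectrum-avoids (dual P) t t≢𝟎 hat≢0)
  where
  n = card E
  n≡ : size E ≡ + n
  n≡ = sym (card≡size E)
  avoiding : Avoids E t → FugledeOutcome E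
  avoiding av with + 2 * size E ≟ N d
  ... | yes e = inj₂ (half⇒ ne e t av)
  ... | no 2n≢N = by-size (classify n n<32 (λ e → size-nonempty ne (trans n≡ (cong +_ e))) mult4 mult8)
    where
    2n<N : n ℕ.+ n ℕ.< 2 ℕ.^ d
    2n<N = ℕ.≤∧≢⇒< (drop‿+≤+ (subst₂ (λ u v → u + v ℤ.≤ N d) n≡ n≡ (avoids⇒2n≤N E t av)))
      (λ e → 2n≢N (trans (double (size E)) (trans (cong₂ _+_ n≡ n≡) (cong +_ e))))
      where
      double : ∀ i → + 2 * i ≡ i + i
      double = solve-∀
    n<32 : n ℕ.< 32
    n<32 = ℕ.≰⇒> λ 32≤n → ℕ.<⇒≱ 2n<N (ℕ.≤-trans (drop‿+≤+ (N≤64 d≤6)) (ℕ.+-mono-≤ 32≤n 32≤n))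
    mult4 : 3 ≤ n → 4 ∣ n
    mult4 3≤n =
      case fresh E [] (subst (_<_ (+ 0)) (sym n≡) (+<+ (ℕ.≤-trans (ℕ.m≤m+n 1 2) 3≤n))) of λ { (x , x∈ , _) →
      case fresh E (x ∷ []) (subst (_<_ (+ 1)) (sym n≡) (+<+ (ℕ.≤-trans (ℕ.m≤m+n 2 1) 3≤n))) of λ
          { (y , y∈ , y∉) →
      case fresh E (x ∷ y ∷ []) (subst (_<_ (+ 2)) (sym n≡) (+<+ 3≤n)) of λ { (z , z∈ , z∉) →
      case three-points⇒4∣size P x∈ y∈ z∈ (λ e → y∉ (here (sym e))) (λ e → z∉ (here (sym e)))
          (λ e → z∉ (there (here (sym e)))) of λ { (m , e) →
        ∣-from-ℤ 4 m (trans (sym n≡) e) }}}}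
    mult8 : 12 ≤ n → 8 ∣ n
    mult8 12≤n = case size≥12⇒8∣size P (N≤64 d≤6) (subst (ℤ._≤_ (+ 12)) (sym n≡) (+≤+ 12≤n)) of λ
        { (w , e) → ∣-from-ℤ 8 w (trans (sym n≡) e) }
    by-size : Sizes n → FugledeOutcome E
    by-size (inj₁ (inj₁ e)) = one-point E (trans n≡ (cong +_ e))
    by-size (inj₁ (inj₂ (inj₁ e))) = two-points E (trans n≡ (cong +_ e))
    by-size (inj₁ (inj₂ (inj₂ (inj₁ e)))) = four-points E (trans n≡ (cong +_ e))
    by-size (inj₁ (inj₂ (inj₂ (inj₂ e)))) = eight-points E (trans n≡ (cong +_ e))
    -- From 2n < N and n = 16, N exceeds 32, so N = 64.
    by-size (inj₂ (inj₁ e)) = inj₂ (spectral-quarter⇒ P ne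
        (N≡64 d d≤6 (subst (λ n → n ℕ.+ n ℕ.< 2 ℕ.^ d) e 2n<N)) (trans n≡ (cong +_ e)))
    by-size (inj₂ (inj₂ e)) = ⊥-elim (size≢24 P (N≤64 d≤6) (trans n≡ (cong +_ e)))

fuglede-d≤6 : (d : ℕ) → d ≤ 6 → (E : Subset₂ d) → Nonempty E → FugledeFor E
fuglede-d≤6 d d≤6 E ne = mk⇔ (tiles⇒spectral d≤6 E ne)
  (λ s → Equivalence.from (outcome⇒fuglede (spectral⇒outcome d≤6 E ne s)) s)

-- Dimension at least ten

lift : Subset₂ d → Subset₂ (suc d)
lift E (b ∷ x) = not b ∧ E x

∑-lift : (E : Subset₂ d) (g : Pt (suc d) → ℤ) →
    ∑ (λ x → 𝟙 (lift E) x * g x) ≡ ∑ (λ x → 𝟙 E x * g (false ∷ x))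
∑-lift E g = trans (cong (_+_ (∑ (λ x → 𝟙 E x * g (false ∷ x))))
    (∑-zero (λ x → *-zeroˡ (g (true ∷ x))))) (+-identityʳ _)

size-lift : (E : Subset₂ d) → size (lift E) ≡ size E
size-lift {d} E = trans (cong (_+_ (size E)) (∑-0 {d})) (+-identityʳ (size E))

hat-lift : (E : Subset₂ d) (b : Bool) (ξ : Pt d) → hat (𝟙 (lift E)) (b ∷ ξ) ≡ hat (𝟙 E) ξ
hat-lift E b ξ = trans (∑-lift E (χ (b ∷ ξ)))
    (∑-cong (λ x → cong (λ u → 𝟙 E x * sgn (u xor dot ξ x)) (Bool.∧-zeroʳ b)))

-- The lifted set lies in the hyperplane of leading coordinate `false`, so its transform ignores the
-- leading frequency. This carries the counterexample to all higher dimensions.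
lift-pair : {E Λ : Subset₂ d} → SpectralPair E Λ → SpectralPair (lift E) (lift Λ)
lift-pair {E = E} {Λ} P = record
  { orth  = λ { {false ∷ l} {false ∷ m} p q n →
      trans (hat-lift E false (l ⊕ m)) (orth p q (λ e → n (cong (false ∷_) e)))
              ; {true ∷ _} () _ _ ; {false ∷ _} {true ∷ _} _ () _ }
  ; sizes = trans (size-lift Λ) (trans sizes (sym (size-lift E))) }
  where open SpectralPair P

12≢2^ : ∀ j → 12 ≢ 2 ℕ.^ j
12≢2^ 0 ()
12≢2^ 1 ()
12≢2^ 2 ()
12≢2^ 3 ()
12≢2^ (suc (suc (suc (suc j)))) e = ℕ.<⇒≱ (ℕ.m≤m+n 13 3)
    (ℕ.≤-trans (ℕ.^-monoʳ-≤ 2 (ℕ.m≤m+n 4 j)) (ℕ.≤-reflexive (sym e)))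

-- The size of a tile divides 2ᵈ and is therefore a power of 2.
twelve-points-do-not-tile : (E : Subset₂ d) → size E ≡ + 12 → ¬ Tiles E
twelve-points-do-not-tile {d} E sz tiles with tiles⇒complements tiles
... | T , C with product-power-of-2 d (card T) (card E)
    (+-injective (trans (pos-* (card T) (card E))
    (trans (cong₂ _*_ (card≡size T) (card≡size E)) (Complements.sizes C))))
...   | i , j , _ , _ , q = 12≢2^ j (trans (sym (+-injective (trans (card≡size E) sz))) q)

-- Rank factorization over ℤ₂ of the exponents of the Paley–Hadamard matrix of order 12, whose rank is 10.
points₀ frequencies₀ : List (Pt 10)
points₀ =
    (O ∷ O ∷ O ∷ O ∷ O ∷ O ∷ O ∷ O ∷ O ∷ O ∷ []) ∷
    (O ∷ O ∷ O ∷ I ∷ I ∷ I ∷ O ∷ I ∷ I ∷ O ∷ []) ∷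
    (O ∷ O ∷ I ∷ I ∷ I ∷ O ∷ I ∷ I ∷ O ∷ I ∷ []) ∷
    (O ∷ I ∷ O ∷ O ∷ O ∷ I ∷ I ∷ I ∷ O ∷ I ∷ []) ∷
    (O ∷ I ∷ I ∷ O ∷ I ∷ O ∷ O ∷ O ∷ I ∷ I ∷ []) ∷
    (O ∷ I ∷ I ∷ I ∷ O ∷ I ∷ I ∷ O ∷ I ∷ O ∷ []) ∷
    (I ∷ O ∷ O ∷ O ∷ I ∷ I ∷ I ∷ O ∷ I ∷ I ∷ []) ∷
    (I ∷ O ∷ I ∷ O ∷ O ∷ O ∷ I ∷ I ∷ I ∷ O ∷ []) ∷
    (I ∷ O ∷ I ∷ I ∷ O ∷ I ∷ O ∷ O ∷ O ∷ I ∷ []) ∷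
    (I ∷ I ∷ O ∷ I ∷ O ∷ O ∷ O ∷ I ∷ I ∷ I ∷ []) ∷
    (I ∷ I ∷ O ∷ I ∷ I ∷ O ∷ I ∷ O ∷ O ∷ O ∷ []) ∷
    (I ∷ I ∷ I ∷ O ∷ I ∷ I ∷ O ∷ I ∷ O ∷ O ∷ []) ∷ []
frequencies₀ =
    (O ∷ O ∷ O ∷ O ∷ O ∷ O ∷ O ∷ O ∷ O ∷ O ∷ []) ∷
    (O ∷ O ∷ O ∷ O ∷ O ∷ O ∷ O ∷ O ∷ O ∷ I ∷ []) ∷
    (O ∷ O ∷ O ∷ O ∷ O ∷ O ∷ O ∷ O ∷ I ∷ O ∷ []) ∷
    (O ∷ O ∷ O ∷ O ∷ O ∷ O ∷ O ∷ I ∷ O ∷ O ∷ []) ∷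
    (O ∷ O ∷ O ∷ O ∷ O ∷ O ∷ I ∷ O ∷ O ∷ O ∷ []) ∷
    (O ∷ O ∷ O ∷ O ∷ O ∷ I ∷ O ∷ O ∷ O ∷ O ∷ []) ∷
    (O ∷ O ∷ O ∷ O ∷ I ∷ O ∷ O ∷ O ∷ O ∷ O ∷ []) ∷
    (O ∷ O ∷ O ∷ I ∷ O ∷ O ∷ O ∷ O ∷ O ∷ O ∷ []) ∷
    (O ∷ O ∷ I ∷ O ∷ O ∷ O ∷ O ∷ O ∷ O ∷ O ∷ []) ∷
    (O ∷ I ∷ O ∷ O ∷ O ∷ O ∷ O ∷ O ∷ O ∷ O ∷ []) ∷
    (I ∷ O ∷ O ∷ O ∷ O ∷ O ∷ O ∷ O ∷ O ∷ O ∷ []) ∷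
    (I ∷ I ∷ I ∷ I ∷ I ∷ I ∷ I ∷ I ∷ I ∷ I ∷ []) ∷ []

indicator : List (Pt d) → Subset₂ d
indicator xs x = does (DecMembership._∈?_ _≟ᵖ_ x xs)

indicator⁻ : (xs : List (Pt d)) {x : Pt d} → x ∈ₛ indicator xs → x ∈ xs
indicator⁻ xs {x} p with DecMembership._∈?_ _≟ᵖ_ x xs
... | yes i = i
indicator⁻ xs () | no _

E₀ Λ₀ : Subset₂ 10
E₀ = indicator points₀
Λ₀ = indicator frequencies₀

abstract
  elems-E₀ : elems E₀ ≡ points₀
  elems-E₀ = refl

  elems-Λ₀ : elems Λ₀ ≡ frequencies₀
  elems-Λ₀ = refl

  -- Decided by evaluation over the 144 pairs of frequencies; off the diagonal this is orthogonality
  -- of the rows of the Hadamard matrix.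
  orthogonality-table : All (λ l → All (λ m → l ≡ m ⊎ Sₗ (χ (l ⊕ m)) points₀ ≡ 0ℤ) frequencies₀)
      frequencies₀
  orthogonality-table = from-yes (All.all? (λ l →
      All.all? (λ m → (l ≟ᵖ m) ⊎-dec (Sₗ (χ (l ⊕ m)) points₀ ≟ 0ℤ)) frequencies₀) frequencies₀)

size-E₀ : size E₀ ≡ + 12
size-E₀ = trans (sym (card≡size E₀)) (cong (λ xs → + length xs) elems-E₀)

size-Λ₀ : size Λ₀ ≡ + 12
size-Λ₀ = trans (sym (card≡size Λ₀)) (cong (λ xs → + length xs) elems-Λ₀)

pair₀ : SpectralPair E₀ Λ₀
pair₀ = record { orth = orth₀ ; sizes = trans size-Λ₀ (sym size-E₀) }
  where
  orth₀ : Orth E₀ Λ₀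
  orth₀ {l} {m} p q n with All.lookup (All.lookup orthogonality-table (indicator⁻ frequencies₀ p))
      (indicator⁻ frequencies₀ q)
  ... | inj₁ e = ⊥-elim (n e)
  ... | inj₂ e = trans (sym (Sₗ-elems E₀ (χ (l ⊕ m)))) (trans (cong (Sₗ (χ (l ⊕ m))) elems-E₀) e)

twelve-point-spectral-set : ∀ c → ∃ λ (E : Subset₂ (c ℕ.+ 10)) → ∃ λ Λ → SpectralPair E Λ × size E ≡ + 12
twelve-point-spectral-set zero = E₀ , Λ₀ , pair₀ , size-E₀
twelve-point-spectral-set (suc c) with twelve-point-spectral-set c
... | E , Λ , P , sz = lift E , lift Λ , lift-pair P , trans (size-lift E) sz

fuglede-fails-d≥10 : (d : ℕ) → 10 ≤ d → ∃ λ (E : Subset₂ d) → Nonempty E × ¬ FugledeFor E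
fuglede-fails-d≥10 d 10≤d = subst (λ d → ∃ λ (E : Subset₂ d) → Nonempty E × ¬ FugledeFor E)
    (ℕ.m∸n+n≡m 10≤d) (counterexample (d ℕ.∸ 10))
  where
  counterexample : ∀ c → ∃ λ (E : Subset₂ (c ℕ.+ 10)) → Nonempty E × ¬ FugledeFor E
  counterexample c with twelve-point-spectral-set c
  ... | E , Λ , P , sz = E , nonempty
        , λ iff → twelve-points-do-not-tile E sz (Equivalence.from iff (pair⇒spectral P))
    where
    nonempty : Nonempty E
    nonempty = case fresh E [] (subst (_<_ (+ 0)) (sym sz) (+<+ (ℕ.m≤m+n 1 11))) of λ
        { (x , p , _) → x , p }

theorem1p2 : ((d : ℕ) → d ≤ 6 → (E : Subset₂ d) → Nonempty E → FugledeFor E)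
    × ((d : ℕ) → 10 ≤ d → ∃ λ (E : Subset₂ d) → Nonempty E × ¬ FugledeFor E)
theorem1p2 = fuglede-d≤6 , fuglede-fails-d≥10
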